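{- $\mathrm{AVG}_\tau\mathrm{LCL}(O(1))\mathrm{P}=\mathrm{AVG}_\tau\mathrm{LCL}(O(1))\cap\mathrm{P}$.
   Context: A catalytic-tape machine has a read-only input tape, a write-only output tape, a read-write work tape of $s$ bits and a read-write catalytic tape of $c$ bits with arbitrary initial content $\tau\in\{0,1\}^c$. $\mathrm{AVG}_\tau\mathrm{LCL}(O(1))$ is the class of languages $L$ such that for some constants $k,C$ there is a deterministic such machine with $s=k\log n$ and $c=n^k$ that on every input $x$ of length $n$ and every $\tau$ outputs $L(x)$, and, writing $\tau'$ for the final catalytic content, $\mathbb E_\tau[d(\tau,\tau')]\le C$, where $\tau$ is uniform in $\{0,1\}^c$ and $d$ is Hamming distance. $\mathrm{AVG}_\tau\mathrm{LCL}(O(1))\mathrm{P}$ is the subclass where the machine additionally always halts within $n^k$ steps. -}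

module Defs where

open import Data.Bool using (Bool; true; false; if_then_else_)
open import Data.Nat using (ℕ; zero; suc; _+_; _*_; _^_; _≤_; _<ᵇ_)
open import Data.Nat.Logarithm using (⌈log₂_⌉)
open import Data.Fin using (Fin)
open import Data.Maybe using (Maybe; just; nothing)
open import Data.List using (List; []; _∷_; length; map; replicate; _++_)
open import Data.Nat.ListAction using (sum)
open import Data.Product using (Σ; ∃; _×_)
open import Relation.Binary.PropositionalEquality using (_≡_)

-- Machine model: read-only input tape, work tape, catalytic tape
-- (all over {0,1}); the (one-bit) answer written on the write-only
-- output tape is modelled by halting with a Bool.

data Move : Set where
  L S R : Move

data Action (q : ℕ) : Set where
  halt : Bool → Action q
  go   : (next : Fin q) (workWrite catWrite : Bool)
         (inMove workMove catMove : Move) → Action q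

record Machine : Set where
  field
    Q     : ℕ
    start : Fin Q
    -- state, input symbol (nothing = right end marker), work bit, catalytic bit
    δ     : Fin Q → Maybe Bool → Bool → Bool → Action Q

record Config (q : ℕ) : Set where
  constructor config
  field
    state : Fin q
    inH   : ℕ
    work  : List Bool
    workH : ℕ
    cat   : List Bool
    catH  : ℕ

readIn : List Bool → ℕ → Maybe Bool
readIn []       _       = nothing
readIn (b ∷ _)  zero    = just b
readIn (_ ∷ bs) (suc i) = readIn bs i

read : List Bool → ℕ → Bool
read []       _       = false
read (b ∷ _)  zero    = b
read (_ ∷ bs) (suc i) = read bs i

write : List Bool → ℕ → Bool → List Bool
write []       _       _ = []
write (_ ∷ bs) zero    v = v ∷ bs
write (b ∷ bs) (suc i) v = b ∷ write bs i v

move : ℕ → Move → ℕ → ℕ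
move len L zero    = zero
move len L (suc h) = h
move len S h       = h
move len R h       = if suc h <ᵇ len then suc h else h

data Result (q : ℕ) : Set where
  halted  : Bool → List Bool → Result q   -- answer, final catalytic content
  running : Config q → Result q

module _ (M : Machine) where
  open Machine M

  step : List Bool → Config Q → Result Q
  step x (config st ih w wh c ch) with δ st (readIn x ih) (read w wh) (read c ch)
  ... | halt b = halted b c
  ... | go st' ww cw mi mw mc =
        running (config st' (move (suc (length x)) mi ih)
                            (write w wh ww) (move (length w) mw wh)
                            (write c ch cw) (move (length c) mc ch))

  runFor : ℕ → List Bool → Result Q → Result Q
  runFor zero    x r              = r
  runFor (suc t) x (halted b c)   = halted b c
  runFor (suc t) x (running cfg)  = runFor t x (step x cfg)

  init : ℕ → List Bool → Result Q
  init s τ = running (config start zero (replicate s false) zero τ zero)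

finalCat : ∀ {q} → Result q → List Bool
finalCat (halted _ c) = c
finalCat (running cfg) = Config.cat cfg

hamming : List Bool → List Bool → ℕ
hamming []       _        = zero
hamming (_ ∷ _)  []       = zero
hamming (a ∷ as) (b ∷ bs) = (if a Data.Bool.xor b then 1 else 0) + hamming as bs
  where import Data.Bool

allBits : ℕ → List (List Bool)
allBits zero    = [] ∷ []
allBits (suc c) = map (false ∷_) (allBits c) ++ map (true ∷_) (allBits c)

Language : Set
Language = List Bool → Bool

spaceB : ℕ → ℕ → ℕ
spaceB k n = k * ⌈log₂ (n + 2) ⌉

polyB : ℕ → ℕ → ℕ
polyB k n = (n + 2) ^ k

-- AVG_τ LCL(O(1)): T x τ is a halting time of M on (x, τ);
-- sum over all τ of d(τ,τ') ≤ C · 2^c  (i.e. E_τ[d(τ,τ')] ≤ C).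
AvgLCL : Language → Set
AvgLCL Lg =
  Σ ℕ λ k → Σ ℕ λ C → Σ Machine λ M → Σ (List Bool → List Bool → ℕ) λ T →
    ((x τ : List Bool) → length τ ≡ polyB k (length x) →
       ∃ λ τ' → runFor M (T x τ) x (init M (spaceB k (length x)) τ) ≡ halted (Lg x) τ')
    ×
    ((x : List Bool) →
       sum (map (λ τ → hamming τ (finalCat (runFor M (T x τ) x (init M (spaceB k (length x)) τ))))
                (allBits (polyB k (length x))))
       ≤ C * 2 ^ polyB k (length x))

AvgLCLP : Language → Set
AvgLCLP Lg =
  Σ ℕ λ k → Σ ℕ λ C → Σ Machine λ M →
    ((x τ : List Bool) → length τ ≡ polyB k (length x) →
       ∃ λ τ' → runFor M (polyB k (length x)) x (init M (spaceB k (length x)) τ) ≡ halted (Lg x) τ')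
    ×
    ((x : List Bool) →
       sum (map (λ τ → hamming τ (finalCat (runFor M (polyB k (length x)) x (init M (spaceB k (length x)) τ))))
                (allBits (polyB k (length x))))
       ≤ C * 2 ^ polyB k (length x))

-- P: same machine model, no catalytic tape, work tape of (n+2)^k cells,
-- halting with the correct answer within (n+2)^k steps.
InP : Language → Set
InP Lg =
  Σ ℕ λ k → Σ Machine λ M →
    (x : List Bool) →
      ∃ λ τ' → runFor M (polyB k (length x)) x (init M (polyB k (length x)) []) ≡ halted (Lg x) τ'

{-# OPTIONS --safe #-}
module Submission where

-- A time-bounded machine is simulated in polynomial space, tape contents and counters being
-- kept on tracks of a single tape.
--
-- Conversely let M witness membership in AVG LCL(O(1)).  Its configuration graph on an input x
-- is a forest whose roots are the halting configurations, and the Euler tour of the component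
-- of a configuration is a permutation that can be stepped in both directions in logarithmic
-- space.  A tour of poly(n) steps, undone afterwards, restores the catalytic tape and reveals
-- the answer if it meets the root.  By Markov's inequality most contents τ are within constant
-- distance d of the final content τ′; among these, a tour without answer visits poly(n) many
-- distinct states, each of which determines τ′ and hence τ up to n^O(d) possibilities, so at
-- most half of all τ are bad.  With poly(n) independent blocks of the catalytic tape all
-- blocks are bad with exponentially small probability, and only then is the tape erased and
-- used as the work tape of the polynomial time machine.

open import Defs
open import Data.Bool using (Bool; true; false; if_then_else_; _xor_)
open import Data.Empty using (⊥; ⊥-elim)
open import Data.Fin using (Fin; zero; suc; toℕ; fromℕ; inject₁)
open import Data.Fin.Patterns
open import Data.Fin.Properties using (toℕ<n; toℕ-injective; toℕ-fromℕ; toℕ-inject₁; injective⇒≤) renaming (_≟_ to _≟ᶠ_)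
open import Data.List using (List; []; _∷_; _++_; length; map; concatMap; allFin; upTo; lookup; replicate; filter; take; drop; cartesianProduct)
open import Data.List.Membership.Propositional using (_∈_; _∉_)
open import Data.List.Membership.Propositional.Properties using (∈-map⁺; ∈-map⁻; ∈-++⁺ˡ; ∈-++⁺ʳ; ∈-++⁻; ∈-concatMap⁺; ∈-cartesianProduct⁺; ∈-cartesianProduct⁻; ∈-allFin; ∈-upTo⁺; ∈-upTo⁻; ∈-filter⁺; ∈-filter⁻; ∈-lookup)
open import Data.List.Properties using (length-++; length-map; length-tabulate; length-upTo; length-take; length-drop; length-replicate; length-filter; take++drop≡id; drop-drop; ++-identityʳ; ∷-injectiveʳ)
open import Data.List.Relation.Unary.All as All using (All; []; _∷_)
open import Data.List.Relation.Unary.AllPairs using ([]; _∷_)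
open import Data.List.Relation.Unary.Any as Any using (here; there)
open import Data.List.Relation.Unary.Any.Properties using (lookup-index)
open import Data.List.Relation.Unary.Unique.Propositional using (Unique)
import Data.List.Relation.Unary.Unique.Propositional.Properties as Uniq
open import Data.Maybe using (Maybe; just; nothing; _<∣>_; fromMaybe)
open import Data.Nat
open import Data.Nat.Induction using (<-wellFounded)
open import Data.Nat.ListAction using (sum)
open import Data.Nat.Logarithm using (⌈log₂_⌉)
open import Data.Nat.Logarithm.Core using (⌈log2⌉-acc-irrelevant)
open import Data.Nat.Properties
open import Data.Nat.Tactic.RingSolver using (solve-∀)
open import Data.Product using (Σ; ∃; _×_; _,_; proj₁; proj₂; map₂; uncurry)
open import Data.Product.Properties using (,-injective)
open import Data.Sum using (_⊎_; inj₁; inj₂)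
open import Data.Unit using (⊤; tt)
open import Data.Vec using (Vec; []; _∷_) renaming (lookup to vlookup; _[_]≔_ to _[_]:=_; replicate to vreplicate)
open import Data.Vec.Properties using (lookup∘update; lookup∘update′; lookup-replicate; []≔-idempotent)
open import Induction.WellFounded using (Acc; acc)
open import Relation.Binary.Definitions using (tri<; tri≈; tri>)
open import Relation.Binary.PropositionalEquality hiding (J)
open import Relation.Nullary using (¬_; yes; no; Dec; contradiction)
open import Relation.Nullary.Decidable using (_×-dec_; map′)
open import Relation.Unary using (Decidable)

-- Structured programs and their compilation to machines

-- A run of M cannot simply be broken off: it may take exponentially long, and a transition forgets
-- what it overwrites, so an interrupted run could leave damage beyond repair. A step of the tour
-- can be taken back from the present configuration alone; the price is that the tour also visits
-- configurations which no run from τ meets. Whether t steps suffice then depends on the size of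
-- trees, and this is controlled only on average over τ: there are 2^c times poly(n) configurations
-- in all, so many τ can lie in large trees only if many of them share a tree, which small distance
-- to the common final content excludes. Membership in P serves the fallback alone. Its damage is
-- bounded by nothing better than the tape length N^K, but it occurs with probability at most 2^-t,
-- and t ≥ N^2 makes the product a constant. The classes are defined by concrete machines, so all
-- procedures are written as structured programs over counters, and the time exponents are read off
-- their syntax. Counters are binary where space is logarithmic and unary where it is polynomial.

record Finite (A : Set) : Set where
  field
    elems    : List A
    complete : ∀ a → a ∈ elems

  size : ℕ
  size = length elems

  encode : A → Fin size
  encode a = Any.index (complete a)

  decode : Fin size → A
  decode = lookup elems

  decode-encode : ∀ a → decode (encode a) ≡ a
  decode-encode a = sym (lookup-index (complete a))

  encode-injective : ∀ {a b} → encode a ≡ encode b → a ≡ b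
  encode-injective {a} {b} p = trans (sym (decode-encode a)) (trans (cong decode p) (decode-encode b))

open Finite ⦃ ... ⦄

Finite-Σ : {A : Set} {B : A → Set} → Finite A → (∀ a → Finite (B a)) → Finite (Σ A B)
Finite-Σ {A} {B} fA fB = record
  { elems    = concatMap block (Finite.elems fA)
  ; complete = λ (a , b) →
      ∈-concatMap⁺ block
        (Any.map (λ where refl → ∈-map⁺ (a ,_) (Finite.complete (fB a) b)) (Finite.complete fA a))
  }
  where
  block : A → List (Σ A B)
  block a = map (a ,_) (Finite.elems (fB a))

Finite-⊎ : {A B : Set} → Finite A → Finite B → Finite (A ⊎ B)
Finite-⊎ fA fB = record
  { elems    = map inj₁ (Finite.elems fA) ++ map inj₂ (Finite.elems fB)
  ; complete = λ where
      (inj₁ a) → ∈-++⁺ˡ (∈-map⁺ inj₁ (Finite.complete fA a))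
      (inj₂ b) → ∈-++⁺ʳ _ (∈-map⁺ inj₂ (Finite.complete fB b))
  }

instance
  finite-⊤ : Finite ⊤
  finite-⊤ = record { elems = tt ∷ [] ; complete = λ _ → here refl }

  finite-Bool : Finite Bool
  finite-Bool = record
    { elems = false ∷ true ∷ []
    ; complete = λ where
        false → here refl
        true  → there (here refl)
    }

  finite-Move : Finite Move
  finite-Move = record
    { elems = L ∷ S ∷ R ∷ []
    ; complete = λ where
        L → here refl
        S → there (here refl)
        R → there (there (here refl))
    }

  finite-Fin : ∀ {n} → Finite (Fin n)
  finite-Fin = record { elems = allFin _ ; complete = ∈-allFin }

  finite-Maybe : {A : Set} ⦃ _ : Finite A ⦄ → Finite (Maybe A)
  finite-Maybe = record
    { elems = nothing ∷ map just elems
    ; complete = λ where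
        nothing  → here refl
        (just a) → there (∈-map⁺ just (complete a))
    }

  finite-× : {A B : Set} ⦃ _ : Finite A ⦄ ⦃ _ : Finite B ⦄ → Finite (A × B)
  finite-× = record
    { elems = cartesianProduct elems elems
    ; complete = λ (a , b) → ∈-cartesianProduct⁺ (complete a) (complete b)
    }

  finite-⊎ : {A B : Set} ⦃ _ : Finite A ⦄ ⦃ _ : Finite B ⦄ → Finite (A ⊎ B)
  finite-⊎ ⦃ fA ⦄ ⦃ fB ⦄ = Finite-⊎ fA fB

Reads : Set
Reads = Maybe Bool × Bool × Bool

record Writes : Set where
  constructor writes
  field
    workWrite catWrite       : Bool
    inMove workMove catMove : Move

-- Every machine step writes on both tapes and moves the heads; writing back what was read gives a
-- step without effect on the memory. Control passes between programs by such steps.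
keep : Reads → Writes
keep (_ , a , b) = writes a b S S S

record Mem : Set where
  constructor mem
  field
    inH   : ℕ
    work  : List Bool
    workH : ℕ
    cat   : List Bool
    catH  : ℕ

-- `loop e b x` restarts b as long as it exits with inj₁; e annotates the bound
-- (n+2)^e on the number of rounds.
data Prog : Set → Set₁ where
  ret  : ∀ {E} → E → Prog E
  act  : (Reads → Writes) → Prog Reads
  bind : ∀ {X E} ⦃ _ : Finite X ⦄ → Prog X → (X → Prog E) → Prog E
  loop : ∀ {X E} ⦃ _ : Finite X ⦄ → ℕ → (X → Prog (X ⊎ E)) → X → Prog E

infixr 5 _▸_
_▸_ : ∀ {X E} ⦃ _ : Finite X ⦄ → Prog X → Prog E → Prog E
P ▸ Q = bind P λ _ → Q

-- Program counters, which become the states of the compiled machine. The symbols read by an `act`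
-- and the values handed on by `bind` and `loop` are stored in them; hence the demand that these
-- types be finite.
Loc : ∀ {E} → Prog E → Set
Loc (ret e)            = ⊤
Loc (act f)            = ⊤ ⊎ Reads
Loc (bind {X} P k)     = Loc P ⊎ Σ X λ x → Loc (k x)
Loc (loop {X} e b x)   = Σ X λ x → Loc (b x)

finite-Loc : ∀ {E} (P : Prog E) → Finite (Loc P)
finite-Loc (ret e)    = finite-⊤
finite-Loc (act f)    = finite-⊎
finite-Loc (bind ⦃ fX ⦄ P k)   = Finite-⊎ (finite-Loc P) (Finite-Σ fX λ x → finite-Loc (k x))
finite-Loc (loop ⦃ fX ⦄ e b x) = Finite-Σ fX λ x → finite-Loc (b x)

entry : ∀ {E} (P : Prog E) → Loc P
entry (ret e)      = tt
entry (act f)      = inj₁ tt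
entry (bind P k)   = inj₁ (entry P)
entry (loop e b x) = x , entry (b x)

-- A program exits without writing. An enclosing `bind` or `loop` with something left to do turns
-- the exit into a `keep` step to the entry of what follows; at the outermost level `compile` turns
-- it into `halt`.
next : ∀ {E} (P : Prog E) → Loc P → Reads → (Writes × Loc P) ⊎ E
after-fst : ∀ {X E} ⦃ _ : Finite X ⦄ (P : Prog X) (k : X → Prog E) → Reads →
            (Writes × Loc P) ⊎ X → (Writes × Loc (bind P k)) ⊎ E
after-fst P k r (inj₁ (w , p)) = inj₁ (w , inj₁ p)
after-fst P k r (inj₂ x)       = inj₁ (keep r , inj₂ (x , entry (k x)))
after-snd : ∀ {X E} ⦃ _ : Finite X ⦄ (P : Prog X) (k : X → Prog E) → ∀ x →
            (Writes × Loc (k x)) ⊎ E → (Writes × Loc (bind P k)) ⊎ E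
after-snd P k x (inj₁ (w , p)) = inj₁ (w , inj₂ (x , p))
after-snd P k x (inj₂ e)       = inj₂ e
after-body : ∀ {X E} ⦃ _ : Finite X ⦄ m (b : X → Prog (X ⊎ E)) y → Reads → ∀ x →
             (Writes × Loc (b x)) ⊎ (X ⊎ E) → (Writes × Loc (loop m b y)) ⊎ E
after-body m b y r x (inj₁ (w , p))   = inj₁ (w , (x , p))
after-body m b y r x (inj₂ (inj₁ x′)) = inj₁ (keep r , (x′ , entry (b x′)))
after-body m b y r x (inj₂ (inj₂ e))  = inj₂ e
next (ret e) _ r = inj₂ e
next (act f) (inj₁ _)  r = inj₁ (f r , inj₂ r)
next (act f) (inj₂ r′) r = inj₂ r′
next (bind P k) (inj₁ p)       r = after-fst P k r (next P p r)
next (bind P k) (inj₂ (x , p)) r = after-snd P k x (next (k x) p r)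
next (loop m b y) (x , p)      r = after-body m b y r x (next (b x) p r)

-- the running time of P is at most (n+2)^(expo P)
expo : ∀ {E} → Prog E → ℕ
expo (ret e)      = 0
expo (act f)      = 1
expo (bind P k)   = suc (expo P + sum (map (λ x → expo (k x)) elems))
expo (loop e b x) = e + suc (sum (map (λ x → expo (b x)) elems))

∈⇒≤sum : ∀ {A : Set} (f : A → ℕ) {a xs} → a ∈ xs → f a ≤ sum (map f xs)
∈⇒≤sum f (here refl) = m≤m+n _ _
∈⇒≤sum f (there p)   = m≤n⇒m≤o+n _ (∈⇒≤sum f p)

compile : Prog Bool → Machine
compile P = record
  { Q     = Finite.size fP
  ; start = Finite.encode fP (entry P)
  ; δ     = λ q i a b → action (next P (Finite.decode fP q) (i , a , b))
  }
  where
  fP : Finite (Loc P)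
  fP = finite-Loc P
  action : (Writes × Loc P) ⊎ Bool → Action (Finite.size fP)
  action (inj₁ (writes ww cw mi mw mc , p)) = go (Finite.encode fP p) ww cw mi mw mc
  action (inj₂ b) = halt b

write-read : ∀ l i → write l i (read l i) ≡ l
write-read []      i       = refl
write-read (b ∷ l) zero    = refl
write-read (b ∷ l) (suc i) = cong (b ∷_) (write-read l i)

-- Semantics and running time of programs

module _ (x : List Bool) where

  reads : Mem → Reads
  reads (mem ih w wh c ch) = readIn x ih , read w wh , read c ch

  apply : Writes → Mem → Mem
  apply (writes ww cw mi mw mc) (mem ih w wh c ch) =
    mem (move (suc (length x)) mi ih) (write w wh ww) (move (length w) mw wh) (write c ch cw) (move (length c) mc ch)

  -- The exit counts as one step. It is paid for by the halting transition of the compiled machine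
  -- or by the `keep` step of an enclosing program, so that durations simply add up in `Reach-bind`.
  data Reach {E} (P : Prog E) : Loc P → Mem → ℕ → E → Mem → Set where
    done : ∀ {p σ e} → next P p (reads σ) ≡ inj₂ e → Reach P p σ 1 e σ
    more : ∀ {p σ w p′ t e σ′} → next P p (reads σ) ≡ inj₁ (w , p′) →
           Reach P p′ (apply w σ) t e σ′ → Reach P p σ (suc t) e σ′

  apply-keep : ∀ σ → apply (keep (reads σ)) σ ≡ σ
  apply-keep (mem ih w wh c ch) rewrite write-read w wh | write-read c ch = refl

  Reach-bindʳ : ∀ {X E} ⦃ _ : Finite X ⦄ {P : Prog X} {k : X → Prog E} {y p σ t e σ′} →
    Reach (k y) p σ t e σ′ → Reach (bind P k) (inj₂ (y , p)) σ t e σ′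
  Reach-bindʳ {P = P} {k} {y} (done eq)   = done (cong (after-snd P k y) eq)
  Reach-bindʳ {P = P} {k} {y} (more eq r) = more (cong (after-snd P k y) eq) (Reach-bindʳ r)

  Reach-bind : ∀ {X E} ⦃ _ : Finite X ⦄ {P : Prog X} {k : X → Prog E} {y p σ t t′ e σ₁ σ₂} →
    Reach P p σ t y σ₁ → Reach (k y) (entry (k y)) σ₁ t′ e σ₂ →
    Reach (bind P k) (inj₁ p) σ (t + t′) e σ₂
  Reach-bind {P = P} {k} {σ = σ} (done eq) r =
    more (cong (after-fst P k (reads σ)) eq)
      (subst (λ z → Reach (bind P k) _ z _ _ _) (sym (apply-keep σ)) (Reach-bindʳ r))
  Reach-bind {P = P} {k} {σ = σ} (more eq r₁) r₂ =
    more (cong (after-fst P k (reads σ)) eq) (Reach-bind r₁ r₂)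

  Reach-loop-last : ∀ {X E} ⦃ _ : Finite X ⦄ {m} {b : X → Prog (X ⊎ E)} {y₀ y p σ t e σ₁} →
    Reach (b y) p σ t (inj₂ e) σ₁ → Reach (loop m b y₀) (y , p) σ t e σ₁
  Reach-loop-last {m = m} {b} {y₀} {y} {σ = σ} (done eq) = done (cong (after-body m b y₀ (reads σ) y) eq)
  Reach-loop-last {m = m} {b} {y₀} {y} {σ = σ} (more eq r) =
    more (cong (after-body m b y₀ (reads σ) y) eq) (Reach-loop-last r)

  Reach-loop-again : ∀ {X E} ⦃ _ : Finite X ⦄ {m} {b : X → Prog (X ⊎ E)} {y₀ y y′ p σ t t′ e σ₁ σ₂} →
    Reach (b y) p σ t (inj₁ y′) σ₁ → Reach (loop m b y₀) (y′ , entry (b y′)) σ₁ t′ e σ₂ →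
    Reach (loop m b y₀) (y , p) σ (t + t′) e σ₂
  Reach-loop-again {m = m} {b} {y₀} {y} {σ = σ} (done eq) r =
    more (cong (after-body m b y₀ (reads σ) y) eq)
      (subst (λ z → Reach (loop m b y₀) _ z _ _ _) (sym (apply-keep σ)) r)
  Reach-loop-again {m = m} {b} {y₀} {y} {σ = σ} (more eq r₁) r₂ =
    more (cong (after-body m b y₀ (reads σ) y) eq) (Reach-loop-again r₁ r₂)

  N : ℕ
  N = length x + 2

  2≤N : 2 ≤ N
  2≤N = m≤n+m 2 (length x)

  N^-mono : ∀ {a b} → a ≤ b → N ^ a ≤ N ^ b
  N^-mono = ^-monoʳ-≤ N ⦃ >-nonZero (≤-trans (s≤s z≤n) 2≤N) ⦄

  1+[N^e∸1] : ∀ e → suc (N ^ e ∸ 1) ≡ N ^ e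
  1+[N^e∸1] e = m+[n∸m]≡n {1} (N^-mono {0} {e} z≤n)

  N^+N^ : ∀ {a b e} → a ≤ e → b ≤ e → N ^ a + N ^ b ≤ N ^ suc e
  N^+N^ {a} {b} {e} p q = ≤-trans (+-mono-≤ (N^-mono p) (N^-mono q))
    (≤-trans (≤-reflexive (cong (N ^ e +_) (sym (+-identityʳ (N ^ e))))) (*-monoˡ-≤ (N ^ e) 2≤N))

  -- A Hoare triple for total correctness with a time bound. `Rep` relates abstract states to
  -- memories, so that specifications of higher layers need not mention tape cells.
  record Does {A : Set} {E} (Rep : A → Mem → Set) (P : Prog E) (a : A) (e : E) (a′ : A) : Set where
    constructor does
    field
      run : ∀ σ → Rep a σ → ∃ λ t → ∃ λ σ′ → t ≤ N ^ expo P × Reach P (entry P) σ t e σ′ × Rep a′ σ′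

  open Does public

  module _ {A : Set} {Rep : A → Mem → Set} where

    -- Since N ≥ 2, a sum of two powers of N is at most one power with the exponent increased by
    -- one. Which continuation is taken is known only at run time; this is why `expo` sums over all
    -- of them.
    then : ∀ {X E} ⦃ _ : Finite X ⦄ {P : Prog X} {k : X → Prog E} {y e a a₁ a₂} →
      Does Rep P a y a₁ → Does Rep (k y) a₁ e a₂ → Does Rep (bind P k) a e a₂
    then {P = P} {k} {y} d₁ d₂ .run σ r with run d₁ σ r
    ... | t , σ₁ , t≤ , reach , r₁ with run d₂ σ₁ r₁
    ... | t′ , σ₂ , t′≤ , reach′ , r₂ =
      t + t′ , σ₂ ,
      ≤-trans (+-mono-≤ t≤ t′≤)
        (N^+N^ (m≤m+n (expo P) _) (m≤n⇒m≤o+n (expo P) (∈⇒≤sum (λ z → expo (k z)) (complete y)))) ,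
      Reach-bind reach reach′ , r₂

    data Rounds {X E} (b : X → Prog (X ⊎ E)) : X → A → ℕ → E → A → Set where
      last  : ∀ {y a e a′} → Does Rep (b y) a (inj₂ e) a′ → Rounds b y a 1 e a′
      again : ∀ {y y′ a a₁ m e a′} → Does Rep (b y) a (inj₁ y′) a₁ →
              Rounds b y′ a₁ m e a′ → Rounds b y a (suc m) e a′

    Does-loop : ∀ {X E} ⦃ _ : Finite X ⦄ {b : X → Prog (X ⊎ E)} {m y a k e a′} →
      Rounds b y a k e a′ → k ≤ N ^ m → Does Rep (loop m b y) a e a′
    Does-loop {X} {E} {b = b} {m} {y₀} {k = k₀} rs₀ k≤ .run σ₀ r₀ = bounded (rounds rs₀ σ₀ r₀)
      where
      B : ℕ
      B = suc (sum (map (λ y → expo (b y)) elems))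
      body≤ : ∀ y → N ^ expo (b y) ≤ N ^ B
      body≤ y = N^-mono (m≤n⇒m≤1+n (∈⇒≤sum (λ z → expo (b z)) (complete y)))
      rounds : ∀ {y a k e a′} → Rounds b y a k e a′ → ∀ σ → Rep a σ → ∃ λ t → ∃ λ σ′ →
        t ≤ k * N ^ B × Reach (loop m b y₀) (y , entry (b y)) σ t e σ′ × Rep a′ σ′
      rounds (last {y} d) σ r with run d σ r
      ... | t , σ′ , t≤ , reach , r′ =
        t , σ′ , ≤-trans t≤ (≤-trans (body≤ y) (≤-reflexive (sym (+-identityʳ _)))) , Reach-loop-last reach , r′
      rounds (again {y} d rs) σ r with run d σ r
      ... | t , σ₁ , t≤ , reach , r₁ with rounds rs σ₁ r₁
      ... | t′ , σ₂ , t′≤ , reach′ , r₂ =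
        t + t′ , σ₂ , +-mono-≤ (≤-trans t≤ (body≤ y)) t′≤ , Reach-loop-again reach reach′ , r₂
      bounded : ∀ {e a′} →
        (∃ λ t → ∃ λ σ′ → t ≤ k₀ * N ^ B × Reach (loop m b y₀) (y₀ , entry (b y₀)) σ₀ t e σ′ × Rep a′ σ′) →
        ∃ λ t → ∃ λ σ′ → t ≤ N ^ (m + B) × Reach (loop m b y₀) (y₀ , entry (b y₀)) σ₀ t e σ′ × Rep a′ σ′
      bounded (t , σ′ , t≤ , reach , r′) =
        t , σ′ ,
        ≤-trans t≤ (≤-trans (*-monoˡ-≤ (N ^ B) k≤) (≤-reflexive (sym (^-distribˡ-+-* N m B)))) , reach , r′

  Is : Mem → Mem → Set
  Is a σ = a ≡ σ

  Does-act : ∀ {f σ} → Does Is (act f) σ (reads σ) (apply (f (reads σ)) σ)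
  Does-act {f} {σ} .run .σ refl = 2 , _ , ≤-trans 2≤N (≤-reflexive (sym (*-identityʳ _))) , more refl (done refl) , refl

  lift-Is : ∀ {A : Set} {Rep : A → Mem → Set} {E} {P : Prog E} {a e a′} →
    (∀ σ → Rep a σ → ∃ λ σ′ → Does Is P σ e σ′ × Rep a′ σ′) → Does Rep P a e a′
  lift-Is f .run σ r with f σ r
  ... | σ′ , d , r′ with run d σ refl
  ... | t , .σ′ , t≤ , reach , refl = t , σ′ , t≤ , reach , r′

  runFor-halted : ∀ M t b c → runFor M t x (halted b c) ≡ halted b c
  runFor-halted M zero    b c = refl
  runFor-halted M (suc t) b c = refl

  runFor-mono : ∀ M {t t′ r b c} → t ≤ t′ → runFor M t x r ≡ halted b c → runFor M t′ x r ≡ halted b c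
  runFor-mono M {t′ = t′} {r = halted _ _} z≤n refl = runFor-halted M t′ _ _
  runFor-mono M {r = halted _ _} (s≤s p) refl = refl
  runFor-mono M {r = running _}  (s≤s p) eq   = runFor-mono M p eq

  compile-correct : ∀ P {p σ t b σ′} → Reach P p σ t b σ′ →
    runFor (compile P) t x
      (running (config (Finite.encode (finite-Loc P) p) (Mem.inH σ) (Mem.work σ) (Mem.workH σ) (Mem.cat σ) (Mem.catH σ)))
    ≡ halted b (Mem.cat σ′)
  compile-correct P {p} (done eq) rewrite Finite.decode-encode (finite-Loc P) p | eq = refl
  compile-correct P {p} (more {w = writes _ _ _ _ _} eq r)
    rewrite Finite.decode-encode (finite-Loc P) p | eq = compile-correct P r

exit : ∀ {x A} {Rep : A → Mem → Set} {E} {P : Prog E} {a e e′ a′} → e ≡ e′ → Does x Rep P a e a′ → Does x Rep P a e′ a′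
exit refl d = d

to : ∀ {x A} {Rep : A → Mem → Set} {E} {P : Prog E} {a e a′ a″} → a′ ≡ a″ → Does x Rep P a e a′ → Does x Rep P a e a″
to refl d = d

infixr 5 _▷_
_▷_ : ∀ {x A} {Rep : A → Mem → Set} {X E} ⦃ _ : Finite X ⦄ {P : Prog X} {k : X → Prog E} {y e a a₁ a₂} →
  Does x Rep P a y a₁ → Does x Rep (k y) a₁ e a₂ → Does x Rep (bind P k) a e a₂
_▷_ {x} = then x

Does-ret : ∀ {x A} {Rep : A → Mem → Set} {E} {e : E} {a} → Does x Rep (ret e) a e a
Does-ret {x} .run σ r = 1 , σ , ≤-refl , done refl , r

-- Tracks on the work tape

length-write : ∀ l i v → length (write l i v) ≡ length l
length-write []      i       v = refl
length-write (b ∷ l) zero    v = refl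
length-write (b ∷ l) (suc i) v = cong suc (length-write l i v)

read-write-same : ∀ l i v → i < length l → read (write l i v) i ≡ v
read-write-same (b ∷ l) zero    v p       = refl
read-write-same (b ∷ l) (suc i) v (s≤s p) = read-write-same l i v p

read-write-other : ∀ l i j v → i ≢ j → read (write l i v) j ≡ read l j
read-write-other []      i       j       v p = refl
read-write-other (b ∷ l) zero    zero    v p = contradiction refl p
read-write-other (b ∷ l) zero    (suc j) v p = refl
read-write-other (b ∷ l) (suc i) zero    v p = refl
read-write-other (b ∷ l) (suc i) (suc j) v p = read-write-other l i j v (λ q → p (cong suc q))

move-R : ∀ {len h} → suc h < len → move len R h ≡ suc h
move-R {len} {h} p with suc h <ᵇ len | <⇒<ᵇ p
... | true | _ = refl

-- Uniqueness of quotient and remainder. It shows that different pairs of a block and a track occupy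
-- different cells.
*+-unique : ∀ {B} i j {a b} → a < B → b < B → i * B + a ≡ j * B + b → i ≡ j × a ≡ b
*+-unique zero zero _ _ eq = refl , eq
*+-unique {B} zero (suc j) {a} {b} p _ eq =
  contradiction p (≤⇒≯ (≤-trans (m≤m+n B (j * B + b)) (≤-reflexive (sym (trans eq (+-assoc B (j * B) b))))))
*+-unique {B} (suc i) zero {a} {b} _ q eq =
  contradiction q (≤⇒≯ (≤-trans (m≤m+n B (i * B + a)) (≤-reflexive (trans (sym (+-assoc B (i * B) a)) eq))))
*+-unique {B} (suc i) (suc j) {a} {b} p q eq with *+-unique i j p q
  (+-cancelˡ-≡ B _ _ (trans (sym (+-assoc B (i * B) a)) (trans eq (+-assoc B (j * B) b))))
... | refl , r = refl , r

-- the work tape is cut into blocks of one bit per track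
data Track (J : ℕ) : Set where
  left wbit wmark cbit cmark : Track J
  used digit : Fin J → Track J

instance
  finite-Track : ∀ {J} → Finite (Track J)
  finite-Track {J} = record
    { elems = left ∷ wbit ∷ wmark ∷ cbit ∷ cmark ∷ map used (allFin J) ++ map digit (allFin J)
    ; complete = λ where
        left      → here refl
        wbit      → there (here refl)
        wmark     → there (there (here refl))
        cbit      → there (there (there (here refl)))
        cmark     → there (there (there (there (here refl))))
        (used r)  → there (there (there (there (there (∈-++⁺ˡ (∈-map⁺ used (∈-allFin r)))))))
        (digit r) → there (there (there (there (there (∈-++⁺ʳ _ (∈-map⁺ digit (∈-allFin r)))))))
    }

_≟ᵗ_ : ∀ {J} (a b : Track J) → Dec (a ≡ b)
a ≟ᵗ b with encode a ≟ᶠ encode b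
... | yes p = yes (encode-injective p)
... | no ¬p = no λ { refl → ¬p refl }

stepWork : Move → Reads → Writes
stepWork m (_ , a , b) = writes a b S m S

shift : Move → ℕ → Prog ⊤
shift m zero    = ret tt
shift m (suc j) = act (stepWork m) ▸ shift m j

module Tracks (J eW : ℕ) where

  B : ℕ
  B = size ⦃ finite-Track {J} ⦄

  off : Track J → ℕ
  off tr = toℕ (encode tr)

  off<B : ∀ tr → off tr < B
  off<B tr = toℕ<n (encode tr)

  getT : Track J → Prog Bool
  getT tr = shift R (off tr) ▸ bind (act keep) λ r → shift L (off tr) ▸ ret (proj₁ (proj₂ r))

  setT : Track J → Bool → Prog ⊤
  setT tr v = shift R (off tr) ▸ act (λ (_ , _ , b) → writes v b S S S) ▸ shift L (off tr)

  nextBlock prevBlock : Prog ⊤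
  nextBlock = shift R B
  prevBlock = shift L B

  -- A head that is moved left at the left end stays there and the machine does not notice. The
  -- track `left`, set in block 0 only, makes the end visible.
  homeRound : ⊤ → Prog (⊤ ⊎ ⊤)
  homeRound _ = bind (getT left) λ where
    true  → ret (inj₂ tt)
    false → prevBlock ▸ ret (inj₁ tt)

  home : Prog ⊤
  home = loop eW homeRound tt

  seekRound : Track J → ⊤ → Prog (⊤ ⊎ ⊤)
  seekRound tr _ = bind (getT tr) λ where
    true  → ret (inj₂ tt)
    false → nextBlock ▸ ret (inj₁ tt)

  seek : Track J → Prog ⊤
  seek tr = loop eW (seekRound tr) tt

  abstract
    upd : (ℕ → Track J → Bool) → ℕ → Track J → Bool → ℕ → Track J → Bool
    upd T i tr v i′ tr′ with i ≟ i′ | tr ≟ᵗ tr′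
    ... | yes _ | yes _ = v
    ... | _     | _     = T i′ tr′

    upd-same : ∀ T i tr v → upd T i tr v i tr ≡ v
    upd-same T i tr v with i ≟ i | tr ≟ᵗ tr
    ... | yes _ | yes _ = refl
    ... | no ¬p | _     = contradiction refl ¬p
    ... | yes _ | no ¬p = contradiction refl ¬p

    upd-block : ∀ T {i tr v i′ tr′} → i ≢ i′ → upd T i tr v i′ tr′ ≡ T i′ tr′
    upd-block T {i} {tr} {v} {i′} {tr′} ¬p with i ≟ i′ | tr ≟ᵗ tr′
    ... | yes p | _     = contradiction p ¬p
    ... | no  _ | yes _ = refl
    ... | no  _ | no _  = refl

    upd-track : ∀ T {i tr v i′ tr′} → tr ≢ tr′ → upd T i tr v i′ tr′ ≡ T i′ tr′
    upd-track T {i} {tr} {v} {i′} {tr′} ¬p with i ≟ i′ | tr ≟ᵗ tr′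
    ... | _     | yes p = contradiction p ¬p
    ... | yes _ | no _  = refl
    ... | no _  | no _  = refl

  module Representation (x : List Bool) (W : ℕ) (W≤ : W ≤ N x ^ eW) where

    apply-stepWork : ∀ m ih w wh c ch →
      apply x (stepWork m (reads x (mem ih w wh c ch))) (mem ih w wh c ch) ≡ mem ih w (move (length w) m wh) c ch
    apply-stepWork m ih w wh c ch rewrite write-read w wh | write-read c ch = refl

    shift-R : ∀ {ih w c ch} j wh → wh + j < length w →
      Does x (Is x) (shift R j) (mem ih w wh c ch) tt (mem ih w (wh + j) c ch)
    shift-R zero wh p rewrite +-identityʳ wh = Does-ret
    shift-R {ih} {w} {c} {ch} (suc j) wh p rewrite +-suc wh j =
      subst (Does x (Is x) (act (stepWork R)) (mem ih w wh c ch) _) one (Does-act x) ▷ shift-R j (suc wh) p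
      where
      one : apply x (stepWork R (reads x (mem ih w wh c ch))) (mem ih w wh c ch) ≡ mem ih w (suc wh) c ch
      one = trans (apply-stepWork R ih w wh c ch)
        (cong (λ z → mem ih w z c ch) (move-R (≤-trans (s≤s (s≤s (m≤m+n wh j))) p)))

    shift-L : ∀ {ih w c ch} j wh →
      Does x (Is x) (shift L j) (mem ih w (j + wh) c ch) tt (mem ih w wh c ch)
    shift-L zero wh = Does-ret
    shift-L {ih} {w} {c} {ch} (suc j) wh =
      subst (Does x (Is x) (act (stepWork L)) (mem ih w (suc j + wh) c ch) _)
                         (apply-stepWork L ih w (suc j + wh) c ch) (Does-act x) ▷ shift-L j wh

    record Blocks : Set where
      constructor blocks
      field
        inH  : ℕ
        bits : ℕ → Track J → Bool
        pos  : ℕ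
        cat  : List Bool
        catH : ℕ

    data RepB : Blocks → Mem → Set where
      repB : ∀ {ih w T i c ch} → i < W → W * B ≤ length w →
             (∀ i tr → i < W → read w (i * B + off tr) ≡ T i tr) →
             RepB (blocks ih T i c ch) (mem ih w (i * B) c ch)

    DoesB : ∀ {E} → Prog E → Blocks → E → Blocks → Set
    DoesB = Does x RepB

    private
      cell< : ∀ (w : List Bool) {i tr} → i < W → W * B ≤ length w → i * B + off tr < length w
      cell< w {i} {tr} i<W len =
        ≤-trans (+-monoʳ-< (i * B) (off<B tr)) (≤-trans (≤-reflexive (+-comm (i * B) B)) (≤-trans (*-monoˡ-≤ B i<W) len))

    getT-does : ∀ {ih T i c ch} tr → DoesB (getT tr) (blocks ih T i c ch) (T i tr) (blocks ih T i c ch)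
    getT-does {ih} {T} {i} {c} {ch} tr = lift-Is x λ where
      (mem _ w _ _ _) (repB i<W len cells) →
        mem ih w (i * B) c ch ,
        subst (λ v → Does x (Is x) (getT tr) (mem ih w (i * B) c ch) v (mem ih w (i * B) c ch)) (cells i tr i<W)
          (shift-R (off tr) (i * B) (cell< w {tr = tr} i<W len) ▷
            subst (Does x (Is x) (act keep) _ _) (apply-keep x _) (Does-act x) ▷
              subst (λ z → Does x (Is x) (shift L (off tr)) (mem ih w z c ch) tt (mem ih w (i * B) c ch))
                             (+-comm (off tr) (i * B)) (shift-L (off tr) (i * B)) ▷ Does-ret) ,
        repB i<W len cells

    setT-does : ∀ {ih T i c ch} tr v → DoesB (setT tr v) (blocks ih T i c ch) tt (blocks ih (upd T i tr v) i c ch)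
    setT-does {ih} {T} {i} {c} {ch} tr v = lift-Is x λ { (mem _ w _ _ _) (repB i<W len cells) →
        mem ih (write w (i * B + off tr) v) (i * B) c ch ,
        shift-R (off tr) (i * B) (cell< w {tr = tr} i<W len) ▷
          subst (Does x (Is x) (act _) _ _)
                         (cong (λ z → mem ih (write w (i * B + off tr) v) (i * B + off tr) z ch) (write-read c ch)) (Does-act x) ▷
            subst (λ z → Does x (Is x) (shift L (off tr)) (mem ih (write w (i * B + off tr) v) z c ch) tt (mem ih (write w (i * B + off tr) v) (i * B) c ch))
                             (+-comm (off tr) (i * B)) (shift-L (off tr) (i * B)) ,
        repB i<W (≤-trans len (≤-reflexive (sym (length-write w (i * B + off tr) v)))) (cells′ w i<W len cells) }
      where
      cells′ : ∀ w → i < W → W * B ≤ length w → (∀ i tr → i < W → read w (i * B + off tr) ≡ T i tr) →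
        ∀ i′ tr′ → i′ < W → read (write w (i * B + off tr) v) (i′ * B + off tr′) ≡ upd T i tr v i′ tr′
      cells′ w i<W len cells i′ tr′ i′<W with i ≟ i′ | tr ≟ᵗ tr′
      ... | yes refl | yes refl = trans (read-write-same w _ v (cell< w {tr = tr} i<W len)) (sym (upd-same T i tr v))
      ... | no ¬p | _ = trans (read-write-other w _ _ v λ q → ¬p (proj₁ (*+-unique i i′ (off<B tr) (off<B tr′) q)))
                          (trans (cells i′ tr′ i′<W) (sym (upd-block T ¬p)))
      ... | yes refl | no ¬p = trans (read-write-other w _ _ v λ q →
                                 ¬p (encode-injective (toℕ-injective (proj₂ (*+-unique i i′ (off<B tr) (off<B tr′) q)))))
                                 (trans (cells i′ tr′ i′<W) (sym (upd-track T ¬p)))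

    nextBlock-does : ∀ {ih T i c ch} → suc i < W → DoesB nextBlock (blocks ih T i c ch) tt (blocks ih T (suc i) c ch)
    nextBlock-does {ih} {T} {i} {c} {ch} si<W = lift-Is x λ where
      (mem _ w _ _ _) (repB i<W len cells) →
        mem ih w (suc i * B) c ch ,
        subst (λ z → Does x (Is x) nextBlock (mem ih w (i * B) c ch) tt (mem ih w z c ch)) (+-comm (i * B) B)
          (shift-R B (i * B) (≤-trans (≤-reflexive (trans (sym (+-identityʳ _)) (cong (_+ 0) (cong suc (+-comm (i * B) B)))))
              (≤-trans (≤-trans (≤-reflexive (+-identityʳ _)) (+-monoˡ-≤ (suc i * B) {1} {B} (s≤s z≤n))) (≤-trans (*-monoˡ-≤ B si<W) len)))) ,
        repB si<W len cells

    prevBlock-does : ∀ {ih T i c ch} → DoesB prevBlock (blocks ih T (suc i) c ch) tt (blocks ih T i c ch)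
    prevBlock-does {ih} {T} {i} {c} {ch} = lift-Is x λ where
      (mem _ w _ _ _) (repB i<W len cells) →
        mem ih w (i * B) c ch , shift-L B (i * B) , repB (<-trans (n<1+n i) i<W) len cells

    record MarkAt (T : ℕ → Track J → Bool) (tr : Track J) (p : ℕ) : Set where
      constructor markAt
      field
        at   : T p tr ≡ true
        rest : ∀ i → i < W → i ≢ p → T i tr ≡ false

    home-does : ∀ {ih T c ch} i → i < W → MarkAt T left 0 → DoesB home (blocks ih T i c ch) tt (blocks ih T 0 c ch)
    home-does {ih} {T} {c} {ch} i i<W (markAt at off) = Does-loop x (rounds i i<W) (≤-trans i<W W≤)
      where
      rounds : ∀ i → i < W → Rounds x {Rep = RepB} homeRound tt (blocks ih T i c ch) (suc i) tt (blocks ih T 0 c ch)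
      rounds zero    _ = last (exit at (getT-does left) ▷ Does-ret)
      rounds (suc i) p = again (exit (off (suc i) p λ ()) (getT-does left) ▷ prevBlock-does ▷ Does-ret)
                               (rounds i (<-trans (n<1+n i) p))

    seek-does : ∀ {ih T c ch tr p} → p < W → MarkAt T tr p → DoesB (seek tr) (blocks ih T 0 c ch) tt (blocks ih T p c ch)
    seek-does {ih} {T} {c} {ch} {tr} {p} p<W (markAt at off) =
      Does-loop x (rounds p 0 (+-identityʳ p)) (≤-trans p<W W≤)
      where
      rounds : ∀ d i → d + i ≡ p → Rounds x {Rep = RepB} (seekRound tr) tt (blocks ih T i c ch) (suc d) tt (blocks ih T p c ch)
      rounds zero    i refl = last (exit at (getT-does tr) ▷ Does-ret)
      rounds (suc d) i eq   =
        again (exit (off i (<-trans i<p p<W) (<⇒≢ i<p)) (getT-does tr) ▷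
                           nextBlock-does (≤-<-trans i<p p<W) ▷ Does-ret)
              (rounds d (suc i) (trans (+-suc d i) eq))
        where
        i<p : i < p
        i<p = subst (i <_) eq (s≤s (m≤n+m i d))

-- Counter machines over two tapes

record CM (J : ℕ) : Set where
  constructor cm
  field
    cnt   : Vec ℕ J
    inH   : ℕ
    work  : List Bool
    workH : ℕ
    cat   : List Bool
    catH  : ℕ

record CMOps (J : ℕ) : Set₁ where
  field
    inc dec : Fin J → Prog ⊤
    isz     : Fin J → Prog Bool
    rdI     : Prog (Maybe Bool)
    inL inR : Prog ⊤
    rdW     : Prog Bool
    wrW     : Bool → Prog ⊤
    wL wR   : Prog ⊤
    rdC     : Prog Bool
    wrC     : Bool → Prog ⊤
    cL cR   : Prog ⊤

-- The interface that lets one program text serve for logarithmic and for polynomial space. Moves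
-- beyond an end of a tape are excluded by hypotheses: simulated tapes are parts of longer ones,
-- whose ends lie elsewhere, so programs have to avoid the ends with the help of counters.
record CMSpec {J : ℕ} (ops : CMOps J) (x : List Bool) (V : ℕ) : Set₁ where
  open CMOps ops
  field
    Rep : CM J → Mem → Set
    inc-does : ∀ {cnt ih wt wh ct ch} r → suc (vlookup cnt r) < V →
      Does x Rep (inc r) (cm cnt ih wt wh ct ch) tt (cm (cnt [ r ]:= suc (vlookup cnt r)) ih wt wh ct ch)
    dec-does : ∀ {cnt ih wt wh ct ch v} r → vlookup cnt r ≡ suc v →
      Does x Rep (dec r) (cm cnt ih wt wh ct ch) tt (cm (cnt [ r ]:= v) ih wt wh ct ch)
    isz-does : ∀ {a} r → Does x Rep (isz r) a (vlookup (CM.cnt a) r ≡ᵇ 0) a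
    rdI-does : ∀ {a} → Does x Rep rdI a (readIn x (CM.inH a)) a
    inL-does : ∀ {cnt ih wt wh ct ch} →
      Does x Rep inL (cm cnt (suc ih) wt wh ct ch) tt (cm cnt ih wt wh ct ch)
    inR-does : ∀ {cnt ih wt wh ct ch} → ih < length x →
      Does x Rep inR (cm cnt ih wt wh ct ch) tt (cm cnt (suc ih) wt wh ct ch)
    rdW-does : ∀ {cnt ih wt wh ct ch} → wh < length wt →
      Does x Rep rdW (cm cnt ih wt wh ct ch) (read wt wh) (cm cnt ih wt wh ct ch)
    wrW-does : ∀ {cnt ih wt wh ct ch} v → wh < length wt →
      Does x Rep (wrW v) (cm cnt ih wt wh ct ch) tt (cm cnt ih (write wt wh v) wh ct ch)
    wL-does : ∀ {cnt ih wt wh ct ch} → suc wh < length wt →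
      Does x Rep wL (cm cnt ih wt (suc wh) ct ch) tt (cm cnt ih wt wh ct ch)
    wR-does : ∀ {cnt ih wt wh ct ch} → suc wh < length wt →
      Does x Rep wR (cm cnt ih wt wh ct ch) tt (cm cnt ih wt (suc wh) ct ch)
    rdC-does : ∀ {cnt ih wt wh ct ch} → ch < length ct →
      Does x Rep rdC (cm cnt ih wt wh ct ch) (read ct ch) (cm cnt ih wt wh ct ch)
    wrC-does : ∀ {cnt ih wt wh ct ch} v → ch < length ct →
      Does x Rep (wrC v) (cm cnt ih wt wh ct ch) tt (cm cnt ih wt wh (write ct ch v) ch)
    cL-does : ∀ {cnt ih wt wh ct ch} → suc ch < length ct →
      Does x Rep cL (cm cnt ih wt wh ct (suc ch)) tt (cm cnt ih wt wh ct ch)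
    cR-does : ∀ {cnt ih wt wh ct ch} → suc ch < length ct →
      Does x Rep cR (cm cnt ih wt wh ct ch) tt (cm cnt ih wt wh ct (suc ch))

-- Two implementations of counter machines, with binary and with unary counters

val : List Bool → ℕ
val []           = 0
val (false ∷ ds) = 2 * val ds
val (true ∷ ds)  = suc (2 * val ds)

double-suc : ∀ a → 2 * suc a ≡ suc (suc (2 * a))
double-suc a = cong suc (+-suc a (a + 0))

val≡0? : ∀ {a} b → a ≡ b → (2 * a ≡ᵇ 0) ≡ (b ≡ᵇ 0)
val≡0? zero    refl = refl
val≡0? (suc b) refl = refl

read-replicate : ∀ s i → read (replicate s false) i ≡ false
read-replicate zero    i       = refl
read-replicate (suc s) zero    = refl
read-replicate (suc s) (suc i) = read-replicate s i

-- Roles of the tracks: `left` marks block 0; `wmark` and `cmark` mark the heads of simulated tapes,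
-- whose cells are `wbit` and `cbit`. A binary counter has one `digit` per block and `used` tells
-- how far it extends; a unary counter is a single mark on `used`, in the block whose number is the
-- value.
module Impl (J eW : ℕ) where
  open Tracks J eW

  tapeRead : Track J → Track J → Prog Bool
  tapeRead bit mark = seek mark ▸ bind (getT bit) λ b → home ▸ ret b

  tapeWrite : Track J → Track J → Bool → Prog ⊤
  tapeWrite bit mark v = seek mark ▸ setT bit v ▸ home

  markR markL : Track J → Prog ⊤
  markR mark = seek mark ▸ setT mark false ▸ nextBlock ▸ setT mark true ▸ home
  markL mark = seek mark ▸ setT mark false ▸ prevBlock ▸ setT mark true ▸ home

  incRound decRound : Fin J → ⊤ → Prog (⊤ ⊎ ⊤)
  incRound r _ = bind (getT (used r)) λ where
    false → setT (used r) true ▸ setT (digit r) true ▸ ret (inj₂ tt)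
    true  → bind (getT (digit r)) λ where
      false → setT (digit r) true ▸ ret (inj₂ tt)
      true  → setT (digit r) false ▸ nextBlock ▸ ret (inj₁ tt)
  decRound r _ = bind (getT (digit r)) λ where
      true  → setT (digit r) false ▸ ret (inj₂ tt)
      false → setT (digit r) true ▸ nextBlock ▸ ret (inj₁ tt)

  zeroRound : Fin J → ⊤ → Prog (⊤ ⊎ Bool)
  zeroRound r _ = bind (getT (used r)) λ where
    false → ret (inj₂ true)
    true  → bind (getT (digit r)) λ where
      true  → ret (inj₂ false)
      false → nextBlock ▸ ret (inj₁ tt)

  setAll : List (Track J) → Prog ⊤
  setAll []         = ret tt
  setAll (tr ∷ trs) = setT tr true ▸ setAll trs

  onInput : Move → Reads → Writes
  onInput m (_ , a , b) = writes a b m S S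

  onCat : Move → Reads → Writes
  onCat m (_ , a , b) = writes a b S S m

  readInput : Prog (Maybe Bool)
  readInput = bind (act keep) λ r → ret (proj₁ r)

  -- With logarithmically many blocks the counters have to be binary. The catalytic tape is the
  -- machine's own and is accessed directly.
  logOps : CMOps J
  logOps = record
    { inc = λ r → loop eW (incRound r) tt ▸ home
    ; dec = λ r → loop eW (decRound r) tt ▸ home
    ; isz = λ r → bind (loop eW (zeroRound r) tt) λ b → home ▸ ret b
    ; rdI = readInput
    ; inL = act (onInput L) ▸ ret tt
    ; inR = act (onInput R) ▸ ret tt
    ; rdW = tapeRead wbit wmark
    ; wrW = tapeWrite wbit wmark
    ; wL  = markL wmark
    ; wR  = markR wmark
    ; rdC = bind (act keep) λ r → ret (proj₂ (proj₂ r))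
    ; wrC = λ v → act (λ (_ , a , _) → writes a v S S S) ▸ ret tt
    ; cL  = act (onCat L) ▸ ret tt
    ; cR  = act (onCat R) ▸ ret tt
    }

  -- A machine for `InP` has polynomially many blocks but no catalytic tape, so both tapes are
  -- simulated on tracks. A unary counter is zero exactly if its mark stands in block 0.
  polyOps : CMOps J
  polyOps = record
    { inc = λ r → markR (used r)
    ; dec = λ r → markL (used r)
    ; isz = λ r → getT (used r)
    ; rdI = readInput
    ; inL = act (onInput L) ▸ ret tt
    ; inR = act (onInput R) ▸ ret tt
    ; rdW = tapeRead wbit wmark
    ; wrW = tapeWrite wbit wmark
    ; wL  = markL wmark
    ; wR  = markR wmark
    ; rdC = tapeRead cbit cmark
    ; wrC = tapeWrite cbit cmark
    ; cL  = markL cmark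
    ; cR  = markR cmark
    }

  logSetup polySetup : List (Track J)
  logSetup  = left ∷ wmark ∷ []
  polySetup = left ∷ wmark ∷ cmark ∷ map used (allFin J)

  module _ (x : List Bool) (m : ℕ) (W≤ : suc m ≤ N x ^ eW) where

    open Representation x (suc m) W≤ public

    private
      W : ℕ
      W = suc m
      Bits : Set
      Bits = ℕ → Track J → Bool

    Agree : Bits → Bits → Track J → Set
    Agree T T′ tr = ∀ i → T′ i tr ≡ T i tr

    Mark-agree : ∀ {T T′ tr p} → Agree T T′ tr → MarkAt T tr p → MarkAt T′ tr p
    Mark-agree ag (markAt at off) = markAt (trans (ag _) at) λ i i<W ne → trans (ag i) (off i i<W ne)

    record TapeRep (T : Bits) (bit mark : Track J) (l : List Bool) (h : ℕ) : Set where
      constructor tapeRep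
      field
        len   : length l ≤ W
        h<W   : h < W
        head  : MarkAt T mark h
        cells : ∀ i → i < length l → T i bit ≡ read l i

    Tape-agree : ∀ {T T′ bit mark l h} → Agree T T′ bit → Agree T T′ mark →
      TapeRep T bit mark l h → TapeRep T′ bit mark l h
    Tape-agree agB agM (tapeRep len h< mk cells) = tapeRep len h< (Mark-agree agM mk) λ i i< → trans (agB i) (cells i i<)

    moved : Bits → Track J → ℕ → ℕ → Bits
    moved T tr p q = upd (upd T p tr false) q tr true

    moved-MarkAt : ∀ {T tr p q} → MarkAt T tr p → MarkAt (moved T tr p q) tr q
    moved-MarkAt {T} {tr} {p} {q} (markAt at off) = markAt (upd-same (upd T p tr false) q tr true) else
      where
      else : ∀ i → i < W → i ≢ q → moved T tr p q i tr ≡ false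
      else i i<W ne = trans (upd-block (upd T p tr false) (λ z → ne (sym z))) (erased i i<W)
        where
        erased : ∀ i → i < W → upd T p tr false i tr ≡ false
        erased i i<W with i ≟ p
        ... | yes refl = upd-same T p tr false
        ... | no ¬p    = trans (upd-block T (λ z → ¬p (sym z))) (off i i<W ¬p)

    moved-agree : ∀ {T tr p q tr′} → tr ≢ tr′ → Agree T (moved T tr p q) tr′
    moved-agree {T} {tr} {p} ne i = trans (upd-track (upd T p tr false) ne) (upd-track T ne)

    markR-does : ∀ {ih T c ch mark p} → mark ≢ left → suc p < W → MarkAt T left 0 → MarkAt T mark p →
      DoesB (markR mark) (blocks ih T 0 c ch) tt (blocks ih (moved T mark p (suc p)) 0 c ch)
    markR-does {T = T} {mark = mark} {p} ne p< ml mk =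
      seek-does (<-trans (n<1+n p) p<) mk ▷
      setT-does mark false ▷
      nextBlock-does p< ▷
      setT-does mark true ▷
      home-does (suc p) p< (Mark-agree (moved-agree ne) ml)

    markL-does : ∀ {ih T c ch mark p} → mark ≢ left → suc p < W → MarkAt T left 0 → MarkAt T mark (suc p) →
      DoesB (markL mark) (blocks ih T 0 c ch) tt (blocks ih (moved T mark (suc p) p) 0 c ch)
    markL-does {T = T} {mark = mark} {p} ne p< ml mk =
      seek-does p< mk ▷
      setT-does mark false ▷
      prevBlock-does ▷
      setT-does mark true ▷
      home-does p (<-trans (n<1+n p) p<) (Mark-agree (moved-agree ne) ml)

    tapeRead-does : ∀ {ih T c ch bit mark l h} → h < length l → MarkAt T left 0 → TapeRep T bit mark l h →
      DoesB (tapeRead bit mark) (blocks ih T 0 c ch) (read l h) (blocks ih T 0 c ch)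
    tapeRead-does {bit = bit} {h = h} h<l ml (tapeRep len h< mk cells) =
      seek-does h< mk ▷
      exit (cells h h<l) (getT-does bit) ▷
      home-does h h< ml ▷ Does-ret

    tapeWrite-does : ∀ {ih T c ch bit mark l h} v → bit ≢ left → MarkAt T left 0 → TapeRep T bit mark l h →
      DoesB (tapeWrite bit mark v) (blocks ih T 0 c ch) tt (blocks ih (upd T h bit v) 0 c ch)
    tapeWrite-does {T = T} {bit = bit} {h = h} v ne ml (tapeRep len h< mk cells) =
      seek-does h< mk ▷
      setT-does bit v ▷
      home-does h h< (Mark-agree (λ i → upd-track T ne) ml)

    tapeWrite-rep : ∀ {T bit mark l h} v → bit ≢ mark → h < length l → TapeRep T bit mark l h →
      TapeRep (upd T h bit v) bit mark (write l h v) h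
    tapeWrite-rep {T} {bit} {mark} {l} {h} v ne h<l (tapeRep len h< mk cells) =
      tapeRep (subst (_≤ W) (sym (length-write l h v)) len) h< (Mark-agree (λ i → upd-track T ne) mk) cells′
      where
      cells′ : ∀ i → i < length (write l h v) → upd T h bit v i bit ≡ read (write l h v) i
      cells′ i i< with h ≟ i
      ... | yes refl = trans (upd-same T h bit v) (sym (read-write-same l h v h<l))
      ... | no ¬p    = trans (upd-block T ¬p)
                         (trans (cells i (subst (i <_) (length-write l h v) i<)) (sym (read-write-other l h i v ¬p)))

    tapeMove-rep : ∀ {T bit mark l h q} → bit ≢ mark → q < W → TapeRep T bit mark l h →
      TapeRep (moved T mark h q) bit mark l q
    tapeMove-rep {T} ne q< (tapeRep len h< mk cells) =
      tapeRep len q< (moved-MarkAt mk) λ i i< → trans (moved-agree {T} (λ z → ne (sym z)) i) (cells i i<)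

    Does-keep : ∀ {a} → Does x (Is x) (act keep) a (reads x a) a
    Does-keep {a} = subst (Does x (Is x) (act keep) a (reads x a)) (apply-keep x a) (Does-act x)

    act-does : ∀ {f ih T i c ch ih′ c′ ch′} →
      (∀ w wh → apply x (f (readIn x ih , read w wh , read c ch)) (mem ih w wh c ch) ≡ mem ih′ w wh c′ ch′) →
      DoesB (act f ▸ ret tt) (blocks ih T i c ch) tt (blocks ih′ T i c′ ch′)
    act-does h = lift-Is x λ where
      (mem _ w wh _ _) (repB i<W len cells) →
        _ , subst (Does x (Is x) (act _) _ _) (h w wh) (Does-act x) ▷ Does-ret , repB i<W len cells

    readInput-does : ∀ {ih T i c ch} → DoesB readInput (blocks ih T i c ch) (readIn x ih) (blocks ih T i c ch)
    readInput-does = lift-Is x λ where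
      σ (repB i<W len cells) → σ , Does-keep ▷ Does-ret , repB i<W len cells

    inL-apply : ∀ ih c ch w wh → apply x (onInput L (readIn x (suc ih) , read w wh , read c ch)) (mem (suc ih) w wh c ch) ≡ mem ih w wh c ch
    inL-apply ih c ch w wh rewrite write-read w wh | write-read c ch = refl

    inR-apply : ∀ ih c ch → ih < length x → ∀ w wh →
      apply x (onInput R (readIn x ih , read w wh , read c ch)) (mem ih w wh c ch) ≡ mem (suc ih) w wh c ch
    inR-apply ih c ch p w wh rewrite write-read w wh | write-read c ch | move-R {suc (length x)} {ih} (s≤s p) = refl

    -- little endian, blank from the first unused block on
    Digits : Bits → Fin J → ℕ → List Bool → Set
    Digits T r i []       = ∀ i′ → i ≤ i′ → i′ < W → T i′ (used r) ≡ false
    Digits T r i (d ∷ ds) = T i (used r) ≡ true × T i (digit r) ≡ d × Digits T r (suc i) ds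

    Digits-agree : ∀ {T T′ r} i ds → (∀ i′ → i ≤ i′ → T′ i′ (used r) ≡ T i′ (used r)) →
      (∀ i′ → i ≤ i′ → T′ i′ (digit r) ≡ T i′ (digit r)) → Digits T r i ds → Digits T′ r i ds
    Digits-agree i []       agU agD blank = λ i′ p q → trans (agU i′ p) (blank i′ p q)
    Digits-agree i (d ∷ ds) agU agD (u , e , rest) =
      trans (agU i ≤-refl) u , trans (agD i ≤-refl) e ,
      Digits-agree (suc i) ds (λ i′ p → agU i′ (<⇒≤ p)) (λ i′ p → agD i′ (<⇒≤ p)) rest

    -- Leading zeros are allowed, because `decRound` never shortens a numeral. The bound `len≤`
    -- leaves the last of the `suc m` blocks blank, so that a scan for the end of the numeral stops
    -- on the tape.
    record BinRep (T : Bits) (r : Fin J) (v : ℕ) : Set where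
      constructor binRep
      field
        ds     : List Bool
        digits : Digits T r 0 ds
        len≤   : length ds ≤ m
        val≡   : val ds ≡ v

    BinRep-agree : ∀ {T T′ r v} → Agree T T′ (used r) → Agree T T′ (digit r) → BinRep T r v → BinRep T′ r v
    BinRep-agree agU agD (binRep ds dig len eq) = binRep ds (Digits-agree 0 ds (λ i _ → agU i) (λ i _ → agD i) dig) len eq

    -- The induction hypothesis for carries and borrows: it concerns the tail of a numeral that
    -- starts in block i. By `before` the blocks to the left stay as they are, which allows a digit
    -- to be put in front afterwards.
    record Pass {E} (b : ⊤ → Prog (⊤ ⊎ E)) (r : Fin J) (ih : ℕ) (c : List Bool) (ch : ℕ)
                (T : Bits) (i len : ℕ) (e : E) (v : ℕ) : Set where
      field
        T′     : Bits
        p k    : ℕ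
        ds     : List Bool
        p<W    : p < W
        k≤     : k ≤ suc len
        rounds : Rounds x {Rep = RepB} b tt (blocks ih T i c ch) k e (blocks ih T′ p c ch)
        digits : Digits T′ r i ds
        len≤   : length ds ≤ len
        val≡   : val ds ≡ v
        before : ∀ i′ tr → i′ < i → T′ i′ tr ≡ T i′ tr
        others : ∀ tr → used r ≢ tr → digit r ≢ tr → Agree T T′ tr

    private
      ≥⇒≢ : ∀ {i i′} → suc i ≤ i′ → i ≢ i′
      ≥⇒≢ p refl = 1+n≰n p

    private
      tail-digits : ∀ {T r i d ds} → Digits T r (suc i) ds → Digits (upd T i (digit r) d) r (suc i) ds
      tail-digits {T} {i = i} {ds = ds} = Digits-agree (suc i) ds (λ i′ p → upd-block T (≥⇒≢ p)) (λ i′ p → upd-block T (≥⇒≢ p))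

    digit-pass : ∀ {ih c ch b r T i len ds} d → i + len < W → suc (length ds) ≤ len → T i (used r) ≡ true → Digits T r (suc i) ds →
      DoesB (b tt) (blocks ih T i c ch) (inj₂ tt) (blocks ih (upd T i (digit r) d) i c ch) →
      Pass b r ih c ch T i len tt (val (d ∷ ds))
    digit-pass {r = r} {T} {i} {len} {ds} d i+len<W len≤ u rest step = record
      { T′ = upd T i (digit r) d ; p = i ; k = 1 ; ds = d ∷ ds
      ; p<W = ≤-<-trans (m≤m+n i len) i+len<W ; k≤ = s≤s z≤n
      ; rounds = last step
      ; digits = trans (upd-track T (λ ())) u , upd-same T i (digit r) d , tail-digits rest
      ; len≤ = len≤ ; val≡ = refl
      ; before = λ i′ tr p → upd-block T (λ z → <⇒≢ p (sym z))
      ; others = λ tr n₁ n₂ i′ → upd-track T n₂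
      }

    carry-pass : ∀ {ih c ch b r T i len v v′} d → T i (used r) ≡ true →
      DoesB (b tt) (blocks ih T i c ch) (inj₁ tt) (blocks ih (upd T i (digit r) d) (suc i) c ch) →
      (∀ ds → val ds ≡ v → val (d ∷ ds) ≡ v′) →
      Pass b r ih c ch (upd T i (digit r) d) (suc i) len tt v → Pass b r ih c ch T i (suc len) tt v′
    carry-pass {r = r} {T} {i} d u step val′ pass = record
      { T′ = P.T′ ; p = P.p ; k = suc P.k ; ds = d ∷ P.ds
      ; p<W = P.p<W ; k≤ = s≤s P.k≤
      ; rounds = again step P.rounds
      ; digits = trans (P.before i (used r) ≤-refl) (trans (upd-track T (λ ())) u) ,
                 trans (P.before i (digit r) ≤-refl) (upd-same T i (digit r) d) , P.digits
      ; len≤ = s≤s P.len≤ ; val≡ = val′ P.ds P.val≡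
      ; before = λ i′ tr p → trans (P.before i′ tr (<-trans p (n<1+n i))) (upd-block T (λ z → <⇒≢ p (sym z)))
      ; others = λ tr n₁ n₂ i′ → trans (P.others tr n₁ n₂ i′) (upd-track T n₂)
      }
      where module P = Pass pass

    -- The bound on the value excludes overflow. A carry passes to a numeral of half the value with
    -- one digit less available, so the bound is inherited; when the digits run out, it says that a
    -- block is left for the new digit.
    inc-pass : ∀ {ih c ch} r ds T i len → i + len < W → length ds ≤ len → Digits T r i ds → suc (val ds) < 2 ^ len →
      Pass (incRound r) r ih c ch T i len tt (suc (val ds))
    inc-pass r [] T i zero i+len<W _ dig (s≤s ())
    inc-pass r [] T i (suc len) i+len<W _ blank _ = record
      { T′ = T₂ ; p = i ; k = 1 ; ds = true ∷ []
      ; p<W = i<W ; k≤ = s≤s z≤n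
      ; rounds = last (exit (blank i ≤-refl i<W) (getT-does (used r)) ▷
                      setT-does (used r) true ▷
                      setT-does (digit r) true ▷ Does-ret)
      ; digits = trans (upd-track T₁ (λ ())) (upd-same T i (used r) true) , upd-same T₁ i (digit r) true ,
                 λ i′ p q → trans (upd-track T₁ (λ ())) (trans (upd-block T (≥⇒≢ p)) (blank i′ (<⇒≤ p) q))
      ; len≤ = s≤s z≤n ; val≡ = refl
      ; before = λ i′ tr p → trans (upd-block T₁ (λ z → <⇒≢ p (sym z))) (upd-block T (λ z → <⇒≢ p (sym z)))
      ; others = λ tr n₁ n₂ i′ → trans (upd-track T₁ n₂) (upd-track T n₁)
      }
      where
      i<W : i < W
      i<W = ≤-<-trans (m≤m+n i (suc len)) i+len<W
      T₁ T₂ : Bits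
      T₁ = upd T i (used r) true
      T₂ = upd T₁ i (digit r) true
    inc-pass r (false ∷ ds) T i len i+len<W len≤ (u , d , rest) _ = digit-pass true i+len<W len≤ u rest
      (exit u (getT-does (used r)) ▷ exit d (getT-does (digit r)) ▷ setT-does (digit r) true ▷ Does-ret)
    inc-pass r (true ∷ ds) T i (suc len) i+len<W (s≤s len≤) (u , d , rest) bound = carry-pass false u
      (exit u (getT-does (used r)) ▷ exit d (getT-does (digit r)) ▷ setT-does (digit r) false ▷
        nextBlock-does (≤-<-trans (s≤s (m≤m+n i len)) i+len<W′) ▷ Does-ret)
      (λ _ eq → trans (cong (2 *_) eq) (double-suc (val ds)))
      (inc-pass r ds (upd T i (digit r) false) (suc i) len i+len<W′ len≤ (tail-digits rest)
        (*-cancelˡ-< 2 _ _ (≤-<-trans (≤-reflexive (double-suc (val ds))) bound)))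
      where
      i+len<W′ : suc i + len < W
      i+len<W′ = subst (_< W) (+-suc i len) i+len<W

    dec-pass : ∀ {ih c ch v} r ds T i len → i + len < W → length ds ≤ len → Digits T r i ds → val ds ≡ suc v →
      Pass (decRound r) r ih c ch T i len tt v
    dec-pass r (true ∷ ds) T i len i+len<W len≤ (u , d , rest) eq =
      subst (Pass (decRound r) r _ _ _ T i len tt) (suc-injective eq)
        (digit-pass false i+len<W len≤ u rest (exit d (getT-does (digit r)) ▷ setT-does (digit r) false ▷ Does-ret))
    dec-pass r (false ∷ ds) T i (suc len) i+len<W (s≤s len≤) (u , d , rest) eq with val ds in veq
    ... | suc a = carry-pass true u
      (exit d (getT-does (digit r)) ▷ setT-does (digit r) true ▷
        nextBlock-does (≤-<-trans (s≤s (m≤m+n i len)) i+len<W′) ▷ Does-ret)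
      (λ _ eq′ → suc-injective (trans (cong (λ z → suc (suc (2 * z))) eq′) (trans (sym (double-suc a)) eq)))
      (dec-pass r ds (upd T i (digit r) true) (suc i) len i+len<W′ len≤ (tail-digits rest) veq)
      where
      i+len<W′ : suc i + len < W
      i+len<W′ = subst (_< W) (+-suc i len) i+len<W

    zero-rounds : ∀ {ih c ch T} r ds i len → i + len < W → length ds ≤ len → Digits T r i ds →
      ∃ λ k → ∃ λ p → k ≤ suc len × p < W ×
        Rounds x {Rep = RepB} (zeroRound r) tt (blocks ih T i c ch) k (val ds ≡ᵇ 0) (blocks ih T p c ch)
    zero-rounds r [] i len i+len<W _ blank =
      1 , i , s≤s z≤n , i<W , last (exit (blank i ≤-refl i<W) (getT-does (used r)) ▷ Does-ret)
      where
      i<W : i < W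
      i<W = ≤-<-trans (m≤m+n i len) i+len<W
    zero-rounds r (true ∷ ds) i len i+len<W _ (u , d , _) =
      1 , i , s≤s z≤n , ≤-<-trans (m≤m+n i len) i+len<W ,
      last (exit u (getT-does (used r)) ▷ exit d (getT-does (digit r)) ▷ Does-ret)
    zero-rounds {ih} {c} {ch} {T} r (false ∷ ds) i (suc len) i+len<W (s≤s len≤) (u , d , rest)
      with zero-rounds {ih} {c} {ch} r ds (suc i) len (subst (_< W) (+-suc i len) i+len<W) len≤ rest
    ... | k , p , k≤ , p<W , rs =
      suc k , p , s≤s k≤ , p<W ,
      again (exit u (getT-does (used r)) ▷
            exit d (getT-does (digit r)) ▷
            nextBlock-does (≤-<-trans (≤-trans (s≤s (m≤m+n i len)) (≤-reflexive (sym (+-suc i len)))) i+len<W) ▷ Does-ret)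
        (subst (λ z → Rounds x {Rep = RepB} (zeroRound r) tt (blocks ih T (suc i) c ch) k z (blocks ih T p c ch))
          (sym (val≡0? (val ds) refl)) rs)

    data LogRep : CM J → Mem → Set where
      logRep : ∀ {cnt ih wt wh ct ch σ T} → RepB (blocks ih T 0 ct ch) σ → MarkAt T left 0 → TapeRep T wbit wmark wt wh →
        (∀ r → BinRep T r (vlookup cnt r)) → LogRep (cm cnt ih wt wh ct ch) σ

    data PolyRep : CM J → Mem → Set where
      polyRep : ∀ {cnt ih wt wh ct ch σ T} → RepB (blocks ih T 0 [] 0) σ → MarkAt T left 0 → TapeRep T wbit wmark wt wh →
        TapeRep T cbit cmark ct ch → (∀ r → MarkAt T (used r) (vlookup cnt r) × vlookup cnt r < W) →
        PolyRep (cm cnt ih wt wh ct ch) σ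

    private
      rerep : ∀ {A : Set} {R′ : A → Mem → Set} {E} {P : Prog E} {a e a′} →
        (∀ σ → R′ a σ → ∃ λ b → ∃ λ b′ → RepB b σ × DoesB P b e b′ × (∀ σ′ → RepB b′ σ′ → R′ a′ σ′)) →
        Does x R′ P a e a′
      rerep f .run σ r with f σ r
      ... | b , b′ , rb , d , back with run d σ rb
      ... | t , σ′ , t≤ , reach , rb′ = t , σ′ , t≤ , reach , back σ′ rb′

    log-pass : ∀ {b cnt ih wt wh ct ch v} r →
      (∀ T → BinRep T r (vlookup cnt r) → Pass b r ih ct ch T 0 m tt v) →
      Does x LogRep (loop eW b tt ▸ home) (cm cnt ih wt wh ct ch) tt (cm (cnt [ r ]:= v) ih wt wh ct ch)
    log-pass {b} {cnt} {ih} {wt} {wh} {ct} {ch} {v} r pass = rerep λ { σ (logRep {T = T} rb ml tw bins) →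
        let open Pass (pass T (bins r)) in
        _ , _ , rb ,
        Does-loop x rounds (≤-trans k≤ W≤) ▷ home-does p p<W (Mark-agree (others left (λ ()) (λ ())) ml) ,
        λ σ′ rb′ → logRep rb′ (Mark-agree (others left (λ ()) (λ ())) ml)
                     (Tape-agree (others wbit (λ ()) (λ ())) (others wmark (λ ()) (λ ())) tw) (bins′ (pass T (bins r)) bins) }
      where
      bins′ : ∀ {T} (P : Pass b r ih ct ch T 0 m tt v) → (∀ r → BinRep T r (vlookup cnt r)) →
        ∀ r′ → BinRep (Pass.T′ P) r′ (vlookup (cnt [ r ]:= v) r′)
      bins′ P bins r′ with r ≟ᶠ r′
      ... | yes refl = binRep (Pass.ds P) (Pass.digits P) (Pass.len≤ P) (trans (Pass.val≡ P) (sym (lookup∘update r cnt v)))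
      ... | no ne = subst (BinRep _ r′) (sym (lookup∘update′ (λ z → ne (sym z)) cnt v))
                      (BinRep-agree (Pass.others P (used r′) (λ { refl → ne refl }) (λ ()))
                                    (Pass.others P (digit r′) (λ ()) (λ { refl → ne refl })) (bins r′))

    logSpec : CMSpec logOps x (2 ^ m)
    logSpec = record
      { Rep = LogRep
      ; inc-does = λ {cnt} r bound → log-pass r λ where
          T (binRep ds dig len veq) → subst (Pass (incRound r) r _ _ _ T 0 m tt) (cong suc veq)
            (inc-pass r ds T 0 m ≤-refl len dig (subst (λ z → suc z < 2 ^ m) (sym veq) bound))
      ; dec-does = λ r eq → log-pass r λ where
          T (binRep ds dig len veq) → dec-pass r ds T 0 m ≤-refl len dig (trans veq eq)
      ; isz-does = λ r → rerep λ where
          σ rep@(logRep {cnt} {ih} {wt} {wh} {ct} {ch} {T = T} rb ml tw bins) → zero-test r rb ml tw bins (bins r)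
      ; rdI-does = rerep λ where
          σ (logRep rb ml tw bins) → _ , _ , rb , readInput-does , λ σ′ rb′ → logRep rb′ ml tw bins
      ; inL-does = rerep λ where
          σ (logRep rb ml tw bins) → _ , _ , rb , act-does (inL-apply _ _ _) , λ σ′ rb′ → logRep rb′ ml tw bins
      ; inR-does = λ p → rerep λ where
          σ (logRep rb ml tw bins) → _ , _ , rb , act-does (inR-apply _ _ _ p) , λ σ′ rb′ → logRep rb′ ml tw bins
      ; rdW-does = λ p → rerep λ where
          σ (logRep rb ml tw bins) → _ , _ , rb , tapeRead-does p ml tw , λ σ′ rb′ → logRep rb′ ml tw bins
      ; wrW-does = λ v p → rerep λ where
          σ (logRep {T = T} rb ml tw bins) → _ , _ , rb , tapeWrite-does v (λ ()) ml tw , λ σ′ rb′ →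
            logRep rb′ (Mark-agree (λ i → upd-track T (λ ())) ml) (tapeWrite-rep v (λ ()) p tw)
              (λ r → BinRep-agree (λ i → upd-track T (λ ())) (λ i → upd-track T (λ ())) (bins r))
      ; wL-does = λ p → rerep λ where
          σ (logRep {T = T} rb ml tw@(tapeRep len h< mk _) bins) → _ , _ , rb , markL-does (λ ()) h< ml mk , λ σ′ rb′ →
            logRep rb′ (Mark-agree (moved-agree {T = T} (λ ())) ml) (tapeMove-rep (λ ()) (<-trans (n<1+n _) h<) tw)
              (λ r → BinRep-agree (moved-agree {T = T} (λ ())) (moved-agree {T = T} (λ ())) (bins r))
      ; wR-does = λ p → rerep λ where
          σ (logRep {T = T} rb ml tw@(tapeRep len h< mk _) bins) → _ , _ , rb , markR-does (λ ()) (<-≤-trans p len) ml mk , λ σ′ rb′ →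
            logRep rb′ (Mark-agree (moved-agree {T = T} (λ ())) ml) (tapeMove-rep (λ ()) (<-≤-trans p len) tw)
              (λ r → BinRep-agree (moved-agree {T = T} (λ ())) (moved-agree {T = T} (λ ())) (bins r))
      ; rdC-does = λ p → rerep λ where
          σ (logRep rb ml tw bins) → _ , _ , rb ,
            lift-Is x (λ { σ (repB a b c) → σ , Does-keep ▷ Does-ret , repB a b c }) ,
            λ σ′ rb′ → logRep rb′ ml tw bins
      ; wrC-does = λ v p → rerep λ where
          σ (logRep rb ml tw bins) → _ , _ , rb , act-does (wrC-apply v _ _ _) , λ σ′ rb′ → logRep rb′ ml tw bins
      ; cL-does = λ p → rerep λ where
          σ (logRep rb ml tw bins) → _ , _ , rb , act-does (cL-apply _ _ _) , λ σ′ rb′ → logRep rb′ ml tw bins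
      ; cR-does = λ p → rerep λ where
          σ (logRep rb ml tw bins) → _ , _ , rb , act-does (cR-apply _ _ _ p) , λ σ′ rb′ → logRep rb′ ml tw bins
      }
      where
      wrC-apply : ∀ v ih c ch w wh →
        apply x (writes (read w wh) v S S S) (mem ih w wh c ch) ≡ mem ih w wh (write c ch v) ch
      wrC-apply v ih c ch w wh rewrite write-read w wh = refl
      cL-apply : ∀ ih c ch w wh →
        apply x (onCat L (readIn x ih , read w wh , read c (suc ch))) (mem ih w wh c (suc ch)) ≡ mem ih w wh c ch
      cL-apply ih c ch w wh rewrite write-read w wh | write-read c (suc ch) = refl
      cR-apply : ∀ ih c ch → suc ch < length c → ∀ w wh →
        apply x (onCat R (readIn x ih , read w wh , read c ch)) (mem ih w wh c ch) ≡ mem ih w wh c (suc ch)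
      cR-apply ih c ch p w wh rewrite write-read w wh | write-read c ch | move-R p = refl
      zero-test : ∀ {cnt ih wt wh ct ch σ T} r → RepB (blocks ih T 0 ct ch) σ → MarkAt T left 0 → TapeRep T wbit wmark wt wh →
        (∀ r → BinRep T r (vlookup cnt r)) → BinRep T r (vlookup cnt r) →
        ∃ λ b → ∃ λ b′ → RepB b σ × DoesB (CMOps.isz logOps r) b (vlookup cnt r ≡ᵇ 0) b′ ×
          (∀ σ′ → RepB b′ σ′ → LogRep (cm cnt ih wt wh ct ch) σ′)
      zero-test r rb ml tw bins (binRep ds dig len veq) with zero-rounds r ds 0 m ≤-refl len dig
      ... | k , p , k≤ , p<W , rs =
        _ , _ , rb ,
        exit (cong (_≡ᵇ 0) veq)
          (Does-loop x rs (≤-trans k≤ W≤) ▷ home-does p p<W ml ▷ Does-ret) ,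
        λ σ′ rb′ → logRep rb′ ml tw bins

    private
      marks-moved : ∀ {cnt : Vec ℕ J} {T r q} → (∀ r → MarkAt T (used r) (vlookup cnt r) × vlookup cnt r < W) → q < W →
        ∀ r′ → MarkAt (moved T (used r) (vlookup cnt r) q) (used r′) (vlookup (cnt [ r ]:= q) r′) × vlookup (cnt [ r ]:= q) r′ < W
      marks-moved {cnt} {T} {r} {q} mks q< r′ with r ≟ᶠ r′
      ... | yes refl rewrite lookup∘update r cnt q = moved-MarkAt (proj₁ (mks r)) , q<
      ... | no ne rewrite lookup∘update′ {i = r′} {j = r} (λ z → ne (sym z)) cnt q =
        Mark-agree (moved-agree {T = T} (λ { refl → ne refl })) (proj₁ (mks r′)) , proj₂ (mks r′)

    polySpec : CMSpec polyOps x W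
    polySpec = record
      { Rep = PolyRep
      ; inc-does = λ {cnt} r bound → rerep λ where
          σ (polyRep {T = T} rb ml tw tc mks) → _ , _ , rb , markR-does (λ ()) bound ml (proj₁ (mks r)) , λ σ′ rb′ →
            polyRep rb′ (Mark-agree (moved-agree {T = T} (λ ())) ml)
              (Tape-agree (moved-agree {T = T} (λ ())) (moved-agree {T = T} (λ ())) tw)
              (Tape-agree (moved-agree {T = T} (λ ())) (moved-agree {T = T} (λ ())) tc)
              (marks-moved {cnt} mks bound)
      ; dec-does = λ {cnt} {v = v} r eq → rerep λ where
          σ (polyRep {T = T} rb ml tw tc mks) → _ , _ , rb ,
            markL-does (λ ()) (subst (_< W) eq (proj₂ (mks r))) ml (subst (MarkAt T (used r)) eq (proj₁ (mks r))) , λ σ′ rb′ →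
            polyRep rb′ (Mark-agree (moved-agree {T = T} (λ ())) ml)
              (Tape-agree (moved-agree {T = T} (λ ())) (moved-agree {T = T} (λ ())) tw)
              (Tape-agree (moved-agree {T = T} (λ ())) (moved-agree {T = T} (λ ())) tc)
              (subst (λ z → ∀ r′ → MarkAt (moved T (used r) z v) (used r′) (vlookup (cnt [ r ]:= v) r′) × vlookup (cnt [ r ]:= v) r′ < W)
                eq (marks-moved {cnt} mks (<-trans (n<1+n v) (subst (_< W) eq (proj₂ (mks r))))))
      ; isz-does = λ r → rerep λ where
          σ (polyRep {cnt} {T = T} rb ml tw tc mks) → _ , _ , rb ,
            exit (is-zero T r (vlookup cnt r) (proj₁ (mks r))) (getT-does (used r)) , λ σ′ rb′ → polyRep rb′ ml tw tc mks
      ; rdI-does = rerep λ where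
          σ (polyRep rb ml tw tc mks) → _ , _ , rb , readInput-does , λ σ′ rb′ → polyRep rb′ ml tw tc mks
      ; inL-does = rerep λ where
          σ (polyRep rb ml tw tc mks) → _ , _ , rb , act-does (inL-apply _ _ _) , λ σ′ rb′ → polyRep rb′ ml tw tc mks
      ; inR-does = λ p → rerep λ where
          σ (polyRep rb ml tw tc mks) → _ , _ , rb , act-does (inR-apply _ _ _ p) , λ σ′ rb′ → polyRep rb′ ml tw tc mks
      ; rdW-does = λ p → rerep λ where
          σ (polyRep rb ml tw tc mks) → _ , _ , rb , tapeRead-does p ml tw , λ σ′ rb′ → polyRep rb′ ml tw tc mks
      ; wrW-does = λ v p → rerep λ where
          σ (polyRep {T = T} rb ml tw tc mks) → _ , _ , rb , tapeWrite-does v (λ ()) ml tw , λ σ′ rb′ →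
            polyRep rb′ (Mark-agree (λ i → upd-track T (λ ())) ml) (tapeWrite-rep v (λ ()) p tw)
              (Tape-agree (λ i → upd-track T (λ ())) (λ i → upd-track T (λ ())) tc)
              (λ r → Mark-agree (λ i → upd-track T (λ ())) (proj₁ (mks r)) , proj₂ (mks r))
      ; wL-does = λ p → rerep λ where
          σ (polyRep {T = T} rb ml tw@(tapeRep len h< mk _) tc mks) → _ , _ , rb , markL-does (λ ()) h< ml mk , λ σ′ rb′ →
            polyRep rb′ (Mark-agree (moved-agree {T = T} (λ ())) ml) (tapeMove-rep (λ ()) (<-trans (n<1+n _) h<) tw)
              (Tape-agree (moved-agree {T = T} (λ ())) (moved-agree {T = T} (λ ())) tc)
              (λ r → Mark-agree (moved-agree {T = T} (λ ())) (proj₁ (mks r)) , proj₂ (mks r))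
      ; wR-does = λ p → rerep λ where
          σ (polyRep {T = T} rb ml tw@(tapeRep len h< mk _) tc mks) → _ , _ , rb , markR-does (λ ()) (<-≤-trans p len) ml mk , λ σ′ rb′ →
            polyRep rb′ (Mark-agree (moved-agree {T = T} (λ ())) ml) (tapeMove-rep (λ ()) (<-≤-trans p len) tw)
              (Tape-agree (moved-agree {T = T} (λ ())) (moved-agree {T = T} (λ ())) tc)
              (λ r → Mark-agree (moved-agree {T = T} (λ ())) (proj₁ (mks r)) , proj₂ (mks r))
      ; rdC-does = λ p → rerep λ where
          σ (polyRep rb ml tw tc mks) → _ , _ , rb , tapeRead-does p ml tc , λ σ′ rb′ → polyRep rb′ ml tw tc mks
      ; wrC-does = λ v p → rerep λ where
          σ (polyRep {T = T} rb ml tw tc mks) → _ , _ , rb , tapeWrite-does v (λ ()) ml tc , λ σ′ rb′ →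
            polyRep rb′ (Mark-agree (λ i → upd-track T (λ ())) ml)
              (Tape-agree (λ i → upd-track T (λ ())) (λ i → upd-track T (λ ())) tw) (tapeWrite-rep v (λ ()) p tc)
              (λ r → Mark-agree (λ i → upd-track T (λ ())) (proj₁ (mks r)) , proj₂ (mks r))
      ; cL-does = λ p → rerep λ where
          σ (polyRep {T = T} rb ml tw tc@(tapeRep len h< mk _) mks) → _ , _ , rb , markL-does (λ ()) h< ml mk , λ σ′ rb′ →
            polyRep rb′ (Mark-agree (moved-agree {T = T} (λ ())) ml)
              (Tape-agree (moved-agree {T = T} (λ ())) (moved-agree {T = T} (λ ())) tw) (tapeMove-rep (λ ()) (<-trans (n<1+n _) h<) tc)
              (λ r → Mark-agree (moved-agree {T = T} (λ ())) (proj₁ (mks r)) , proj₂ (mks r))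
      ; cR-does = λ p → rerep λ where
          σ (polyRep {T = T} rb ml tw tc@(tapeRep len h< mk _) mks) → _ , _ , rb , markR-does (λ ()) (<-≤-trans p len) ml mk , λ σ′ rb′ →
            polyRep rb′ (Mark-agree (moved-agree {T = T} (λ ())) ml)
              (Tape-agree (moved-agree {T = T} (λ ())) (moved-agree {T = T} (λ ())) tw) (tapeMove-rep (λ ()) (<-≤-trans p len) tc)
              (λ r → Mark-agree (moved-agree {T = T} (λ ())) (proj₁ (mks r)) , proj₂ (mks r))
      }
      where
      is-zero : ∀ T r v → MarkAt T (used r) v → T 0 (used r) ≡ (v ≡ᵇ 0)
      is-zero T r zero    (markAt at _)  = at
      is-zero T r (suc v) (markAt _ off) = off 0 (s≤s z≤n) (λ ())

    setAll-does : ∀ {ih T c ch} trs → ∃ λ T′ →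
      DoesB (setAll trs) (blocks ih T 0 c ch) tt (blocks ih T′ 0 c ch) ×
      (∀ tr → T 0 tr ≡ true → T′ 0 tr ≡ true) × (∀ tr → tr ∈ trs → T′ 0 tr ≡ true) ×
      (∀ i tr → i ≢ 0 ⊎ tr ∉ trs → T′ i tr ≡ T i tr)
    setAll-does {T = T} [] = T , Does-ret , (λ _ p → p) , (λ _ ()) , λ _ _ _ → refl
    setAll-does {ih} {T} {c} {ch} (t ∷ trs) with setAll-does {ih} {upd T 0 t true} {c} {ch} trs
    ... | T′ , d , stay , set , other =
      T′ , setT-does t true ▷ d , (λ tr p → stay tr (kept tr p)) ,
      (λ { tr (here refl) → stay tr (upd-same T 0 t true) ; tr (there p) → set tr p }) , other′
      where
      kept : ∀ tr → T 0 tr ≡ true → upd T 0 t true 0 tr ≡ true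
      kept tr p with t ≟ᵗ tr
      ... | yes refl = upd-same T 0 t true
      ... | no ne    = trans (upd-track T ne) p
      other′ : ∀ i tr → i ≢ 0 ⊎ tr ∉ (t ∷ trs) → T′ i tr ≡ T i tr
      other′ i tr (inj₁ p) = trans (other i tr (inj₁ p)) (upd-block T (λ z → p (sym z)))
      other′ i tr (inj₂ p) = trans (other i tr (inj₂ λ q → p (there q))) (upd-track T (λ z → p (here (sym z))))

    data Fresh : List Bool → Mem → Set where
      fresh : ∀ {l c} → W * B ≤ l → Fresh c (mem 0 (replicate l false) 0 c 0)

    private
      fresh-RepB : ∀ {c σ} → Fresh c σ → RepB (blocks 0 (λ _ _ → false) 0 c 0) σ
      fresh-RepB (fresh {l} p) =
        repB (s≤s z≤n) (subst (W * B ≤_) (sym (length-replicate l)) p) (λ i tr _ → read-replicate l (i * B + off tr))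

      ∉used : ∀ {tr : Track J} {rs : List (Fin J)} → (∀ r → tr ≢ used r) → tr ∉ map used rs
      ∉used {rs = r ∷ rs} ne (here p)  = ne r p
      ∉used {rs = r ∷ rs} ne (there p) = ∉used ne p

    Setup : List (Track J) → Mem → (Mem → Set) → Set
    Setup trs σ Q = ∃ λ t → ∃ λ σ′ → t ≤ N x ^ expo (setAll trs) ×
      Reach x (setAll trs) (entry (setAll trs)) σ t tt σ′ × Q σ′

    setup : ∀ {c σ} trs {Q : Mem → Set} → Fresh c σ →
      (∀ T → (∀ tr → tr ∈ trs → MarkAt T tr 0) → (∀ i tr → tr ∉ trs → T i tr ≡ false) →
        ∀ σ′ → RepB (blocks 0 T 0 c 0) σ′ → Q σ′) → Setup trs σ Q
    setup {c} {σ} trs {Q} fr k = use (setAll-does trs)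
      where
      use : (∃ λ T′ →
        DoesB (setAll trs) (blocks 0 (λ _ _ → false) 0 c 0) tt (blocks 0 T′ 0 c 0) ×
        (∀ tr → false ≡ true → T′ 0 tr ≡ true) × (∀ tr → tr ∈ trs → T′ 0 tr ≡ true) ×
        (∀ i tr → i ≢ 0 ⊎ tr ∉ trs → T′ i tr ≡ false)) → Setup trs σ Q
      use (T′ , d , _ , set , other) = fin (run d σ (fresh-RepB fr))
        where
        fin : Setup trs σ (RepB (blocks 0 T′ 0 c 0)) → Setup trs σ Q
        fin (t , σ′ , t≤ , reach , rb) = t , σ′ , t≤ , reach ,
          k T′ (λ tr p → markAt (set tr p) λ i _ ne → other i tr (inj₁ ne)) (λ i tr p → other i tr (inj₂ p)) σ′ rb

    private
      blank-tape : ∀ {T bit mark} s → s ≤ W → MarkAt T mark 0 → (∀ i → T i bit ≡ false) →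
        TapeRep T bit mark (replicate s false) 0
      blank-tape s s≤W mk off =
        tapeRep (subst (_≤ W) (sym (length-replicate s)) s≤W) (s≤s z≤n) mk λ i _ → trans (off i) (sym (read-replicate s i))

    logSetup-reach : ∀ {c σ s} → s ≤ W → Fresh c σ →
      Setup logSetup σ (LogRep (cm (vreplicate J 0) 0 (replicate s false) 0 c 0))
    logSetup-reach {s = s} s≤W fr = setup logSetup fr λ T mk off σ′ rb →
      logRep rb (mk left (here refl))
        (blank-tape s s≤W (mk wmark (there (here refl)))
          (λ i → off i wbit λ { (here ()) ; (there (here ())) ; (there (there ())) }))
        (λ r → binRep [] (λ i _ _ → off i (used r) λ { (here ()) ; (there (here ())) ; (there (there ())) }) z≤n
               (sym (lookup-replicate r 0)))

    polySetup-reach : ∀ {σ s c} → s ≤ W → c ≤ W → Fresh [] σ →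
      Setup polySetup σ (PolyRep (cm (vreplicate J 0) 0 (replicate s false) 0 (replicate c false) 0))
    polySetup-reach {s = s} {c} s≤W c≤W fr = setup polySetup fr λ T mk off σ′ rb →
      polyRep rb (mk left (here refl))
        (blank-tape s s≤W (mk wmark (there (here refl))) (λ i → off i wbit λ where
          (here ())
          (there (here ()))
          (there (there (here ())))
          (there (there (there p))) → ∉used (λ _ ()) p))
        (blank-tape c c≤W (mk cmark (there (there (here refl)))) (λ i → off i cbit λ where
          (here ())
          (there (here ()))
          (there (there (here ())))
          (there (there (there p))) → ∉used (λ _ ()) p))
        (λ r → subst (λ z → MarkAt T (used r) z × z < W) (sym (lookup-replicate r 0))
                 (mk (used r) (there (there (there (∈-map⁺ used (∈-allFin r))))) , s≤s z≤n))

-- Arithmetic with counters and edge-sensing heads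

-- `logRound` computes the logarithm by this recursion, with the argument minus two in `tmp₁`.
log-unfold : ∀ y → ⌈log₂ suc (suc y) ⌉ ≡ suc ⌈log₂ suc ⌈ y /2⌉ ⌉
log-unfold y with <-wellFounded (suc (suc y))
... | acc rs = cong suc (⌈log2⌉-acc-irrelevant (suc ⌈ y /2⌉))

log≤ : ∀ y → ⌈log₂ suc y ⌉ ≤ y
log≤ y = bound y (<-wellFounded y)
  where
  bound : ∀ y → Acc _<_ y → ⌈log₂ suc y ⌉ ≤ y
  bound zero    _        = z≤n
  bound (suc y) (acc rs) =
    ≤-trans (≤-reflexive (log-unfold y)) (s≤s (≤-trans (bound ⌈ y /2⌉ (rs (s≤s (⌈n/2⌉≤n y)))) (⌈n/2⌉≤n y)))

<ᵇ-true : ∀ {a b} → a < b → (a <ᵇ b) ≡ true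
<ᵇ-true {a} {b} p with a <ᵇ b | <⇒<ᵇ p
... | true | _ = refl

<ᵇ-false : ∀ a b → ¬ (a < b) → (a <ᵇ b) ≡ false
<ᵇ-false a       zero    _  = refl
<ᵇ-false zero    (suc b) ¬p = contradiction (s≤s z≤n) ¬p
<ᵇ-false (suc a) (suc b) ¬p = <ᵇ-false a b (λ q → ¬p (s≤s q))

∸-peel : ∀ {i n} → i < n → n ∸ i ≡ suc (n ∸ suc i)
∸-peel {zero}  {suc n} _       = refl
∸-peel {suc i} {suc n} (s≤s p) = ∸-peel p

opp : Move → Move
opp L = R
opp S = S
opp R = L

-- the displacement that `move len m` actually performs at h
eff : ℕ → Move → ℕ → Move
eff len L zero    = S
eff len L (suc h) = L
eff len S h       = S
eff len R h       = if suc h <ᵇ len then R else S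

-- Registers hold the distance of each simulated head from the left end and, except for the input
-- head, the number of cells to its right. Besides two scratch registers there are three pairs `Lo`,
-- `Hi`, for N and for two timers. A loop shifts the content of such a pair from one member to the
-- other, so the bound survives the loop.
nregs : ℕ
nregs = 13

pattern ipos = 0F
pattern wpos = 1F
pattern wrem = 2F
pattern cpos = 3F
pattern crem = 4F
pattern tmp₁ = 5F
pattern tmp₂ = 6F
pattern nLo  = 7F
pattern nHi  = 8F
pattern aLo  = 9F
pattern aHi  = Fin.suc 9F
pattern bLo  = Fin.suc (Fin.suc 9F)
pattern bHi  = Fin.suc (Fin.suc (Fin.suc 9F))

module Macros (ops : CMOps nregs) where
  open CMOps ops

  drainRound : Fin nregs → Prog ⊤ → ⊤ → Prog (⊤ ⊎ ⊤)
  drainRound r body _ = bind (isz r) λ where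
    true  → ret (inj₂ tt)
    false → dec r ▸ body ▸ ret (inj₁ tt)

  drain : ℕ → Fin nregs → Prog ⊤ → Prog ⊤
  drain e r body = loop e (drainRound r body) tt

  tick : Fin nregs → Fin nregs → ℕ → Prog Bool
  tick lo hi e = bind (isz lo) λ where
    true  → drain e hi (inc lo) ▸ ret true
    false → dec lo ▸ inc hi ▸ ret false

  repRound : ∀ {X} ⦃ _ : Finite X ⦄ → Fin nregs → Fin nregs → ℕ → (X → Prog X) → X → Prog (X ⊎ X)
  repRound lo hi e f y = bind (f y) λ y′ → bind (tick lo hi e) λ where
    true  → ret (inj₂ y′)
    false → ret (inj₁ y′)

  -- runs f as often as lo + 1 says, and restores lo by means of hi
  rep : ∀ {X} ⦃ _ : Finite X ⦄ → Fin nregs → Fin nregs → ℕ → (X → Prog X) → X → Prog X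
  rep lo hi e f = loop e (repRound lo hi e f)

  scanRound : ⊤ → Prog (⊤ ⊎ ⊤)
  scanRound _ = bind rdI λ where
    nothing  → ret (inj₂ tt)
    (just _) → inR ▸ inc ipos ▸ inc tmp₁ ▸ inc nLo ▸ ret (inj₁ tt)

  initN : Prog ⊤
  initN = loop 1 scanRound tt ▸ drain 1 ipos inL ▸ inc nLo

  halveRound : ⊤ → Prog (⊤ ⊎ ⊤)
  halveRound _ = bind (isz tmp₁) λ where
    true  → ret (inj₂ tt)
    false → dec tmp₁ ▸ inc tmp₂ ▸ bind (isz tmp₁) λ where
      true  → ret (inj₂ tt)
      false → dec tmp₁ ▸ ret (inj₁ tt)

  incs : ℕ → Fin nregs → Prog ⊤
  incs zero    r = ret tt
  incs (suc k) r = inc r ▸ incs k r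

  logRound : ℕ → ⊤ → Prog (⊤ ⊎ ⊤)
  logRound k _ = loop 1 halveRound tt ▸ incs k wrem ▸ bind (isz tmp₂) λ where
    true  → ret (inj₂ tt)
    false → dec tmp₂ ▸ drain 1 tmp₂ (inc tmp₁) ▸ ret (inj₁ tt)

  initW : ℕ → Prog ⊤
  initW zero    = loop 1 (logRound zero) tt
  -- With the head in cell 0 the number of cells to its right is one less than the space. For k = 0
  -- the simulated tape has a single cell and `wrem` stays 0.
  initW (suc k) = loop 1 (logRound (suc k)) tt ▸ dec wrem

  incTmp₂ : ⊤ → Prog ⊤
  incTmp₂ _ = inc tmp₂

  addN : Prog ⊤
  addN = rep nLo nHi 1 incTmp₂ tt

  -- Bounds are stored minus one, since `rep` runs once more than its counter says; so `addN` adds N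
  -- although `nLo` holds N - 1. From r = N^e - 1 the drain yields r times N, the extra `addN` makes
  -- it N^(e+1), and the decrement restores the convention.
  mulN : ℕ → Fin nregs → Prog ⊤
  mulN e r = drain e r addN ▸ addN ▸ dec tmp₂ ▸ drain (suc e) tmp₂ (inc r)

  initPow : ℕ → Fin nregs → Prog ⊤
  initPow zero    r = ret tt
  initPow (suc e) r = initPow e r ▸ mulN e r

  -- Undoing a move requires knowing whether it was blocked, which a machine does not feel. The
  -- counters tell, and on the input tape the end marker does so for the right end. The result is
  -- the displacement that was performed.
  tryI tryW tryC : Move → Prog Move
  tryI S = ret S
  tryI L = bind (isz ipos) λ where
    true  → ret S
    false → dec ipos ▸ inL ▸ ret L
  tryI R = bind rdI λ where
    nothing  → ret S
    (just _) → inc ipos ▸ inR ▸ ret R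
  tryW S = ret S
  tryW L = bind (isz wpos) λ where
    true  → ret S
    false → dec wpos ▸ inc wrem ▸ wL ▸ ret L
  tryW R = bind (isz wrem) λ where
    true  → ret S
    false → dec wrem ▸ inc wpos ▸ wR ▸ ret R
  tryC S = ret S
  tryC L = bind (isz cpos) λ where
    true  → ret S
    false → dec cpos ▸ inc crem ▸ cL ▸ ret L
  tryC R = bind (isz crem) λ where
    true  → ret S
    false → dec crem ▸ inc cpos ▸ cR ▸ ret R

  module Specs (x : List Bool) (V : ℕ) (spec : CMSpec ops x V) where
    open CMSpec spec

    n : ℕ
    n = length x

    D : ∀ {E} → Prog E → CM nregs → E → CM nregs → Set
    D = Does x Rep

    -- A family of states in which only register `r` varies. Loops are specified for such families,
    -- without reference to the other registers.
    record IsReg (r : Fin nregs) (f : ℕ → CM nregs) : Set where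
      field
        inc-reg : ∀ v → suc v < V → D (inc r) (f v) tt (f (suc v))
        dec-reg : ∀ v → D (dec r) (f (suc v)) tt (f v)
        isz-reg : ∀ v → D (isz r) (f v) (v ≡ᵇ 0) (f v)

    open IsReg

    setReg : Fin nregs → ℕ → CM nregs → CM nregs
    setReg r v a = record a { cnt = CM.cnt a [ r ]:= v }

    isReg : ∀ r a → IsReg r (λ v → setReg r v a)
    isReg r a = record
      { inc-reg = λ v p → to (cong (λ z → record a { cnt = z }) (trans ([]≔-idempotent cnt r) (cong (λ z → cnt [ r ]:= suc z) (held v))))
                    (inc-does r (subst (λ z → suc z < V) (sym (held v)) p))
      ; dec-reg = λ v → to (cong (λ z → record a { cnt = z }) ([]≔-idempotent cnt r)) (dec-does r (held (suc v)))
      ; isz-reg = λ v → exit (cong (_≡ᵇ 0) (held v)) (isz-does r)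
      }
      where
      open CM a
      held : ∀ v → vlookup (cnt [ r ]:= v) r ≡ v
      held v = lookup∘update r cnt v

    drain-does : ∀ {e r body} (F : ℕ → ℕ → CM nregs) total → (∀ i → IsReg r (λ j → F j i)) →
      (∀ i j → i < total → D body (F j i) tt (F j (suc i))) → suc total ≤ N x ^ e →
      D (drain e r body) (F total 0) tt (F 0 total)
    drain-does {e} {r} {body} F total isR step bound = Does-loop x (rounds total 0 (+-identityʳ total)) bound
      where
      rounds : ∀ j i → j + i ≡ total → Rounds x {Rep = Rep} (drainRound r body) tt (F j i) (suc j) tt (F 0 total)
      rounds zero    i refl = last (isz-reg (isR i) 0 ▷ Does-ret)
      rounds (suc j) i eq   =
        again (isz-reg (isR i) (suc j) ▷
              dec-reg (isR i) j ▷
              step i j (subst (i <_) eq (s≤s (m≤n+m i j))) ▷ Does-ret)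
              (rounds j (suc i) (trans (+-suc j i) eq))

    tick-zero : ∀ {lo hi e} (F : ℕ → ℕ → CM nregs) mx → (∀ b → IsReg lo (λ a → F a b)) → (∀ a → IsReg hi (λ b → F a b)) →
      mx < V → suc mx ≤ N x ^ e → D (tick lo hi e) (F 0 mx) true (F mx 0)
    tick-zero {lo} {hi} {e} F mx isLo isHi mx<V bound =
      isz-reg (isLo mx) 0 ▷
        drain-does (λ j i → F i j) mx isHi (λ i j i< → inc-reg (isLo j) i (≤-<-trans i< mx<V)) bound ▷ Does-ret

    tick-suc : ∀ {lo hi e} (F : ℕ → ℕ → CM nregs) a b → (∀ b → IsReg lo (λ a → F a b)) → (∀ a → IsReg hi (λ b → F a b)) →
      suc b < V → D (tick lo hi e) (F (suc a) b) false (F a (suc b))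
    tick-suc F a b isLo isHi b<V =
      isz-reg (isLo b) (suc a) ▷
        dec-reg (isLo b) a ▷ inc-reg (isHi a) b b<V ▷ Does-ret

    rep-does : ∀ {X} ⦃ _ : Finite X ⦄ {lo hi e} {f : X → Prog X} (F : ℕ → ℕ → ℕ → CM nregs) (y : ℕ → X) mx →
      (∀ i b → IsReg lo (λ a → F a b i)) → (∀ i a → IsReg hi (λ b → F a b i)) → mx < V → suc mx ≤ N x ^ e →
      (∀ i a b → i ≤ mx → D (f (y i)) (F a b i) (y (suc i)) (F a b (suc i))) →
      D (rep lo hi e f (y 0)) (F mx 0 0) (y (suc mx)) (F mx 0 (suc mx))
    rep-does {X} {lo = lo} {hi} {e} {f} F y mx isLo isHi mx<V bound step =
      Does-loop x (rounds mx 0 (+-identityʳ mx)) bound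
      where
      rounds : ∀ a i → a + i ≡ mx →
        Rounds x {Rep = Rep} (repRound lo hi e f) (y i) (F a i i) (suc a) (y (suc mx)) (F mx 0 (suc mx))
      rounds zero i refl =
        last (step i 0 i ≤-refl ▷ tick-zero (λ a b → F a b (suc i)) i (isLo (suc i)) (isHi (suc i)) mx<V bound ▷ Does-ret)
      rounds (suc a) i eq =
        again (step i (suc a) i (<⇒≤ i<mx) ▷
              tick-suc (λ a b → F a b (suc i)) a i (isLo (suc i)) (isHi (suc i)) (≤-<-trans i<mx mx<V) ▷ Does-ret)
              (rounds a (suc i) (trans (+-suc a i) eq))
        where
        i<mx : i < mx
        i<mx = subst (i <_) eq (s≤s (m≤n+m i a))

    readIn-< : ∀ (l : List Bool) i → i < length l → ∃ λ b → readIn l i ≡ just b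
    readIn-< (b ∷ l) zero    _       = b , refl
    readIn-< (b ∷ l) (suc i) (s≤s p) = readIn-< l i p

    readIn-≥ : ∀ (l : List Bool) → readIn l (length l) ≡ nothing
    readIn-≥ []      = refl
    readIn-≥ (_ ∷ l) = readIn-≥ l

    1+n≤N^1 : suc n ≤ N x ^ 1
    1+n≤N^1 = ≤-trans (≤-trans (n≤1+n (suc n)) (≤-reflexive (+-comm 2 n))) (≤-reflexive (sym (*-identityʳ (N x))))

    N≡ : N x ≡ suc (suc n)
    N≡ = +-comm n 2

    module _ {wt : List Bool} {wh : ℕ} {ct : List Bool} {ch : ℕ} where

      initN-does : suc n < V →
        D initN (cm (0 ∷ 0 ∷ 0 ∷ 0 ∷ 0 ∷ 0 ∷ 0 ∷ 0 ∷ 0 ∷ 0 ∷ 0 ∷ 0 ∷ 0 ∷ []) 0 wt wh ct ch) tt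
                (cm (0 ∷ 0 ∷ 0 ∷ 0 ∷ 0 ∷ n ∷ 0 ∷ suc n ∷ 0 ∷ 0 ∷ 0 ∷ 0 ∷ 0 ∷ []) 0 wt wh ct ch)
      initN-does n<V =
        Does-loop x (rounds n 0 (+-identityʳ n)) 1+n≤N^1 ▷
        to (cong (G 0) (n∸n≡0 n))
            (drain-does (λ j i → G j (n ∸ i)) n (λ i → isReg ipos (G 0 (n ∸ i)))
               (λ i j i<n → subst (λ z → D inL (G j z) tt (G j (n ∸ suc i))) (sym (∸-peel i<n)) inL-does) 1+n≤N^1) ▷
        inc-does nLo n<V
        where
        F : ℕ → CM nregs
        F i = cm (i ∷ 0 ∷ 0 ∷ 0 ∷ 0 ∷ i ∷ 0 ∷ i ∷ 0 ∷ 0 ∷ 0 ∷ 0 ∷ 0 ∷ []) i wt wh ct ch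
        G : ℕ → ℕ → CM nregs
        G j i = cm (j ∷ 0 ∷ 0 ∷ 0 ∷ 0 ∷ n ∷ 0 ∷ n ∷ 0 ∷ 0 ∷ 0 ∷ 0 ∷ 0 ∷ []) i wt wh ct ch
        rounds : ∀ j i → j + i ≡ n → Rounds x {Rep = Rep} scanRound tt (F i) (suc j) tt (F n)
        rounds zero    i refl = last (exit (readIn-≥ x) rdI-does ▷ Does-ret)
        rounds (suc j) i eq   = again
            (exit (proj₂ (readIn-< x i i<n)) rdI-does ▷
            inR-does i<n ▷
            inc-does ipos i<V ▷ inc-does tmp₁ i<V ▷ inc-does nLo i<V ▷ Does-ret)
            (rounds j (suc i) (trans (+-suc j i) eq))
          where
          i<n : i < n
          i<n = subst (i <_) eq (s≤s (m≤n+m i j))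
          i<V : suc i < V
          i<V = <-trans (s≤s i<n) n<V

    logState : List Bool → List Bool → ℕ → ℕ → ℕ → CM nregs
    logState wt ct wr t₁ t₂ = cm (0 ∷ 0 ∷ wr ∷ 0 ∷ 0 ∷ t₁ ∷ t₂ ∷ suc n ∷ 0 ∷ 0 ∷ 0 ∷ 0 ∷ 0 ∷ []) 0 wt 0 ct 0

    module _ {wt ct : List Bool} where
      private
        G : ℕ → ℕ → ℕ → CM nregs
        G = logState wt ct

      halve-rounds : ∀ {wr} y t → y + t < V →
        ∃ λ k → k ≤ suc y × Rounds x {Rep = Rep} halveRound tt (G wr y t) k tt (G wr 0 (⌈ y /2⌉ + t))
      halve-rounds zero t _ = 1 , ≤-refl , last (isz-does tmp₁ ▷ Does-ret)
      halve-rounds (suc zero) t p =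
        1 , s≤s z≤n , last (isz-does tmp₁ ▷ dec-does tmp₁ refl ▷ inc-does tmp₂ p ▷
          isz-does tmp₁ ▷ Does-ret)
      halve-rounds {wr} (suc (suc y)) t p with halve-rounds {wr} y (suc t) (≤-<-trans (≤-reflexive (+-suc y t)) (<-trans (n<1+n _) p))
      ... | k , k≤ , rs = suc k , s≤s (m≤n⇒m≤1+n k≤) ,
        again (isz-does tmp₁ ▷ dec-does tmp₁ refl ▷
              inc-does tmp₂ (≤-<-trans (s≤s (m≤n+m t (suc y))) p) ▷
              isz-does tmp₁ ▷ dec-does tmp₁ refl ▷ Does-ret)
          (subst (λ z → Rounds x {Rep = Rep} halveRound tt (G wr y (suc t)) k tt (G wr 0 z)) (+-suc ⌈ y /2⌉ t) rs)

      incs-does : ∀ {t₁ t₂} k wr → k + wr < V → D (incs k wrem) (G wr t₁ t₂) tt (G (k + wr) t₁ t₂)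
      incs-does zero    wr p = Does-ret
      incs-does {t₁} {t₂} (suc k) wr p =
        inc-does wrem (≤-<-trans (s≤s (m≤n+m wr k)) p) ▷
          to (cong (λ z → G z t₁ t₂) (+-suc k wr)) (incs-does k (suc wr) (subst (_< V) (sym (+-suc k wr)) p))

      log-rounds : ∀ k y → Acc _<_ y → ∀ wr → y < V → y ≤ n → k * ⌈log₂ suc (suc y) ⌉ + wr < V →
        ∃ λ r → r ≤ suc y × Rounds x {Rep = Rep} (logRound k) tt (G wr y 0) r tt (G (k * ⌈log₂ suc (suc y) ⌉ + wr) 0 0)
      log-rounds k y (acc rs) wr y<V y≤n bound = byHalf ⌈ y /2⌉ refl
        where
        halving : D (loop 1 halveRound tt) (G wr y 0) tt (G wr 0 ⌈ y /2⌉)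
        halving = to (cong (G wr 0) (+-identityʳ _))
          (Does-loop x (proj₂ (proj₂ halves)) (≤-trans (proj₁ (proj₂ halves)) (≤-trans (s≤s y≤n) 1+n≤N^1)))
          where
          halves : ∃ λ h → h ≤ suc y × Rounds x {Rep = Rep} halveRound tt (G wr y 0) h tt (G wr 0 (⌈ y /2⌉ + 0))
          halves = halve-rounds {wr} y 0 (subst (_< V) (sym (+-identityʳ y)) y<V)
        byHalf : ∀ h → ⌈ y /2⌉ ≡ h →
          ∃ λ r → r ≤ suc y × Rounds x {Rep = Rep} (logRound k) tt (G wr y 0) r tt (G (k * ⌈log₂ suc (suc y) ⌉ + wr) 0 0)
        byHalf zero eq = 1 , s≤s z≤n ,
          last (to (cong (G wr 0) eq) halving ▷
               incs-does k wr (subst (λ z → z + wr < V) ℓ≡ bound) ▷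
               isz-does tmp₂ ▷
                 to (cong (λ z → G (z + wr) 0 0) (sym ℓ≡)) (Does-ret))
          where
          ℓ≡ : k * ⌈log₂ suc (suc y) ⌉ ≡ k
          ℓ≡ = trans (cong (k *_) (trans (log-unfold y) (cong (λ z → suc ⌈log₂ suc z ⌉) eq))) (*-identityʳ k)
        byHalf (suc q) eq = suc (proj₁ IH) , s≤s (≤-trans (proj₁ (proj₂ IH)) q<y) ,
          again (to (cong (G wr 0) eq) halving ▷
                incs-does k wr (≤-<-trans (+-monoˡ-≤ wr (subst (k ≤_) (sym ℓ≡) (m≤m+n k _))) bound) ▷
                isz-does tmp₂ ▷
                dec-does tmp₂ refl ▷
                drain-does (λ j i → G (k + wr) i j) q (λ i → isReg tmp₂ (G (k + wr) i 0))
                      (λ i j i< → inc-does tmp₁ (≤-<-trans (≤-trans i< (<⇒≤ q<y)) y<V))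
                      (≤-trans (s≤s (≤-trans (<⇒≤ q<y) y≤n)) 1+n≤N^1) ▷
                Does-ret)
            (subst (λ z → Rounds x {Rep = Rep} (logRound k) tt (G (k + wr) q 0) (proj₁ IH) tt (G z 0 0)) (sym total) (proj₂ (proj₂ IH)))
          where
          q<y : q < y
          q<y = subst (_≤ y) eq (⌈n/2⌉≤n y)
          ℓ≡ : k * ⌈log₂ suc (suc y) ⌉ ≡ k + k * ⌈log₂ suc (suc q) ⌉
          ℓ≡ = trans (cong (k *_) (trans (log-unfold y) (cong (λ z → suc ⌈log₂ suc z ⌉) eq))) (*-suc k _)
          total : k * ⌈log₂ suc (suc y) ⌉ + wr ≡ k * ⌈log₂ suc (suc q) ⌉ + (k + wr)
          total = trans (cong (_+ wr) (trans ℓ≡ (+-comm k _))) (+-assoc _ k wr)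
          IH : ∃ λ r → r ≤ suc q × Rounds x {Rep = Rep} (logRound k) tt (G (k + wr) q 0) r tt (G (k * ⌈log₂ suc (suc q) ⌉ + (k + wr)) 0 0)
          IH = log-rounds k q (rs q<y) (k + wr) (<-trans q<y y<V) (≤-trans (<⇒≤ q<y) y≤n) (subst (_< V) total bound)

      initW-does : ∀ k → n < V → k * ⌈log₂ N x ⌉ < V →
        D (initW k) (G 0 n 0) tt (G (k * ⌈log₂ N x ⌉ ∸ 1) 0 0)
      initW-does zero    n<V bound = counted
        where
        logs : ∃ λ r → r ≤ suc n × Rounds x {Rep = Rep} (logRound 0) tt (G 0 n 0) r tt (G 0 0 0)
        logs = log-rounds zero n (<-wellFounded n) 0 n<V ≤-refl bound
        counted : D (initW zero) (G 0 n 0) tt (G 0 0 0)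
        counted = Does-loop x (proj₂ (proj₂ logs)) (≤-trans (proj₁ (proj₂ logs)) 1+n≤N^1)
      initW-does (suc k) n<V bound = Does-loop x (proj₂ (proj₂ logs)) (≤-trans (proj₁ (proj₂ logs)) 1+n≤N^1) ▷
          dec-does wrem positive
        where
        ℓ : ℕ
        ℓ = ⌈log₂ suc (suc n) ⌉
        ℓ≡ : suc k * ℓ + 0 ≡ suc k * ⌈log₂ N x ⌉
        ℓ≡ = trans (+-identityʳ _) (cong (λ z → suc k * ⌈log₂ z ⌉) (sym N≡))
        logs : ∃ λ r → r ≤ suc n × Rounds x {Rep = Rep} (logRound (suc k)) tt (G 0 n 0) r tt (G (suc k * ℓ + 0) 0 0)
        logs = log-rounds (suc k) n (<-wellFounded n) 0 n<V ≤-refl (subst (_< V) (sym ℓ≡) bound)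
        positive : suc k * ℓ + 0 ≡ suc (suc k * ⌈log₂ N x ⌉ ∸ 1)
        positive = trans ℓ≡ (sym (m+[n∸m]≡n {1} (subst (1 ≤_) ℓ≡ (subst (λ z → 1 ≤ suc k * z + 0) (sym (log-unfold n)) (s≤s z≤n)))))

    record PowRegs (r : Fin nregs) (G : (rv t n₀ n₁ : ℕ) → CM nregs) : Set where
      field
        reg-r : ∀ t n₀ n₁ → IsReg r (λ v → G v t n₀ n₁)
        reg-t : ∀ v n₀ n₁ → IsReg tmp₂ (λ t → G v t n₀ n₁)
        reg-0 : ∀ v t n₁ → IsReg nLo (λ n₀ → G v t n₀ n₁)
        reg-1 : ∀ v t n₀ → IsReg nHi (λ n₁ → G v t n₀ n₁)

    module _ {r : Fin nregs} {G : (rv t n₀ n₁ : ℕ) → CM nregs} (regs : PowRegs r G) where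
      open PowRegs regs

      addN-does : ∀ v t → t + N x < V → D addN (G v t (suc n) 0) tt (G v (N x + t) (suc n) 0)
      addN-does v t p = to (cong (λ z → G v (z + t) (suc n) 0) (sym N≡))
        (rep-does (λ a b i → G v (i + t) a b) (λ _ → tt) (suc n) (λ i b → reg-0 v (i + t) b) (λ i a → reg-1 v (i + t) a)
          (≤-<-trans (≤-trans (n≤1+n _) (≤-trans (≤-reflexive (sym N≡)) (m≤n+m (N x) t))) p)
          (≤-reflexive (trans (sym N≡) (sym (*-identityʳ (N x)))))
          (λ i a b i≤ → inc-reg (reg-t v a b) (i + t)
            (≤-<-trans (≤-trans (+-monoˡ-≤ t (s≤s i≤)) (≤-reflexive (trans (cong (_+ t) (sym N≡)) (+-comm (N x) t)))) p)))

      mulN-does : ∀ e → N x ^ suc e < V → D (mulN e r) (G (N x ^ e ∸ 1) 0 (suc n) 0) tt (G (N x ^ suc e ∸ 1) 0 (suc n) 0)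
      mulN-does e p =
        drain-does (λ j i → G j (i * N x) (suc n) 0) v (λ i → reg-r (i * N x) (suc n) 0)
            (λ i j i< → addN-does j (i * N x) (≤-<-trans (≤-trans (≤-reflexive (+-comm (i * N x) (N x))) (≤-trans (*-monoˡ-≤ (N x) i<) v*N≤)) p))
            (≤-reflexive 1+v) ▷
        addN-does 0 (v * N x) (≤-<-trans (≤-reflexive (trans (+-comm (v * N x) (N x)) total)) p) ▷
        subst (λ z → D (dec tmp₂) (G 0 z (suc n) 0) tt (G 0 (N x ^ suc e ∸ 1) (suc n) 0)) (sym total′)
                       (dec-reg (reg-t 0 (suc n) 0) (N x ^ suc e ∸ 1)) ▷
          drain-does (λ j i → G i j (suc n) 0) (N x ^ suc e ∸ 1) (λ i → reg-t i (suc n) 0)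
            (λ i j i< → inc-reg (reg-r j (suc n) 0) i (≤-<-trans (≤-trans i< (m∸n≤m _ 1)) p)) (≤-reflexive (1+[N^e∸1] x (suc e)))
        where
        v : ℕ
        v = N x ^ e ∸ 1
        1+v : suc v ≡ N x ^ e
        1+v = 1+[N^e∸1] x e
        total : N x + v * N x ≡ N x ^ suc e
        total = trans (cong (_* N x) 1+v) (*-comm (N x ^ e) (N x))
        total′ : N x + v * N x ≡ suc (N x ^ suc e ∸ 1)
        total′ = trans total (sym (1+[N^e∸1] x (suc e)))
        v*N≤ : v * N x ≤ N x ^ suc e
        v*N≤ = ≤-trans (m≤n+m (v * N x) (N x)) (≤-reflexive total)

      initPow-does : ∀ e → N x ^ e < V → D (initPow e r) (G 0 0 (suc n) 0) tt (G (N x ^ e ∸ 1) 0 (suc n) 0)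
      initPow-does zero    p = Does-ret
      initPow-does (suc e) p = initPow-does e (≤-<-trans (N^-mono x (n≤1+n e)) p) ▷ mulN-does e p

    -- surroundings of the simulated configuration: the catalytic tape before and after
    -- the current window and the contents of the two timers
    record Frame : Set where
      constructor frame
      field
        pre post    : List Bool
        a₀ a₁ b₀ b₁ : ℕ

    -- `cpos` and `crem` are relative to the window while the real head is offset by the length of
    -- `pre`; the simulated machine thus takes the ends of the window for the ends of its tape.
    simState : Frame → ℕ → List Bool → ℕ → List Bool → ℕ → CM nregs
    simState (frame pre post a₀ a₁ b₀ b₁) ih w wh c ch =
      cm (ih ∷ wh ∷ length w ∸ suc wh ∷ ch ∷ length c ∸ suc ch ∷ 0 ∷ 0 ∷ suc n ∷ 0 ∷ a₀ ∷ a₁ ∷ b₀ ∷ b₁ ∷ [])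
         ih w wh (pre ++ c ++ post) (length pre + ch)

    window< : ∀ {pre post : List Bool} {len h} (c : List Bool) → length c ≡ len → h < len → length pre + h < length (pre ++ c ++ post)
    window< {pre} {post} {len} {h} c refl h< = subst (length pre + h <_) (sym (length-++ pre))
      (+-monoʳ-< (length pre) (≤-trans h< (subst (length c ≤_) (sym (length-++ c)) (m≤m+n _ _))))

    tryI-does : ∀ {fr ih w wh c ch} m → ih ≤ n → suc n < V →
      D (tryI m) (simState fr ih w wh c ch) (eff (suc n) m ih) (simState fr (move (suc n) m ih) w wh c ch)
    tryI-does S ih≤ n<V = Does-ret
    tryI-does {ih = zero}   L ih≤ n<V = isz-does ipos ▷ Does-ret
    tryI-does {ih = suc ih} L ih≤ n<V = isz-does ipos ▷ dec-does ipos refl ▷ inL-does ▷ Does-ret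
    tryI-does {fr} {ih} {w} {wh} {c} {ch} R ih≤ n<V = byEdge (suc ih <? suc n)
      where
      byEdge : Dec (suc ih < suc n) →
        D (tryI R) (simState fr ih w wh c ch) (eff (suc n) R ih) (simState fr (move (suc n) R ih) w wh c ch)
      byEdge (yes (s≤s p)) rewrite <ᵇ-true p =
        exit (proj₂ (readIn-< x ih p)) rdI-does ▷
        inc-does ipos (<-trans (s≤s p) n<V) ▷ inR-does p ▷ Does-ret
      byEdge (no ¬p) rewrite <ᵇ-false ih n (λ p → ¬p (s≤s p)) =
        exit (subst (λ z → readIn x z ≡ nothing) (≤-antisym (≮⇒≥ (λ p → ¬p (s≤s p))) ih≤) (readIn-≥ x)) rdI-does ▷ Does-ret

    module _ {fr : Frame} {ih : ℕ} where

      tryW-does : ∀ {w wh c ch} m → wh < length w → length w < V →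
        D (tryW m) (simState fr ih w wh c ch) (eff (length w) m wh) (simState fr ih w (move (length w) m wh) c ch)
      tryW-does S wh< len<V = Does-ret
      tryW-does {wh = zero} L wh< len<V = isz-does wpos ▷ Does-ret
      tryW-does {w} {suc wh} {c} {ch} L wh< len<V =
        isz-does wpos ▷
        dec-does wpos refl ▷
        subst (λ z → D (inc wrem) (at (length w ∸ suc (suc wh))) tt (at z)) (sym (∸-peel wh<))
                       (inc-does wrem (subst (_< V) (∸-peel wh<) (≤-<-trans (m∸n≤m (length w) (suc wh)) len<V))) ▷
        wL-does wh< ▷ Does-ret
        where
        open Frame fr
        at : ℕ → CM nregs
        at z = cm (ih ∷ wh ∷ z ∷ ch ∷ length c ∸ suc ch ∷ 0 ∷ 0 ∷ suc n ∷ 0 ∷ a₀ ∷ a₁ ∷ b₀ ∷ b₁ ∷ []) ih w (suc wh) (pre ++ c ++ post) (length pre + ch)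
      tryW-does {w} {wh} {c} {ch} R wh< len<V = byEdge (suc wh <? length w)
        where
        byEdge : Dec (suc wh < length w) →
          D (tryW R) (simState fr ih w wh c ch) (eff (length w) R wh) (simState fr ih w (move (length w) R wh) c ch)
        byEdge (yes p) rewrite <ᵇ-true p =
          exit (cong (_≡ᵇ 0) (∸-peel p)) (isz-does wrem) ▷
          dec-does wrem (∸-peel p) ▷
          inc-does wpos (<-trans p len<V) ▷
          wR-does p ▷ Does-ret
        byEdge (no ¬p) rewrite <ᵇ-false (suc wh) (length w) ¬p =
          exit (cong (_≡ᵇ 0) (m≤n⇒m∸n≡0 (≮⇒≥ ¬p))) (isz-does wrem) ▷ Does-ret

      tryC-does : ∀ {w wh c ch} m → ch < length c → length c < V →
        D (tryC m) (simState fr ih w wh c ch) (eff (length c) m ch) (simState fr ih w wh c (move (length c) m ch))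
      tryC-does S ch< len<V = Does-ret
      tryC-does {ch = zero} L ch< len<V = isz-does cpos ▷ Does-ret
      tryC-does {w} {wh} {c} {suc ch} L ch< len<V =
        isz-does cpos ▷
        dec-does cpos refl ▷
        subst (λ z → D (inc crem) (at (length c ∸ suc (suc ch))) tt (at z)) (sym (∸-peel ch<))
                       (inc-does crem (subst (_< V) (∸-peel ch<) (≤-<-trans (m∸n≤m (length c) (suc ch)) len<V))) ▷
        subst (λ z → D cL (off z) tt (off (length pre + ch))) (sym (+-suc (length pre) ch))
                       (cL-does (subst (_< length (pre ++ c ++ post)) (+-suc (length pre) ch) (window< {pre} {post} c refl ch<))) ▷
          Does-ret
        where
        open Frame fr
        at : ℕ → CM nregs
        at z = cm (ih ∷ wh ∷ length w ∸ suc wh ∷ ch ∷ z ∷ 0 ∷ 0 ∷ suc n ∷ 0 ∷ a₀ ∷ a₁ ∷ b₀ ∷ b₁ ∷ []) ih w wh (pre ++ c ++ post) (length pre + suc ch)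
        off : ℕ → CM nregs
        off z = cm (ih ∷ wh ∷ length w ∸ suc wh ∷ ch ∷ length c ∸ suc ch ∷ 0 ∷ 0 ∷ suc n ∷ 0 ∷ a₀ ∷ a₁ ∷ b₀ ∷ b₁ ∷ []) ih w wh (pre ++ c ++ post) z
      tryC-does {w} {wh} {c} {ch} R ch< len<V = byEdge (suc ch <? length c)
        where
        open Frame fr
        off : ℕ → CM nregs
        off z = cm (ih ∷ wh ∷ length w ∸ suc wh ∷ suc ch ∷ length c ∸ suc (suc ch) ∷ 0 ∷ 0 ∷ suc n ∷ 0 ∷ a₀ ∷ a₁ ∷ b₀ ∷ b₁ ∷ []) ih w wh (pre ++ c ++ post) z
        byEdge : Dec (suc ch < length c) →
          D (tryC R) (simState fr ih w wh c ch) (eff (length c) R ch) (simState fr ih w wh c (move (length c) R ch))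
        byEdge (yes p) rewrite <ᵇ-true p =
          exit (cong (_≡ᵇ 0) (∸-peel p)) (isz-does crem) ▷
          dec-does crem (∸-peel p) ▷
          inc-does cpos (<-trans p len<V) ▷
          subst (λ z → D cR (off (length pre + ch)) tt (off z)) (sym (+-suc (length pre) ch))
                         (cR-does (subst (_< length (pre ++ c ++ post)) (+-suc (length pre) ch) (window< {pre} {post} c refl p))) ▷
            Does-ret
        byEdge (no ¬p) rewrite <ᵇ-false (suc ch) (length c) ¬p =
          exit (cong (_≡ᵇ 0) (m≤n⇒m∸n≡0 (≮⇒≥ ¬p))) (isz-does crem) ▷ Does-ret

-- The Euler tour of the configuration graph

infix 4 _≟ꟳ_
_≟ꟳ_ : {A : Set} ⦃ _ : Finite A ⦄ (a b : A) → Dec (a ≡ b)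
a ≟ꟳ b = map′ encode-injective (cong encode) (encode a ≟ᶠ encode b)

opp-opp : ∀ d → opp (opp d) ≡ d
opp-opp L = refl
opp-opp S = refl
opp-opp R = refl

move-eff : ∀ len m h → move len (eff len m h) h ≡ move len m h
move-eff len L zero    = refl
move-eff len L (suc h) = refl
move-eff len S h       = refl
move-eff len R h with suc h <ᵇ len in eq
... | true  rewrite eq = refl
... | false = refl

move-< : ∀ {len} m h → h < len → move len m h < len
move-< L zero    p = p
move-< L (suc h) p = <-trans (n<1+n h) p
move-< S h       p = p
move-< {len} R h p with suc h <? len
... | yes q rewrite <ᵇ-true q = q
... | no ¬q rewrite <ᵇ-false (suc h) len ¬q = p

-- A blocked move has displacement `S`, and any other leaves room for the way back. Hence the
-- displacement performed determines the inverse, whereas the move `m` that was asked for does not.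
move-undo : ∀ {len} m h → h < len →
  eff len (opp (eff len m h)) (move len m h) ≡ opp (eff len m h) ×
  move len (opp (eff len m h)) (move len m h) ≡ h
move-undo L zero    p = refl , refl
move-undo L (suc h) p rewrite <ᵇ-true p = refl , refl
move-undo S h       p = refl , refl
move-undo {len} R h p with suc h <? len
... | yes q rewrite <ᵇ-true q = refl , refl
... | no ¬q rewrite <ᵇ-false (suc h) len ¬q = refl , refl

move-redo : ∀ {len d} h → h < len → eff len (opp d) h ≡ opp d → move len d (move len (opp d) h) ≡ h
move-redo {len} {d} h p eq = trans (cong (λ z → move len z (move len (opp d) h)) (sym (trans (cong opp eq) (opp-opp d))))
  (proj₂ (move-undo (opp d) h p))

write-write : ∀ l i u v → write (write l i u) i v ≡ write l i v
write-write []      i       u v = refl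
write-write (b ∷ l) zero    u v = refl
write-write (b ∷ l) (suc i) u v = cong (b ∷_) (write-write l i u v)

skip : ∀ {K} → Fin (suc K) → Fin (suc (suc K))
skip zero    = zero
skip (suc j) = suc (suc j)

-- The cyclic successor i + 1 modulo K + 1 and its inverse: the cyclic order of the darts at a
-- configuration, which the tour follows.
rot unrot : ∀ {K} → Fin (suc K) → Fin (suc K)
rot {zero}  zero    = zero
rot {suc K} zero    = suc zero
rot {suc K} (suc i) = skip (rot i)
unrot {K} zero  = fromℕ K
unrot (suc i)   = inject₁ i

unrot-rot : ∀ {K} (d : Fin (suc K)) → unrot (rot d) ≡ d
unrot-rot {zero}  zero    = refl
unrot-rot {suc K} zero    = refl
unrot-rot {suc K} (suc i) = trans (unskip (rot i)) (cong suc (unrot-rot i))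
  where
  unskip : ∀ z → unrot (skip z) ≡ suc (unrot z)
  unskip zero    = refl
  unskip (suc j) = refl

rot-last : ∀ K → rot (fromℕ K) ≡ zero
rot-last zero    = refl
rot-last (suc K) = cong skip (rot-last K)

rot-inject₁ : ∀ {K} (i : Fin K) → rot (inject₁ i) ≡ suc i
rot-inject₁ {suc K} zero    = refl
rot-inject₁ {suc K} (suc i) = cong skip (rot-inject₁ i)

lower : ∀ {K} (d : Fin (suc K)) → toℕ d < K → ∃ λ i → d ≡ inject₁ i
lower {suc K} zero    p       = zero , refl
lower {suc K} (suc d) (s≤s p) with lower d p
... | i , eq = suc i , cong suc eq

iter : {A : Set} → (A → A) → ℕ → A → A
iter f zero    a = a
iter f (suc k) a = iter f k (f a)

iter-+ : ∀ {A : Set} (f : A → A) j k a → iter f (j + k) a ≡ iter f k (iter f j a)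
iter-+ f zero    k a = refl
iter-+ f (suc j) k a = iter-+ f j k (f a)

iter-suc : ∀ {A : Set} (f : A → A) k a → iter f (suc k) a ≡ f (iter f k a)
iter-suc f zero    a = refl
iter-suc f (suc k) a = iter-suc f k (f a)

unique-lookup : ∀ {A : Set} {xs : List A} → Unique xs → ∀ {i j} → lookup xs i ≡ lookup xs j → i ≡ j
unique-lookup (_ ∷ _)  {zero}  {zero}  _  = refl
unique-lookup (h ∷ _)  {zero}  {suc j} eq = contradiction eq (All.lookup h (∈-lookup j))
unique-lookup (h ∷ _)  {suc i} {zero}  eq = contradiction (sym eq) (All.lookup h (∈-lookup i))
unique-lookup (_ ∷ us) {suc i} {suc j} eq = cong suc (unique-lookup us eq)

length-≤-by-injection : ∀ {A B : Set} {xs : List A} {ys : List B} (f : A → B) → Unique xs →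
  (∀ {a} → a ∈ xs → f a ∈ ys) → (∀ {a b} → a ∈ xs → b ∈ xs → f a ≡ f b → a ≡ b) → length xs ≤ length ys
length-≤-by-injection {xs = xs} {ys} f u into inj =
  injective⇒≤ {f = λ i → Any.index (into (∈-lookup i))} λ {i} {j} eq →
    unique-lookup u (inj (∈-lookup i) (∈-lookup j)
      (trans (lookup-index (into (∈-lookup {xs = xs} i)))
        (trans (cong (lookup ys) eq) (sym (lookup-index (into (∈-lookup {xs = xs} j)))))))

∈-allBits : ∀ {c} l → length l ≡ c → l ∈ allBits c
∈-allBits []          refl = here refl
∈-allBits (false ∷ l) refl = ∈-++⁺ˡ (∈-map⁺ (false ∷_) (∈-allBits l refl))
∈-allBits (true ∷ l)  refl = ∈-++⁺ʳ _ (∈-map⁺ (true ∷_) (∈-allBits l refl))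

module Tour (M : Machine) where
  open Machine M

  δ′ : Fin Q → Reads → Action Q
  δ′ q (i , a , b) = δ q i a b

  -- what a transition u → v erases: state and symbols of u and the actual head displacements
  Idx : Set
  Idx = Fin Q × Reads × Move × Move × Move

  abstract
    finite-Idx : Finite Idx
    finite-Idx = finite-×

  K : ℕ
  K = Finite.size finite-Idx

  encI : Idx → Fin K
  encI = Finite.encode finite-Idx

  decI : Fin K → Idx
  decI = Finite.decode finite-Idx

  -- zero is the edge to the successor, suc j the possible edge to the j-th predecessor
  Dart : Set
  Dart = Fin (suc K)

  movesOf : Action Q → Move × Move × Move
  movesOf (halt _)            = S , S , S
  movesOf (go _ _ _ mi mw mc) = mi , mw , mc

  opp³ : Move × Move × Move → Move × Move × Move
  opp³ (a , b , c) = opp a , opp b , opp c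

  Fits : Fin Q → Action Q → Reads → Set
  Fits st (halt _) _ = ⊥
  Fits st (go st′ ww cw _ _ _) (_ , a , b) = (st′ ≡ st) × (ww ≡ a) × (cw ≡ b)

  fits? : ∀ st α r → Dec (Fits st α r)
  fits? st (halt _) _ = no λ ()
  fits? st (go st′ ww cw _ _ _) (_ , a , b) = (st′ ≟ᶠ st) ×-dec (ww ≟ꟳ a) ×-dec (cw ≟ꟳ b)

  -- e: displacements of the heads when moved backwards, r: the symbols found there,
  -- f: displacements that the transition would perform from there
  Match : Fin Q → Fin K → Idx → (e : Move × Move × Move) (r : Reads) (f : Move × Move × Move) → Set
  Match st j (q , s , d) e r f =
    (encI (q , s , d) ≡ j) × Fits st (δ′ q s) r × (proj₁ r ≡ proj₁ s) × (e ≡ opp³ d) × (f ≡ d)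

  abstract
    match? : ∀ st j idx e r f → Dec (Match st j idx e r f)
    match? st j (q , s , d) e r f =
      (encI (q , s , d) ≟ᶠ j) ×-dec fits? st (δ′ q s) r ×-dec (proj₁ r ≟ꟳ proj₁ s) ×-dec (e ≟ꟳ opp³ d) ×-dec (f ≟ꟳ d)

  start-config : ℕ → List Bool → Config Q
  start-config s τ = config start 0 (replicate s false) 0 τ 0

  module _ (x : List Bool) where

    n₁ : ℕ
    n₁ = suc (length x)

    V : Set
    V = Config Q

    look : ℕ → List Bool → ℕ → List Bool → ℕ → Reads
    look ih w wh c ch = readIn x ih , read w wh , read c ch

    readsOf : V → Reads
    readsOf (config _ ih w wh c ch) = look ih w wh c ch

    effs : ℕ → ℕ → Move × Move × Move → ℕ → ℕ → ℕ → Move × Move × Move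
    effs lw lc (mi , mw , mc) ih wh ch = eff n₁ mi ih , eff lw mw wh , eff lc mc ch

    after : V → Fin Q → Bool → Bool → Move → Move → Move → V
    after (config _ ih w wh c ch) st ww cw mi mw mc =
      config st (move n₁ mi ih) (write w wh ww) (move (length w) mw wh) (write c ch cw) (move (length c) mc ch)

    effsAt : V → Move × Move × Move → Move × Move × Move
    effsAt (config _ ih w wh c ch) m = effs (length w) (length c) m ih wh ch

    pull : V → Idx → V
    pull (config st ih w wh c ch) (_ , _ , dI , dW , dC) =
      config st (move n₁ (opp dI) ih) w (move (length w) (opp dW) wh) c (move (length c) (opp dC) ch)

    rewind : V → Idx → V
    rewind (config _ ih w wh c ch) (q , (_ , a , b) , _) = config q ih (write w wh a) wh (write c ch b) ch

    matchAt? : ∀ v j idx → Dec (Match (Config.state v) j idx (effsAt v (opp³ (proj₂ (proj₂ idx))))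
      (readsOf (pull v idx)) (effsAt (pull v idx) (movesOf (δ′ (proj₁ idx) (proj₁ (proj₂ idx))))))
    matchAt? v j idx = match? _ _ _ _ _ _

    flipOut : V → Action Q → V × Dart
    flipOut v (halt b) = v , zero
    flipOut v (go st ww cw mi mw mc) =
      after v st ww cw mi mw mc , suc (encI (Config.state v , readsOf v , effsAt v (mi , mw , mc)))

    flipIn : ∀ {P : Set} → V → Fin K → Idx → Dec P → V × Dart
    flipIn v j idx (yes _) = rewind (pull v idx) idx , zero
    flipIn v j idx (no _)  = v , suc j

    -- follow a dart to the dart at its other end; a missing edge leads back to itself
    flip : V × Dart → V × Dart
    flip (v , zero)  = flipOut v (δ′ (Config.state v) (readsOf v))
    flip (v , suc j) = flipIn v j (decI j) (matchAt? v j (decI j))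

    Valid : V → Set
    Valid (config _ ih w wh c ch) = ih < n₁ × wh < length w × ch < length c

    after-pull : ∀ v st ww cw m → Valid v → ∀ q r →
      pull (after v st ww cw (proj₁ m) (proj₁ (proj₂ m)) (proj₂ (proj₂ m))) (q , r , effsAt v m)
        ≡ config st (Config.inH v) (write (Config.work v) (Config.workH v) ww) (Config.workH v)
                    (write (Config.cat v) (Config.catH v) cw) (Config.catH v)
    after-pull (config _ ih w wh c ch) st ww cw (mi , mw , mc) (p₁ , p₂ , p₃) q r
      rewrite length-write w wh ww | length-write c ch cw
            | proj₂ (move-undo mi ih p₁) | proj₂ (move-undo mw wh p₂) | proj₂ (move-undo mc ch p₃) = refl

    after-effs : ∀ v st ww cw mi mw mc → Valid v →
      effsAt (after v st ww cw mi mw mc) (opp³ (effsAt v (mi , mw , mc))) ≡ opp³ (effsAt v (mi , mw , mc))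
    after-effs (config _ ih w wh c ch) st ww cw mi mw mc (p₁ , p₂ , p₃)
      rewrite length-write w wh ww | length-write c ch cw
            | proj₁ (move-undo mi ih p₁) | proj₁ (move-undo mw wh p₂) | proj₁ (move-undo mc ch p₃) = refl

    flipIn-yes : ∀ {P : Set} v j idx (d : Dec P) → P → flipIn v j idx d ≡ (rewind (pull v idx) idx , zero)
    flipIn-yes v j idx (yes _) p = refl
    flipIn-yes v j idx (no ¬p) p = contradiction p ¬p

    -- The index of the dart arrived at contains all that the transition erases. Moving back by the
    -- opposite displacements leads to the old head positions, where the written symbols are found;
    -- so the test succeeds, and `rewind` puts back the old ones.
    flip-out-in : ∀ v st ww cw mi mw mc → Valid v → δ′ (Config.state v) (readsOf v) ≡ go st ww cw mi mw mc →
      flip (flipOut v (go st ww cw mi mw mc)) ≡ (v , zero)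
    flip-out-in v@(config q ih w wh c ch) st ww cw mi mw mc valid@(p₁ , p₂ , p₃) eq =
      trans (cong (λ z → flipIn v′ j z (matchAt? v′ j z)) (Finite.decode-encode finite-Idx idx))
        (trans (flipIn-yes v′ j idx (matchAt? v′ j idx) matches) (cong (_, zero) rewound))
      where
      idx : Idx
      idx = q , readsOf v , effsAt v (mi , mw , mc)
      j : Fin K
      j = encI idx
      v′ : V
      v′ = after v st ww cw mi mw mc
      pulled : pull v′ idx ≡ config st ih (write w wh ww) wh (write c ch cw) ch
      pulled = after-pull v st ww cw (mi , mw , mc) valid q (readsOf v)
      fits : Fits st (δ′ q (readsOf v)) (readsOf (pull v′ idx))
      fits = subst (λ α → Fits st α (readsOf (pull v′ idx))) (sym eq)
        (subst (λ z → Fits st (go st ww cw mi mw mc) (readsOf z)) (sym pulled)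
          (refl , sym (read-write-same w wh ww p₂) , sym (read-write-same c ch cw p₃)))
      same : effsAt (pull v′ idx) (movesOf (δ′ q (readsOf v))) ≡ effsAt v (mi , mw , mc)
      same = trans (cong (λ α → effsAt (pull v′ idx) (movesOf α)) eq) (trans (cong (λ z → effsAt z (mi , mw , mc)) pulled)
        (cong₂ (λ lw lc → effs lw lc (mi , mw , mc) ih wh ch) (length-write w wh ww) (length-write c ch cw)))
      matches : Match st j idx (effsAt v′ (opp³ (effsAt v (mi , mw , mc)))) (readsOf (pull v′ idx))
        (effsAt (pull v′ idx) (movesOf (δ′ q (readsOf v))))
      matches = refl , fits , cong (λ z → readIn x (Config.inH z)) pulled , after-effs v st ww cw mi mw mc valid , same
      rewound : rewind (pull v′ idx) idx ≡ v
      rewound = trans (cong (λ z → rewind z idx) pulled) (cong₂ (λ w c → config q ih w wh c ch)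
        (trans (write-write w wh ww (read w wh)) (write-read w wh)) (trans (write-write c ch cw (read c ch)) (write-read c ch)))

    -- `Match` says that the transition from the reconstructed configuration writes what stands on
    -- the tapes now and moves the heads to where they are now. Its condition on `encI` selects one
    -- dart per predecessor: `Finite` does not rule out repetitions in the enumeration, and another
    -- dart with the same index would not be returned to.
    flip-in-out : ∀ v j idx → Valid v → Match (Config.state v) j idx (effsAt v (opp³ (proj₂ (proj₂ idx))))
      (readsOf (pull v idx)) (effsAt (pull v idx) (movesOf (δ′ (proj₁ idx) (proj₁ (proj₂ idx))))) →
      flip (rewind (pull v idx) idx , zero) ≡ (v , suc j)
    flip-in-out v@(config st ih w wh c ch) j idx@(q , s@(sym₀ , a , b) , d@(dI , dW , dC)) (p₁ , p₂ , p₃) (enc≡ , fits , sym≡ , e≡ , f≡) =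
      trans (cong (flipOut u) (cong (δ′ q) reads≡)) (out (δ′ q s) refl fits f≡)
      where
      ihu whu chu : ℕ
      ihu = move n₁ (opp dI) ih
      whu = move (length w) (opp dW) wh
      chu = move (length c) (opp dC) ch
      u : V
      u = rewind (pull v idx) idx
      reads≡ : readsOf u ≡ s
      reads≡ = cong₂ _,_ sym≡ (cong₂ _,_ (read-write-same w whu a (move-< (opp dW) wh p₂)) (read-write-same c chu b (move-< (opp dC) ch p₃)))
      out : ∀ α → δ′ q s ≡ α → Fits st α (readsOf (pull v idx)) → effsAt (pull v idx) (movesOf α) ≡ d → flipOut u α ≡ (v , suc j)
      out (go .st ww cw mi mw mc) δ≡ (refl , ww≡ , cw≡) f≡ = cong₂ _,_ config≡ (cong suc (trans (cong encI idx≡) enc≡))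
        where
        idx≡ : (q , readsOf u , effsAt u (mi , mw , mc)) ≡ idx
        idx≡ = cong₂ (λ r z → q , r , z) reads≡
          (trans (cong₂ (λ lw lc → effs lw lc (mi , mw , mc) ihu whu chu) (length-write w whu a) (length-write c chu b)) f≡)
        back : ∀ {len m d h} → h < len → eff len (opp d) h ≡ opp d → eff len m (move len (opp d) h) ≡ d →
          move len m (move len (opp d) h) ≡ h
        back {len} {m} {d} {h} h< e≡ f≡ = trans (sym (move-eff len m (move len (opp d) h)))
          (trans (cong (λ z → move len z (move len (opp d) h)) f≡) (move-redo h h< e≡))
        content : ∀ l i u v → v ≡ read l i → write (write l i u) i v ≡ l
        content l i u v refl = trans (write-write l i u v) (write-read l i)
        config≡ : after u st ww cw mi mw mc ≡ v
        config≡ rewrite length-write w whu a | length-write c chu b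
                      | content w whu a ww ww≡ | content c chu b cw cw≡
                      | back {m = mi} p₁ (cong proj₁ e≡) (cong proj₁ f≡)
                      | back {m = mw} p₂ (cong (λ z → proj₁ (proj₂ z)) e≡) (cong (λ z → proj₁ (proj₂ z)) f≡)
                      | back {m = mc} p₃ (cong (λ z → proj₂ (proj₂ z)) e≡) (cong (λ z → proj₂ (proj₂ z)) f≡) = refl

    flip-flip : ∀ v d → Valid v → flip (flip (v , d)) ≡ (v , d)
    flip-flip v zero valid = out (δ′ (Config.state v) (readsOf v)) refl
      where
      out : ∀ α → δ′ (Config.state v) (readsOf v) ≡ α → flip (flipOut v α) ≡ (v , zero)
      out (halt b) eq = cong (flipOut v) eq
      out (go st ww cw mi mw mc) eq = flip-out-in v st ww cw mi mw mc valid eq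
    flip-flip v (suc j) valid = inn (matchAt? v j (decI j)) refl
      where
      inn : ∀ d → matchAt? v j (decI j) ≡ d → flip (flipIn v j (decI j) d) ≡ (v , suc j)
      inn (yes m) _ = flip-in-out v j (decI j) valid m
      inn (no _) eq = cong (flipIn v j (decI j)) eq

    -- Turn to the next dart, then cross it: the contour walk around a tree. As a rotation followed
    -- by an involution it is undone by crossing first and turning back.
    T T⁻¹ : V × Dart → V × Dart
    T (v , d) = flip (v , rot d)
    T⁻¹ s = map₂ unrot (flip s)

    T⁻¹-T : ∀ v d → Valid v → T⁻¹ (T (v , d)) ≡ (v , d)
    T⁻¹-T v d valid = trans (cong (map₂ unrot) (flip-flip v (rot d) valid)) (cong (v ,_) (unrot-rot d))

    record Good (s c : ℕ) (v : V) : Set where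
      constructor good
      field
        valid   : Valid v
        length-work : length (Config.work v) ≡ s
        length-cat  : length (Config.cat v) ≡ c

    open Good public

    start-good : ∀ {s c τ} → 0 < s → 0 < c → length τ ≡ c → Good s c (start-config s τ)
    start-good {s} 0<s 0<c len =
      good (s≤s z≤n , subst (0 <_) (sym (length-replicate s)) 0<s , subst (0 <_) (sym len) 0<c) (length-replicate s) len

    after-good : ∀ {s c v} st ww cw mi mw mc → Good s c v → Good s c (after v st ww cw mi mw mc)
    after-good {v = config q ih w wh c ch} st ww cw mi mw mc (good (p₁ , p₂ , p₃) refl refl) =
      good (move-< mi ih p₁ ,
            subst (λ z → move (length w) mw wh < z) (sym (length-write w wh ww)) (move-< mw wh p₂) ,
            subst (λ z → move (length c) mc ch < z) (sym (length-write c ch cw)) (move-< mc ch p₃))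
           (length-write w wh ww) (length-write c ch cw)

    rewind-good : ∀ {s c v} idx → Good s c v → Good s c (rewind (pull v idx) idx)
    rewind-good {v = config q ih w wh c ch} (_ , (_ , a , b) , dI , dW , dC) (good (p₁ , p₂ , p₃) refl refl) =
      good (move-< (opp dI) ih p₁ ,
            subst (λ z → move (length w) (opp dW) wh < z) (sym (length-write w _ a)) (move-< (opp dW) wh p₂) ,
            subst (λ z → move (length c) (opp dC) ch < z) (sym (length-write c _ b)) (move-< (opp dC) ch p₃))
           (length-write w _ a) (length-write c _ b)

    flip-good : ∀ {s c} v d → Good s c v → Good s c (proj₁ (flip (v , d)))
    flip-good {s} {c} v zero g = out (δ′ (Config.state v) (readsOf v))
      where
      out : ∀ α → Good s c (proj₁ (flipOut v α))
      out (halt b) = g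
      out (go st ww cw mi mw mc) = after-good st ww cw mi mw mc g
    flip-good {s} {c} v (suc j) g = inn (matchAt? v j (decI j))
      where
      inn : ∀ {P} (d : Dec P) → Good s c (proj₁ (flipIn v j (decI j) d))
      inn (yes _) = rewind-good (decI j) g
      inn (no _)  = g

    -- Components of halting configurations and the walk around them

    data Halts (b : Bool) (τ : List Bool) : V → ℕ → Set where
      stops : ∀ {v} → δ′ (Config.state v) (readsOf v) ≡ halt b → Config.cat v ≡ τ → Halts b τ v 0
      steps : ∀ {v st ww cw mi mw mc m} → δ′ (Config.state v) (readsOf v) ≡ go st ww cw mi mw mc →
             Halts b τ (after v st ww cw mi mw mc) m → Halts b τ v (suc m)

    go-injective : ∀ {st ww cw mi mw mc st′ ww′ cw′ mi′ mw′ mc′} v → go st ww cw mi mw mc ≡ go st′ ww′ cw′ mi′ mw′ mc′ →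
      after v st ww cw mi mw mc ≡ after v st′ ww′ cw′ mi′ mw′ mc′
    go-injective v refl = refl

    Halts-unique : ∀ {b b′ τ τ′ v m m′} → Halts b τ v m → Halts b′ τ′ v m′ → b ≡ b′ × τ ≡ τ′ × m ≡ m′
    Halts-unique (stops eq refl) (stops eq′ refl) with trans (sym eq) eq′
    ... | refl = refl , refl , refl
    Halts-unique (stops eq _) (steps eq′ _) with trans (sym eq) eq′
    ... | ()
    Halts-unique (steps eq _) (stops eq′ _) with trans (sym eq) eq′
    ... | ()
    Halts-unique {v = v} {m′ = suc m′} (steps eq h) (steps eq′ h′)
      with Halts-unique h (subst (λ z → Halts _ _ z m′) (sym (go-injective v (trans (sym eq) eq′))) h′)
    ... | refl , refl , refl = refl , refl , refl

    runFor-Halts : ∀ t {v b τ} → runFor M t x (running v) ≡ halted b τ → ∃ λ m → suc m ≤ t × Halts b τ v m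
    runFor-Halts (suc t) {v@(config st ih w wh c ch)} {b} {τ} eq = out (δ′ st (readsOf v)) refl
      where
      out : ∀ α → δ′ st (readsOf v) ≡ α → ∃ λ m → suc m ≤ suc t × Halts b τ v m
      out (halt b′) δ≡ rewrite δ≡ with trans (sym (runFor-halted x M t b′ c)) eq
      ... | refl = 0 , s≤s z≤n , stops δ≡ refl
      out (go st′ ww cw mi mw mc) δ≡ rewrite δ≡ with runFor-Halts t eq
      ... | m , m≤ , h = suc m , s≤s m≤ , steps δ≡ h

    -- Records only the answer and the final content of the halting configuration, not the
    -- configuration itself: soundness and counting use no more of a component.
    Comp : Bool → List Bool → V → Set
    Comp b τ v = ∃ λ m → Halts b τ v m

    flip-zero-halts : ∀ {b τ v w j m} → flip (v , zero) ≡ (w , suc j) → Halts b τ w m → Halts b τ v (suc m)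
    flip-zero-halts {b} {τ} {v} {w} {j} {m} eq h = out (δ′ (Config.state v) (readsOf v)) refl eq
      where
      out : ∀ α → δ′ (Config.state v) (readsOf v) ≡ α → flipOut v α ≡ (w , suc j) → Halts b τ v (suc m)
      out (go st ww cw mi mw mc) δ≡ refl = steps δ≡ h

    flip-comp : ∀ {b τ} v d → Valid v → Comp b τ v → Comp b τ (proj₁ (flip (v , d)))
    flip-comp {b} {τ} v zero valid (m , h) = out (δ′ (Config.state v) (readsOf v)) refl h
      where
      out : ∀ {m} α → δ′ (Config.state v) (readsOf v) ≡ α → Halts b τ v m → Comp b τ (proj₁ (flipOut v α))
      out (halt b) δ≡ h = _ , h
      out (go st ww cw mi mw mc) δ≡ (stops eq _) with trans (sym eq) δ≡
      ... | ()
      out {suc m} (go st ww cw mi mw mc) δ≡ (steps eq h) = m , subst (λ z → Halts b τ z m) (go-injective v (trans (sym eq) δ≡)) h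
    flip-comp {b} {τ} v (suc j) valid (m , h) = inn (matchAt? v j (decI j)) refl
      where
      inn : ∀ d → matchAt? v j (decI j) ≡ d → Comp b τ (proj₁ (flipIn v j (decI j) d))
      inn (yes p) _ = suc m , flip-zero-halts (flip-in-out v j (decI j) valid p) h
      inn (no _)  _ = m , h

    allConfigs : ℕ → ℕ → List V
    allConfigs s c = map (λ (st , ih , w , wh , c , ch) → config st ih w wh c ch)
      (cartesianProduct (allFin Q) (cartesianProduct (upTo n₁) (cartesianProduct (allBits s)
        (cartesianProduct (upTo s) (cartesianProduct (allBits c) (upTo c))))))

    ∈-allConfigs : ∀ {s c v} → Good s c v → v ∈ allConfigs s c
    ∈-allConfigs {v = config st ih w wh c ch} (good (p₁ , p₂ , p₃) refl refl) =
      ∈-map⁺ _ (∈-cartesianProduct⁺ (∈-allFin st) (∈-cartesianProduct⁺ (∈-upTo⁺ p₁) (∈-cartesianProduct⁺ (∈-allBits w refl)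
        (∈-cartesianProduct⁺ (∈-upTo⁺ p₂) (∈-cartesianProduct⁺ (∈-allBits c refl) (∈-upTo⁺ p₃))))))

    run-path : ∀ {b τ s c v m} → Halts b τ v m → Good s c v →
      ∃ λ vs → length vs ≡ suc m × Unique vs × All (λ u → Good s c u × ∃ λ i → i ≤ m × Halts b τ u i) vs
    run-path {v = v} h@(stops _ _) g = v ∷ [] , refl , [] ∷ [] , (g , 0 , z≤n , h) ∷ []
    run-path {b} {τ} {s} {c} {v} {suc m} h@(steps {st = st} {ww} {cw} {mi} {mw} {mc} eq h′) g =
      extend (run-path h′ (after-good st ww cw mi mw mc g))
      where
      extend : (∃ λ vs → length vs ≡ suc m × Unique vs × All (λ u → Good s c u × ∃ λ i → i ≤ m × Halts b τ u i) vs) →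
        ∃ λ vs → length vs ≡ suc (suc m) × Unique vs × All (λ u → Good s c u × ∃ λ i → i ≤ suc m × Halts b τ u i) vs
      extend (vs , len , uniq , all) =
        v ∷ vs , cong suc len ,
        -- If v occurred again, it would have two remaining running times, suc m and some i ≤ m.
        All.map (λ { (_ , i , i≤ , hi) refl → 1+n≰n (subst (_≤ m) (sym (proj₂ (proj₂ (Halts-unique h hi)))) i≤) }) all ∷ uniq ,
        (g , suc m , ≤-refl , h) ∷ All.map (λ { (g , i , i≤ , hi) → g , i , m≤n⇒m≤1+n i≤ , hi }) all

    Halts-bound : ∀ {b τ s c v m} → Halts b τ v m → Good s c v → suc m ≤ length (allConfigs s c)
    Halts-bound {s = s} {c} h g with run-path h g
    ... | vs , len , uniq , all = subst (_≤ length (allConfigs s c)) len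
      (length-≤-by-injection (λ z → z) uniq (λ p → ∈-allConfigs (proj₁ (All.lookup all p))) (λ _ _ z → z))

    module _ {b : Bool} {τ : List Bool} {s c : ℕ} where

      private
        Reaches : V × Dart → V × Dart → Set
        Reaches a a′ = ∃ λ k → iter T k a ≡ a′

        step-then : ∀ {a a′ a″} → T a ≡ a′ → Reaches a′ a″ → Reaches a a″
        step-then refl (k , eq) = suc k , eq

        both : ∀ {a a′ a″} → Reaches a a′ → Reaches a′ a″ → Reaches a a″
        both (j , refl) (k , eq) = j + k , trans (iter-+ T j k _) eq

      -- At each turn, a missing edge leads back to its own dart. An existing predecessor is entered
      -- at its dart zero; `deeper` walks around its subtree up to the last dart, from which the
      -- next turn is dart zero again, the edge back to w.
      children : ∀ {w m} → Halts b τ w m → Good s c w →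
        (∀ {u} → Halts b τ u (suc m) → Good s c u → Reaches (u , zero) (u , fromℕ K)) →
        ∀ rest d → rest + toℕ d ≡ K → Reaches (w , d) (w , fromℕ K)
      children {w} h g deeper zero d eq = 0 , cong (w ,_) (toℕ-injective (trans eq (sym (toℕ-fromℕ K))))
      children {w} {m} h g deeper (suc rest) d eq = down (lower d (subst (toℕ d <_) eq (s≤s (m≤n+m (toℕ d) rest))))
        where
        down : (∃ λ i → d ≡ inject₁ i) → Reaches (w , d) (w , fromℕ K)
        down (i , refl) = child (matchAt? w i (decI i)) refl
          where
          onward : Reaches (w , suc i) (w , fromℕ K)
          onward = children h g deeper rest (suc i)
            (trans (+-suc rest (toℕ i)) (trans (cong (λ z → suc (rest + z)) (sym (toℕ-inject₁ i))) eq))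
          arrive : T (w , inject₁ i) ≡ flip (w , suc i)
          arrive = cong (λ z → flip (w , z)) (rot-inject₁ i)
          child : ∀ p → matchAt? w i (decI i) ≡ p → Reaches (w , inject₁ i) (w , fromℕ K)
          child (no _) p≡ = step-then (trans arrive (cong (flipIn w i (decI i)) p≡)) onward
          child (yes p) p≡ = step-then (trans arrive (cong (flipIn w i (decI i)) p≡))
            (both (deeper (flip-zero-halts back h) (rewind-good (decI i) g))
                  (step-then (trans (cong (λ z → flip (rewind (pull w (decI i)) (decI i) , z)) (rot-last K)) back) onward))
            where
            back : flip (rewind (pull w (decI i)) (decI i) , zero) ≡ (w , suc i)
            back = flip-in-out w i (decI i) (valid g) p

      -- fuel bounds the depth of the tree of predecessors, since a run does not repeat configurations
      subtree : ∀ fuel {w m} → Halts b τ w m → Good s c w → length (allConfigs s c) ≤ fuel + m →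
        ∀ rest d → rest + toℕ d ≡ K → Reaches (w , d) (w , fromℕ K)
      subtree zero h g full rest d eq = contradiction (≤-trans (Halts-bound h g) full) 1+n≰n
      subtree (suc fuel) {m = m} h g full = children h g λ h′ g′ →
        subtree fuel h′ g′ (≤-trans full (≤-reflexive (sym (+-suc fuel m)))) K zero (+-identityʳ K)

      -- Once the subtree of v is finished, the next turn is dart zero, so the tour climbs to the
      -- successor; induction on the remaining running time leads to the halting configuration. The
      -- walk stops at its last dart because the turn after it is the one that reveals the answer.
      to-root : ∀ {v m} d → Halts b τ v m → Good s c v →
        ∃ λ k → ∃ λ v′ → iter T k (v , d) ≡ (v′ , fromℕ K) × δ′ (Config.state v′) (readsOf v′) ≡ halt b
      to-root {v} d h@(stops eq _) g with subtree (length (allConfigs s c)) h g (m≤m+n _ _) (K ∸ toℕ d) d (m∸n+n≡m (s≤s⁻¹ (toℕ<n d)))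
      ... | k , it = k , v , it , eq
      to-root {v} {suc m} d h@(steps {st = st} {ww} {cw} {mi} {mw} {mc} eq h′) g
        with subtree (length (allConfigs s c)) h g (m≤m+n _ _) (K ∸ toℕ d) d (m∸n+n≡m (s≤s⁻¹ (toℕ<n d)))
           | to-root (suc (encI (Config.state v , readsOf v , effsAt v (mi , mw , mc)))) h′ (after-good st ww cw mi mw mc g)
      ... | k₁ , it₁ | k₂ , v′ , it₂ , halts =
        k₁ + suc k₂ , v′ ,
        trans (iter-+ T k₁ (suc k₂) (v , d)) (trans (cong (λ z → iter T k₂ (T z)) it₁)
          (trans (cong (iter T k₂) (trans (cong (λ z → flip (v , z)) (rot-last K)) (cong (flipOut v) eq))) it₂)) ,
        halts

    revealOut : Action Q → Maybe Bool
    revealOut (halt b)         = just b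
    revealOut (go _ _ _ _ _ _) = nothing

    reveal : V → Dart → Maybe Bool
    reveal v zero    = revealOut (δ′ (Config.state v) (readsOf v))
    reveal v (suc _) = nothing

    answer : ℕ → V × Dart → Maybe Bool → Maybe Bool
    answer zero    s       ans = ans
    answer (suc t) (v , d) ans = answer t (T (v , d)) (reveal v (rot d) <∣> ans)

    seen : V × Dart → Maybe Bool
    seen (v , d) = reveal v (rot d)

    answer-just : ∀ t s b → ∃ λ b′ → answer t s (just b) ≡ just b′
    answer-just zero    s b = b , refl
    answer-just (suc t) s b with seen s
    ... | nothing = answer-just t (T s) b
    ... | just b′ = answer-just t (T s) b′

    answer-nothing : ∀ t s → answer t s nothing ≡ nothing → ∀ j → j < t → seen (iter T j s) ≡ nothing
    answer-nothing (suc t) s eq j j< with seen s in seq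
    answer-nothing (suc t) s eq j j<            | just b with answer-just t (T s) b
    ... | b′ , eq′ with trans (sym eq) eq′
    ... | ()
    answer-nothing (suc t) s eq zero j<         | nothing = seq
    answer-nothing (suc t) s eq (suc j) (s≤s p) | nothing = answer-nothing t (T s) eq j p

    module _ {b : Bool} {τ : List Bool} {s c : ℕ} where

      In : V × Dart → Set
      In (v , d) = Good s c v × Comp b τ v

      T-in : ∀ a → In a → In (T a)
      T-in (v , d) (g , comp) = flip-good v (rot d) g , flip-comp v (rot d) (valid g) comp

      iter-in : ∀ k a → In a → In (iter T k a)
      iter-in zero    a i = i
      iter-in (suc k) a i = iter-in k (T a) (T-in a i)

      seen-sound : ∀ {b′} v d → Comp b τ v → reveal v d ≡ just b′ → b′ ≡ b
      seen-sound {b′} v zero (m , h) eq = out (δ′ (Config.state v) (readsOf v)) refl h eq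
        where
        out : ∀ {m} α → δ′ (Config.state v) (readsOf v) ≡ α → Halts b τ v m → revealOut α ≡ just b′ → b′ ≡ b
        out (halt b) δ≡ (stops eq _) refl with trans (sym eq) δ≡
        ... | refl = refl
        out (halt b) δ≡ (steps eq _) refl with trans (sym eq) δ≡
        ... | ()

      answer-sound : ∀ t a {b′} → In a → answer t a nothing ≡ just b′ → b′ ≡ b
      answer-sound t a i eq = sound t a nothing i (λ ()) eq
        where
        sound : ∀ t a ans {b′} → In a → (∀ {b″} → ans ≡ just b″ → b″ ≡ b) → answer t a ans ≡ just b′ → b′ ≡ b
        sound zero    a ans i ok eq = ok eq
        sound (suc t) (v , d) ans i ok eq = sound t (T (v , d)) _ (T-in (v , d) i) ok′ eq
          where
          ok′ : ∀ {b″} → (reveal v (rot d) <∣> ans) ≡ just b″ → b″ ≡ b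
          ok′ eq with reveal v (rot d) in req
          ... | just _  = seen-sound v (rot d) (proj₂ i) (trans req eq)
          ... | nothing = ok eq

      undo : ∀ k a → In a → iter T⁻¹ k (iter T k a) ≡ a
      undo zero    a i = refl
      undo (suc k) a i = trans (cong (iter T⁻¹ (suc k)) (iter-suc T k a))
        (trans (cong (iter T⁻¹ k) (T⁻¹-T _ _ (valid (proj₁ (iter-in k a i))))) (undo k a i))

      -- Otherwise the tour would be periodic without ever passing the halting configuration.
      distinct : ∀ t a → In a → answer t a nothing ≡ nothing → ∀ {i j} → i < j → j < t →
        iter T i a ≡ iter T j a → ⊥
      distinct t a inn none {i} {j} i<j j<t eq with to-root (proj₂ a) (proj₂ (proj₂ inn)) (proj₁ inn)
      ... | h , v′ , hit , halts = descend h (<-wellFounded h) hit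
        where
        descend : ∀ h → Acc _<_ h → iter T h a ≡ (v′ , fromℕ K) → ⊥
        descend h (acc rs) hit with h <? t
        ... | yes h<t = contradiction (trans (sym seen≡) (answer-nothing t a none h h<t)) λ ()
          where
          seen≡ : seen (iter T h a) ≡ just b
          seen≡ = trans (cong seen hit) (trans (cong (reveal v′) (rot-last K)) (cong revealOut halts))
        ... | no h≮t = descend (i + (h ∸ j)) (rs shorter) hit′
          where
          j≤h : j ≤ h
          j≤h = ≤-trans (<⇒≤ j<t) (≮⇒≥ h≮t)
          shorter : i + (h ∸ j) < h
          shorter = ≤-trans (+-monoˡ-≤ (h ∸ j) i<j) (≤-reflexive (m+[n∸m]≡n j≤h))
          hit′ : iter T (i + (h ∸ j)) a ≡ (v′ , fromℕ K)
          hit′ = trans (iter-+ T i (h ∸ j) a) (trans (cong (iter T (h ∸ j)) eq)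
            (trans (sym (iter-+ T j (h ∸ j) a)) (trans (cong (λ z → iter T z a) (m+[n∸m]≡n j≤h)) hit)))

-- Counting bad catalytic contents

length-cartesianProduct : ∀ {A B : Set} (xs : List A) (ys : List B) → length (cartesianProduct xs ys) ≡ length xs * length ys
length-cartesianProduct []       ys = refl
length-cartesianProduct (x ∷ xs) ys = trans (length-++ (map (x ,_) ys)) (cong₂ _+_ (length-map (x ,_) ys) (length-cartesianProduct xs ys))

length-allBits : ∀ c → length (allBits c) ≡ 2 ^ c
length-allBits zero    = refl
length-allBits (suc c) = trans (length-++ (map (false ∷_) (allBits c)))
  (cong₂ _+_ (trans (length-map _ (allBits c)) (length-allBits c))
             (trans (length-map _ (allBits c)) (trans (length-allBits c) (sym (+-identityʳ _)))))

∈-allBits⁻ : ∀ {c l} → l ∈ allBits c → length l ≡ c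
∈-allBits⁻ {zero} (here refl) = refl
∈-allBits⁻ {suc c} p with ∈-++⁻ (map (false ∷_) (allBits c)) p
... | inj₁ q with ∈-map⁻ (false ∷_) q
...   | l , r , refl = cong suc (∈-allBits⁻ r)
∈-allBits⁻ {suc c} p | inj₂ q with ∈-map⁻ (true ∷_) q
...   | l , r , refl = cong suc (∈-allBits⁻ r)

unique-allBits : ∀ c → Unique (allBits c)
unique-allBits zero    = [] ∷ []
unique-allBits (suc c) = Uniq.++⁺ (Uniq.map⁺ ∷-injectiveʳ (unique-allBits c)) (Uniq.map⁺ ∷-injectiveʳ (unique-allBits c)) disjoint
  where
  disjoint : ∀ {v} → v ∈ map (false ∷_) (allBits c) × v ∈ map (true ∷_) (allBits c) → ⊥
  disjoint (p , q) with ∈-map⁻ (false ∷_) p | ∈-map⁻ (true ∷_) q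
  ... | _ , _ , refl | _ , _ , ()

markov : ∀ {A : Set} {P : A → Set} (P? : Decidable P) (f : A → ℕ) d → (∀ a → P a → d < f a) → ∀ xs →
  suc d * length (filter P? xs) ≤ sum (map f xs)
markov P? f d big [] = ≤-reflexive (*-zeroʳ (suc d))
markov P? f d big (x ∷ xs) with P? x
... | yes p = ≤-trans (≤-reflexive (*-suc (suc d) _)) (+-mono-≤ (big x p) (markov P? f d big xs))
... | no _  = ≤-trans (markov P? f d big xs) (m≤n+m _ (f x))

sum≤filter : ∀ {A : Set} {P : A → Set} (P? : Decidable P) (f : A → ℕ) B xs →
  (∀ {a} → a ∈ xs → f a ≤ B) → (∀ {a} → a ∈ xs → ¬ P a → f a ≡ 0) → sum (map f xs) ≤ B * length (filter P? xs)
sum≤filter P? f B [] _ _ = z≤n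
sum≤filter P? f B (x ∷ xs) bnd zer with P? x
... | yes _ = ≤-trans (+-mono-≤ (bnd (here refl)) (sum≤filter P? f B xs (λ p → bnd (there p)) (λ p → zer (there p)))) (≤-reflexive (sym (*-suc B _)))
... | no ¬p = subst (λ z → z + sum (map f xs) ≤ B * length (filter P? xs)) (sym (zer (here refl) ¬p))
                (sum≤filter P? f B xs (λ p → bnd (there p)) (λ p → zer (there p)))

filter-split : ∀ {A : Set} {P R : A → Set} (P? : Decidable P) (R? : Decidable R) {S : A → Set} (S? : Decidable S) xs →
  (∀ a → P a → R a ⊎ S a) → length (filter P? xs) ≤ length (filter R? xs) + length (filter S? xs)
filter-split P? R? S? [] h = z≤n
filter-split P? R? S? (x ∷ xs) h with P? x | R? x | S? x | filter-split P? R? S? xs h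
... | no _  | no _  | no _  | ih = ih
... | no _  | yes _ | no _  | ih = m≤n⇒m≤1+n ih
... | no _  | no _  | yes _ | ih = ≤-trans ih (+-monoʳ-≤ _ (n≤1+n _))
... | no _  | yes _ | yes _ | ih = m≤n⇒m≤1+n (≤-trans ih (+-monoʳ-≤ _ (n≤1+n _)))
... | yes _ | yes _ | no _  | ih = s≤s ih
... | yes _ | no _  | yes _ | ih = ≤-trans (s≤s ih) (≤-reflexive (sym (+-suc _ _)))
... | yes _ | yes _ | yes _ | ih = s≤s (≤-trans ih (+-monoʳ-≤ _ (n≤1+n _)))
... | yes p | no ¬r | no ¬s | ih with h x p
...   | inj₁ r = contradiction r ¬r
...   | inj₂ s = contradiction s ¬s

-- Given `bs`, the positions of disagreement recover `as`; they serve as the code of a point in a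
-- Hamming ball around `bs`.
diffs : ℕ → List Bool → List Bool → List ℕ
diffs i (a ∷ as) (b ∷ bs) = if a xor b then i ∷ diffs (suc i) as bs else diffs (suc i) as bs
diffs i _        _        = []

length-diffs : ∀ i as bs → length (diffs i as bs) ≡ hamming as bs
length-diffs i []       bs       = refl
length-diffs i (a ∷ as) []       = refl
length-diffs i (a ∷ as) (b ∷ bs) with a xor b
... | true  = cong suc (length-diffs (suc i) as bs)
... | false = length-diffs (suc i) as bs

diffs-≥ : ∀ i as bs → All (i ≤_) (diffs i as bs)
diffs-≥ i []       bs       = []
diffs-≥ i (a ∷ as) []       = []
diffs-≥ i (a ∷ as) (b ∷ bs) with a xor b
... | true  = ≤-refl ∷ All.map <⇒≤ (diffs-≥ (suc i) as bs)
... | false = All.map <⇒≤ (diffs-≥ (suc i) as bs)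

diffs-< : ∀ i as bs → All (_< i + length as) (diffs i as bs)
diffs-< i []       bs       = []
diffs-< i (a ∷ as) []       = []
diffs-< i (a ∷ as) (b ∷ bs) with a xor b
... | true  = subst (i <_) (sym (+-suc i (length as))) (s≤s (m≤m+n i (length as))) ∷
              All.map (λ {z} → subst (z <_) (sym (+-suc i (length as)))) (diffs-< (suc i) as bs)
... | false = All.map (λ {z} → subst (z <_) (sym (+-suc i (length as)))) (diffs-< (suc i) as bs)

xor-cancelʳ : ∀ a a′ b → a xor b ≡ a′ xor b → a ≡ a′
xor-cancelʳ false false b     _ = refl
xor-cancelʳ true  true  b     _ = refl
xor-cancelʳ false true  false ()
xor-cancelʳ false true  true  ()
xor-cancelʳ true  false false ()
xor-cancelʳ true  false true  ()

diffs-injective : ∀ i as as′ bs → length as ≡ length bs → length as′ ≡ length bs → diffs i as bs ≡ diffs i as′ bs → as ≡ as′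
diffs-injective i [] [] [] _ _ _ = refl
diffs-injective i (a ∷ as) (a′ ∷ as′) (b ∷ bs) l l′ eq with a xor b in p | a′ xor b in p′
... | true  | true  = cong₂ _∷_ (xor-cancelʳ a a′ b (trans p (sym p′))) (diffs-injective (suc i) as as′ bs (cong pred l) (cong pred l′) (∷-injectiveʳ eq))
... | false | false = cong₂ _∷_ (xor-cancelʳ a a′ b (trans p (sym p′))) (diffs-injective (suc i) as as′ bs (cong pred l) (cong pred l′) eq)
... | true  | false = ⊥-elim (1+n≰n (All.head (subst (All (suc i ≤_)) (sym eq) (diffs-≥ (suc i) as′ bs))))
... | false | true  = ⊥-elim (1+n≰n (All.head (subst (All (suc i ≤_)) eq (diffs-≥ (suc i) as bs))))

shortLists : ℕ → ℕ → List (List ℕ)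
shortLists c zero    = [] ∷ []
shortLists c (suc d) = [] ∷ map (uncurry _∷_) (cartesianProduct (upTo c) (shortLists c d))

∈-shortLists : ∀ {c d l} → All (_< c) l → length l ≤ d → l ∈ shortLists c d
∈-shortLists {d = zero}  []       _       = here refl
∈-shortLists {d = suc d} []       _       = here refl
∈-shortLists {d = suc d} (p ∷ ps) (s≤s q) = there (∈-map⁺ (uncurry _∷_) (∈-cartesianProduct⁺ (∈-upTo⁺ p) (∈-shortLists ps q)))

length-shortLists : ∀ c d → length (shortLists c d) ≤ suc c ^ d
length-shortLists c zero    = ≤-refl
length-shortLists c (suc d) = begin
  suc (length (map (uncurry _∷_) (cartesianProduct (upTo c) (shortLists c d))))
    ≡⟨ cong suc (trans (length-map _ (cartesianProduct (upTo c) (shortLists c d)))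
         (trans (length-cartesianProduct (upTo c) (shortLists c d)) (cong (_* length (shortLists c d)) (length-upTo c)))) ⟩
  suc (c * length (shortLists c d))
    ≤⟨ +-mono-≤ (m^n>0 (suc c) d) (*-monoʳ-≤ c (length-shortLists c d)) ⟩
  suc c ^ d + c * suc c ^ d ∎
  where open ≤-Reasoning

hamming≤ : ∀ as bs → hamming as bs ≤ length as
hamming≤ []       bs       = z≤n
hamming≤ (a ∷ as) []       = z≤n
hamming≤ (a ∷ as) (b ∷ bs) with a xor b
... | true  = s≤s (hamming≤ as bs)
... | false = m≤n⇒m≤1+n (hamming≤ as bs)

hamming-self : ∀ as → hamming as as ≡ 0
hamming-self []           = refl
hamming-self (false ∷ as) = hamming-self as
hamming-self (true ∷ as)  = hamming-self as

nothing? : (m : Maybe Bool) → Dec (m ≡ nothing)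
nothing? nothing  = yes refl
nothing? (just _) = no λ ()

module Counting (M : Machine) (x : List Bool) where
  open Machine M using (Q; start)
  open Tour M

  tourAnswer : ℕ → ℕ → List Bool → Maybe Bool
  tourAnswer s t τ = answer x t (start-config s τ , zero) nothing

  Bad : ℕ → ℕ → List Bool → Set
  Bad s t τ = tourAnswer s t τ ≡ nothing

  bad? : ∀ s t → Decidable (Bad s t)
  bad? s t τ = nothing? (tourAnswer s t τ)

  -- number of tour states that share a catalytic content, times the number of
  -- contents at distance at most d
  congestion : ℕ → ℕ → ℕ → ℕ
  congestion s c d = Q * (suc (length x) * (2 ^ s * (s * c))) * (suc K * suc c ^ d)

  module _ (b : Bool) (s c : ℕ) (0<s : 0 < s) (0<c : 0 < c) (F : List Bool → List Bool)
           (halts : ∀ τ → length τ ≡ c → Comp x b (F τ) (start-config s τ)) where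

    start-in : ∀ τ → length τ ≡ c → In x {b} {F τ} {s} {c} (start-config s τ , zero)
    start-in τ eq = start-good x 0<s 0<c eq , halts τ eq

    Halts-length : ∀ {b τ v m} → Halts x b τ v m → Good x s c v → length τ ≡ c
    Halts-length (stops _ refl) g = length-cat g
    Halts-length (steps {st = st} {ww} {cw} {mi} {mw} {mc} _ h) g = Halts-length h (after-good x st ww cw mi mw mc g)

    length-F : ∀ τ → length τ ≡ c → length (F τ) ≡ c
    length-F τ eq = Halts-length (proj₂ (halts τ eq)) (start-good x 0<s 0<c eq)

    -- Double counting of the pairs of a bad τ and a time j < t. The tour state at time j determines
    -- the final content F τ, the differences from it then determine τ, and j is determined because
    -- a tour without answer repeats no state. Tour states number 2^c times a factor that is
    -- polynomial for logarithmic s.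
    close-bad : ∀ d t → let bads = filter (λ τ → bad? s t τ ×-dec (hamming τ (F τ) ≤? d)) (allBits c) in
      length bads * t ≤ congestion s c d * 2 ^ c
    close-bad d t = begin
      length bads * t
        ≡⟨ sym (trans (length-cartesianProduct bads (upTo t)) (cong (length bads *_) (length-upTo t))) ⟩
      length (cartesianProduct bads (upTo t))
        ≤⟨ length-≤-by-injection code (Uniq.cartesianProduct⁺ (Uniq.filter⁺ bc? (unique-allBits c)) (Uniq.upTo⁺ t)) into inj ⟩
      length (cartesianProduct (cartesianProduct (allConfigs x s c) (allFin (suc K))) (shortLists c d))
        ≡⟨ trans (length-cartesianProduct (cartesianProduct (allConfigs x s c) (allFin (suc K))) (shortLists c d))
             (cong (_* length (shortLists c d)) (trans (length-cartesianProduct (allConfigs x s c) (allFin (suc K)))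
               (cong₂ _*_ configs (length-tabulate (λ (i : Fin (suc K)) → i))))) ⟩
      Q * (suc (length x) * (2 ^ s * (s * (2 ^ c * c)))) * suc K * length (shortLists c d)
        ≤⟨ *-monoʳ-≤ (Q * (suc (length x) * (2 ^ s * (s * (2 ^ c * c)))) * suc K) (length-shortLists c d) ⟩
      Q * (suc (length x) * (2 ^ s * (s * (2 ^ c * c)))) * suc K * suc c ^ d
        ≡⟨ arith Q (suc (length x)) (2 ^ s) s (2 ^ c) c (suc K) (suc c ^ d) ⟩
      congestion s c d * 2 ^ c ∎
      where
      open ≤-Reasoning
      bc? : Decidable (λ τ → Bad s t τ × hamming τ (F τ) ≤ d)
      bc? τ = bad? s t τ ×-dec (hamming τ (F τ) ≤? d)
      bads : List (List Bool)
      bads = filter bc? (allBits c)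
      code : List Bool × ℕ → (Config Q × Dart) × List ℕ
      code (τ , j) = iter (T x) j (start-config s τ , zero) , diffs 0 τ (F τ)
      facts : ∀ {τ j} → (τ , j) ∈ cartesianProduct bads (upTo t) → length τ ≡ c × Bad s t τ × hamming τ (F τ) ≤ d × j < t
      facts p with ∈-cartesianProduct⁻ bads (upTo t) p
      ... | p₁ , p₂ with ∈-filter⁻ bc? {xs = allBits c} p₁
      ... | q , bad , close = ∈-allBits⁻ q , bad , close , ∈-upTo⁻ p₂
      into : ∀ {a} → a ∈ cartesianProduct bads (upTo t) →
        code a ∈ cartesianProduct (cartesianProduct (allConfigs x s c) (allFin (suc K))) (shortLists c d)
      into {τ , j} p with facts p
      ... | len , bad , close , j<t =
        ∈-cartesianProduct⁺ (∈-cartesianProduct⁺ (∈-allConfigs x (proj₁ (iter-in x j _ (start-in τ len)))) (∈-allFin _))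
          (∈-shortLists (subst (λ z → All (_< z) (diffs 0 τ (F τ))) len (diffs-< 0 τ (F τ)))
            (subst (_≤ d) (sym (length-diffs 0 τ (F τ))) close))
      inj : ∀ {a a′} → a ∈ cartesianProduct bads (upTo t) → a′ ∈ cartesianProduct bads (upTo t) → code a ≡ code a′ → a ≡ a′
      inj {τ , j} {τ′ , j′} p p′ eq with facts p | facts p′ | ,-injective eq
      ... | len , bad , _ , j<t | len′ , _ , _ , j′<t | eq₁ , eq₂ = both same-τ
        where
        same-F : F τ ≡ F τ′
        same-F = proj₁ (proj₂ (Halts-unique x (proj₂ (proj₂ (iter-in x j _ (start-in τ len))))
          (proj₂ (subst (λ z → Comp x b (F τ′) (proj₁ z)) (sym eq₁) (proj₂ (iter-in x j′ _ (start-in τ′ len′)))))))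
        same-τ : τ ≡ τ′
        same-τ = diffs-injective 0 τ τ′ (F τ) (trans len (sym (length-F τ len))) (trans len′ (sym (length-F τ len)))
          (trans eq₂ (cong (diffs 0 τ′) (sym same-F)))
        both : τ ≡ τ′ → (τ , j) ≡ (τ′ , j′)
        both refl with <-cmp j j′
        ... | tri< j<j′ _ _ = ⊥-elim (distinct x t _ (start-in τ len) bad j<j′ j′<t eq₁)
        ... | tri≈ _ refl _ = refl
        ... | tri> _ _ j>j′ = ⊥-elim (distinct x t _ (start-in τ len) bad j>j′ j<t (sym eq₁))
      configs : length (allConfigs x s c) ≡ Q * (suc (length x) * (2 ^ s * (s * (2 ^ c * c))))
      configs = trans (length-map _ (cartesianProduct (allFin Q) _)) (proof
        (times (has (allFin Q) {Q} (length-tabulate (λ i → i))) (times (has (upTo (suc (length x))) (length-upTo (suc (length x))))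
          (times (has (allBits s) (length-allBits s)) (times (has (upTo s) (length-upTo s))
            (times (has (allBits c) (length-allBits c)) (has (upTo c) (length-upTo c))))))))
        where
        data HasLength {A : Set} : List A → ℕ → Set where
          has : ∀ xs {k} → length xs ≡ k → HasLength xs k
        proof : ∀ {A : Set} {xs : List A} {k} → HasLength xs k → length xs ≡ k
        proof (has _ p) = p
        times : ∀ {A B : Set} {xs : List A} {ys : List B} {k l} → HasLength xs k → HasLength ys l → HasLength (cartesianProduct xs ys) (k * l)
        times (has xs refl) (has ys refl) = has _ (length-cartesianProduct xs ys)
      arith : ∀ q n u s v c k e → q * (n * (u * (s * (v * c)))) * k * e ≡ q * (n * (u * (s * c))) * (k * e) * v
      arith = solve-∀

    -- Markov's inequality leaves at most a quarter for contents that lose more than 4C+3 bits.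
    bad-half : ∀ C t → sum (map (λ τ → hamming τ (F τ)) (allBits c)) ≤ C * 2 ^ c →
      4 * suc (congestion s c (4 * C + 3)) ≤ t → 2 * length (filter (bad? s t) (allBits c)) ≤ 2 ^ c
    bad-half C t avg t≥ = *-cancelˡ-≤ 2 (begin
      2 * (2 * length (filter (bad? s t) (allBits c)))
        ≡⟨ sym (*-assoc 2 2 (length (filter (bad? s t) (allBits c)))) ⟩
      4 * length (filter (bad? s t) (allBits c))
        ≤⟨ *-monoʳ-≤ 4 (filter-split (bad? s t) far? bc? (allBits c) split) ⟩
      4 * (far + close)
        ≡⟨ *-distribˡ-+ 4 far close ⟩
      4 * far + 4 * close
        ≤⟨ +-mono-≤ few-far few-close ⟩
      2 ^ c + 2 ^ c
        ≡⟨ cong (2 ^ c +_) (sym (+-identityʳ (2 ^ c))) ⟩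
      2 * 2 ^ c ∎)
      where
      open ≤-Reasoning
      d : ℕ
      d = 4 * C + 3
      far? : Decidable (λ τ → d < hamming τ (F τ))
      far? τ = d <? hamming τ (F τ)
      bc? : Decidable (λ τ → Bad s t τ × hamming τ (F τ) ≤ d)
      bc? τ = bad? s t τ ×-dec (hamming τ (F τ) ≤? d)
      far close : ℕ
      far   = length (filter far? (allBits c))
      close = length (filter bc? (allBits c))
      split : ∀ τ → Bad s t τ → d < hamming τ (F τ) ⊎ (Bad s t τ × hamming τ (F τ) ≤ d)
      split τ bad with d <? hamming τ (F τ)
      ... | yes p = inj₁ p
      ... | no ¬p = inj₂ (bad , ≮⇒≥ ¬p)
      suc-d : ∀ C f → suc (4 * C + 3) * f ≡ suc C * (4 * f)
      suc-d = solve-∀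
      few-far : 4 * far ≤ 2 ^ c
      few-far = *-cancelˡ-≤ (suc C) (begin
        suc C * (4 * far) ≡⟨ sym (suc-d C far) ⟩
        suc d * far       ≤⟨ markov far? (λ τ → hamming τ (F τ)) d (λ _ p → p) (allBits c) ⟩
        sum (map (λ τ → hamming τ (F τ)) (allBits c)) ≤⟨ avg ⟩
        C * 2 ^ c         ≤⟨ *-monoˡ-≤ (2 ^ c) (n≤1+n C) ⟩
        suc C * 2 ^ c ∎)
      p : ℕ
      p = suc (congestion s c d)
      few-close : 4 * close ≤ 2 ^ c
      few-close = *-cancelˡ-≤ p (begin
        p * (4 * close) ≡⟨ trans (sym (*-assoc p 4 close)) (trans (cong (_* close) (*-comm p 4)) (*-comm (4 * p) close)) ⟩
        close * (4 * p) ≤⟨ *-monoʳ-≤ close t≥ ⟩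
        close * t       ≤⟨ close-bad d t ⟩
        congestion s c d * 2 ^ c ≤⟨ *-monoˡ-≤ (2 ^ c) (n≤1+n (congestion s c d)) ⟩
        p * 2 ^ c ∎)

-- Independence of the blocks

module Blockwise {P : List Bool → Set} (P? : Decidable P) (c : ℕ) where

  AllBlocks : ℕ → List Bool → Set
  AllBlocks zero    l = ⊤
  AllBlocks (suc m) l = P (take c l) × AllBlocks m (drop c l)

  allBlocks? : ∀ m → Decidable (AllBlocks m)
  allBlocks? zero    l = yes tt
  allBlocks? (suc m) l = P? (take c l) ×-dec allBlocks? m (drop c l)

  -- Splitting off the first block maps the contents with all blocks bad into a product, and each
  -- factor contributes one half. The r cells behind the blocks are arbitrary.
  count-AllBlocks : 2 * length (filter P? (allBits c)) ≤ 2 ^ c → ∀ m r →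
    2 ^ m * length (filter (allBlocks? m) (allBits (m * c + r))) ≤ 2 ^ (m * c + r)
  count-AllBlocks half zero r = ≤-trans (≤-reflexive (+-identityʳ _))
    (≤-trans (length-filter (allBlocks? zero) (allBits r)) (≤-reflexive (length-allBits r)))
  count-AllBlocks half (suc m) r = begin
    2 ^ suc m * length (filter (allBlocks? (suc m)) (allBits (c + m * c + r)))
      ≤⟨ *-monoʳ-≤ (2 ^ suc m) (length-≤-by-injection (λ l → take c l , drop c l)
           (Uniq.filter⁺ (allBlocks? (suc m)) (unique-allBits (c + m * c + r))) into inj) ⟩
    2 ^ suc m * length (cartesianProduct one rest)
      ≡⟨ cong (2 ^ suc m *_) (length-cartesianProduct one rest) ⟩
    2 * 2 ^ m * (length one * length rest)
      ≡⟨ arith (2 ^ m) (length one) (length rest) ⟩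
    2 * length one * (2 ^ m * length rest)
      ≤⟨ *-mono-≤ half (count-AllBlocks half m r) ⟩
    2 ^ c * 2 ^ (m * c + r)
      ≡⟨ trans (sym (^-distribˡ-+-* 2 c (m * c + r))) (cong (2 ^_) (sym (+-assoc c (m * c) r))) ⟩
    2 ^ (c + m * c + r) ∎
    where
    open ≤-Reasoning
    one rest : List (List Bool)
    one  = filter P? (allBits c)
    rest = filter (allBlocks? m) (allBits (m * c + r))
    arith : ∀ u a b → 2 * u * (a * b) ≡ 2 * a * (u * b)
    arith = solve-∀
    into : ∀ {l} → l ∈ filter (allBlocks? (suc m)) (allBits (c + m * c + r)) → (take c l , drop c l) ∈ cartesianProduct one rest
    into {l} p with ∈-filter⁻ (allBlocks? (suc m)) {xs = allBits (c + m * c + r)} p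
    ... | q , p₁ , p₂ = ∈-cartesianProduct⁺
      (∈-filter⁺ P? (∈-allBits (take c l) (trans (length-take c l) (m≤n⇒m⊓n≡m (subst (c ≤_) (sym len) (m≤m+n c (m * c + r)))))) p₁)
      (∈-filter⁺ (allBlocks? m) (∈-allBits (drop c l) (trans (length-drop c l) (trans (cong (_∸ c) len) (m+n∸m≡n c (m * c + r))))) p₂)
      where
      len : length l ≡ c + (m * c + r)
      len = trans (∈-allBits⁻ q) (+-assoc c (m * c) r)
    inj : ∀ {l l′} → l ∈ filter (allBlocks? (suc m)) (allBits (c + m * c + r)) →
      l′ ∈ filter (allBlocks? (suc m)) (allBits (c + m * c + r)) → (take c l , drop c l) ≡ (take c l′ , drop c l′) → l ≡ l′
    inj {l} {l′} _ _ eq with ,-injective eq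
    ... | p , q = trans (sym (take++drop≡id c l)) (trans (cong₂ _++_ p q) (take++drop≡id c l′))

-- Programs for the tour

read-window : ∀ pre c post i → i < length c → read (pre ++ c ++ post) (length pre + i) ≡ read c i
read-window []        (b ∷ c) post zero    _       = refl
read-window []        (b ∷ c) post (suc i) (s≤s p) = read-window [] c post i p
read-window (_ ∷ pre) c       post i       p       = read-window pre c post i p

write-window : ∀ pre c post i v → i < length c →
  write (pre ++ c ++ post) (length pre + i) v ≡ pre ++ write c i v ++ post
write-window []        (b ∷ c) post zero    v _       = refl
write-window []        (b ∷ c) post (suc i) v (s≤s p) = cong (b ∷_) (write-window [] c post i v p)
write-window (a ∷ pre) c       post i       v p       = cong (a ∷_) (write-window pre c post i v p)

module Simulation (ops : CMOps nregs) (M : Machine) where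
  open CMOps ops
  open Macros ops
  open Machine M
  open Tour M

  private
    Move³ : Set
    Move³ = Move × Move × Move

  readAll : Prog Reads
  readAll = bind rdI λ i → bind rdW λ a → bind rdC λ b → ret (i , a , b)

  writeAll : Bool → Bool → Prog ⊤
  writeAll a b = wrW a ▸ wrC b

  tryAll : Move³ → Prog Move³
  tryAll (mi , mw , mc) = bind (tryI mi) λ eI → bind (tryW mw) λ eW → bind (tryC mc) λ eC → ret (eI , eW , eC)

  -- Finds out which of the moves would be blocked by making them and taking them back, as needed
  -- for the last condition of `Match`.
  probe : Move³ → Prog Move³
  probe m = bind (tryAll m) λ e → tryAll (opp³ e) ▸ ret e

  outP : Fin Q → Reads → Action Q → Prog (Fin Q × Dart × Maybe Bool)
  outP st r (halt b) = ret (st , zero , just b)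
  outP st r (go st′ ww cw mi mw mc) =
    writeAll ww cw ▸ bind (tryAll (mi , mw , mc)) λ e → ret (st′ , suc (encI (st , r , e)) , nothing)

  finish : ∀ {P : Set} → Fin Q → Fin K → Idx → Move³ → Dec P → Prog (Fin Q × Dart × Maybe Bool)
  finish st j (q , (_ , a , b) , _) e (yes _) = writeAll a b ▸ ret (q , zero , nothing)
  -- Nothing was written yet. The heads return by the opposites of the displacements performed,
  -- which may differ from those in `idx`.
  finish st j idx                   e (no _)  = tryAll (opp³ e) ▸ ret (st , suc j , nothing)

  inP : Fin Q → Fin K → Idx → Prog (Fin Q × Dart × Maybe Bool)
  inP st j idx@(q , s , d) =
    bind (tryAll (opp³ d)) λ e → bind readAll λ r → bind (probe (movesOf (δ′ q s))) λ f →
      finish st j idx e (match? st j idx e r f)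

  flipP : Fin Q → Dart → Prog (Fin Q × Dart × Maybe Bool)
  flipP st zero    = bind readAll λ r → outP st r (δ′ st r)
  flipP st (suc j) = inP st j (decI j)

  Ctl : Set
  Ctl = Fin Q × Dart × Maybe Bool

  forward backward : Ctl → Prog Ctl
  forward  (st , d , ans) = bind (flipP st (rot d)) λ (st′ , d′ , r) → ret (st′ , d′ , (r <∣> ans))
  backward (st , d , ans) = bind (flipP st d) λ (st′ , d′ , _) → ret (st′ , unrot d′ , ans)

  -- The answer is carried in the finite control on the way back. Both loops have the same length
  -- because `rep` restores `aLo`.
  tourP : ℕ → Prog (Maybe Bool)
  tourP e = bind (rep aLo aHi e forward (start , zero , nothing)) λ y →
            bind (rep aLo aHi e backward y) λ y′ → ret (proj₂ (proj₂ y′))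

  -- Crossing dart zero is one step of M, so the routines of the tour also give an ordinary
  -- simulator, the one used for the inclusion in P.
  direct : Fin Q × Maybe Bool → Prog (Fin Q × Maybe Bool)
  direct (st , just b)  = ret (st , just b)
  direct (st , nothing) = bind (flipP st zero) λ (st′ , _ , r) → ret (st′ , r)

  directP : ℕ → Prog (Maybe Bool)
  directP e = bind (rep aLo aHi e direct (start , nothing)) λ y → ret (proj₂ y)

  module SimSpecs (x : List Bool) (Vb : ℕ) (spec : CMSpec ops x Vb) where
    open CMSpec spec
    open Specs x Vb spec

    sim : Frame → Config Q → CM nregs
    sim fr (config _ ih w wh c ch) = simState fr ih w wh c ch

    push : Config Q → Move³ → Config Q
    push (config st ih w wh c ch) (mi , mw , mc) =
      config st (move (suc n) mi ih) w (move (length w) mw wh) c (move (length c) mc ch)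

    put : Config Q → Bool → Bool → Config Q
    put (config st ih w wh c ch) a b = config st ih (write w wh a) wh (write c ch b) ch

    Small : Config Q → Set
    Small v = suc n < Vb × length (Config.work v) < Vb × length (Config.cat v) < Vb

    push-valid : ∀ v m → Valid x v → Valid x (push v m)
    push-valid (config _ ih w wh c ch) (mi , mw , mc) (p₁ , p₂ , p₃) = move-< mi ih p₁ , move-< mw wh p₂ , move-< mc ch p₃

    push-undo : ∀ v m → Valid x v → push (push v m) (opp³ (effsAt x v m)) ≡ v
    push-undo (config st ih w wh c ch) (mi , mw , mc) (p₁ , p₂ , p₃)
      rewrite proj₂ (move-undo mi ih p₁) | proj₂ (move-undo mw wh p₂) | proj₂ (move-undo mc ch p₃) = refl

    module _ {fr : Frame} where
      open Frame fr

      readAll-does : ∀ v → Valid x v → D readAll (sim fr v) (readsOf x v) (sim fr v)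
      readAll-does (config _ ih w wh c ch) (p₁ , p₂ , p₃) =
        rdI-does ▷ rdW-does p₂ ▷
          exit (read-window pre c post ch p₃) (rdC-does (window< {pre} {post} c refl p₃)) ▷ Does-ret

      writeAll-does : ∀ v a b → Valid x v → D (writeAll a b) (sim fr v) tt (sim fr (put v a b))
      writeAll-does (config _ ih w wh c ch) a b (p₁ , p₂ , p₃) =
        wrW-does a p₂ ▷ to regs (wrC-does b (window< {pre} {post} c refl p₃))
        where
        regs : cm (ih ∷ wh ∷ length w ∸ suc wh ∷ ch ∷ length c ∸ suc ch ∷ 0 ∷ 0 ∷ suc n ∷ 0 ∷ a₀ ∷ a₁ ∷ b₀ ∷ b₁ ∷ [])
                  ih (write w wh a) wh (write (pre ++ c ++ post) (length pre + ch) b) (length pre + ch)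
               ≡ simState fr ih (write w wh a) wh (write c ch b) ch
        regs rewrite length-write w wh a | length-write c ch b | write-window pre c post ch b p₃ = refl

      tryAll-does : ∀ v m → Valid x v → Small v → D (tryAll m) (sim fr v) (effsAt x v m) (sim fr (push v m))
      tryAll-does (config _ ih w wh c ch) (mi , mw , mc) (p₁ , p₂ , p₃) (q₁ , q₂ , q₃) =
        tryI-does {fr} mi (s≤s⁻¹ p₁) q₁ ▷ tryW-does {fr} mw p₂ q₂ ▷ tryC-does {fr} mc p₃ q₃ ▷ Does-ret

      probe-does : ∀ v m → Valid x v → Small v → D (probe m) (sim fr v) (effsAt x v m) (sim fr v)
      probe-does v m p q = tryAll-does v m p q ▷
        to (cong (sim fr) (push-undo v m p)) (tryAll-does (push v m) _ (push-valid v m p) q) ▷ Does-ret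

      outP-does : ∀ v → Valid x v → Small v → ∀ α →
        D (outP (Config.state v) (readsOf x v) α) (sim fr v)
          (Config.state (proj₁ (flipOut x v α)) , proj₂ (flipOut x v α) , revealOut x α) (sim fr (proj₁ (flipOut x v α)))
      outP-does v p q (halt b) = Does-ret
      outP-does v@(config st ih w wh c ch) p@(p₁ , p₂ , p₃) q@(q₁ , q₂ , q₃) (go st′ ww cw mi mw mc) =
        writeAll-does v ww cw p ▷
          to (cong (sim fr) moved≡) (exit effs≡ (tryAll-does (put v ww cw) (mi , mw , mc)
              (p₁ , subst (wh <_) (sym (length-write w wh ww)) p₂ , subst (ch <_) (sym (length-write c ch cw)) p₃)
              (q₁ , subst (_< Vb) (sym (length-write w wh ww)) q₂ , subst (_< Vb) (sym (length-write c ch cw)) q₃))) ▷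
            Does-ret
        where
        effs≡ : effsAt x (put v ww cw) (mi , mw , mc) ≡ effsAt x v (mi , mw , mc)
        effs≡ rewrite length-write w wh ww | length-write c ch cw = refl
        moved≡ : push (put v ww cw) (mi , mw , mc) ≡ config st (move (suc n) mi ih) (write w wh ww) (move (length w) mw wh) (write c ch cw) (move (length c) mc ch)
        moved≡ rewrite length-write w wh ww | length-write c ch cw = refl

      finish-does : ∀ {P : Set} v j idx → Valid x v → Small v → (d : Dec P) →
        D (finish (Config.state v) j idx (effsAt x v (opp³ (proj₂ (proj₂ idx)))) d) (sim fr (pull x v idx))
          (Config.state (proj₁ (flipIn x v j idx d)) , proj₂ (flipIn x v j idx d) , nothing) (sim fr (proj₁ (flipIn x v j idx d)))
      finish-does v@(config st ih w wh c ch) j idx@(q , (_ , a , b) , d) p sm (yes _) =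
        writeAll-does (pull x v idx) a b (push-valid v (opp³ d) p) ▷ Does-ret
      finish-does v@(config st ih w wh c ch) j idx@(q , s , d) p sm (no _) =
        to (cong (sim fr) (push-undo v (opp³ d) p)) (tryAll-does (pull x v idx) _ (push-valid v (opp³ d) p) sm) ▷ Does-ret

      flipP-does : ∀ v d → Valid x v → Small v →
        D (flipP (Config.state v) d) (sim fr v)
          (Config.state (proj₁ (flip x (v , d))) , proj₂ (flip x (v , d)) , reveal x v d) (sim fr (proj₁ (flip x (v , d))))
      flipP-does v zero p q = readAll-does v p ▷ outP-does v p q (δ′ (Config.state v) (readsOf x v))
      flipP-does v@(config st ih w wh c ch) (suc j) p q = pulled (decI j)
        where
        pulled : ∀ idx → D (inP st j idx) (sim fr v)
          (Config.state (proj₁ (flipIn x v j idx (matchAt? x v j idx))) , proj₂ (flipIn x v j idx (matchAt? x v j idx)) , nothing)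
          (sim fr (proj₁ (flipIn x v j idx (matchAt? x v j idx))))
        pulled idx@(r , s , d) =
          tryAll-does v (opp³ d) p q ▷
          readAll-does (pull x v idx) (push-valid v (opp³ d) p) ▷
          probe-does (pull x v idx) (movesOf (δ′ r s)) (push-valid v (opp³ d) p) q ▷
            finish-does v j idx p q (matchAt? x v j idx)

    answer-suc : ∀ i a ans → answer x (suc i) a ans ≡ (seen x (iter (T x) i a) <∣> answer x i a ans)
    answer-suc zero    a ans = refl
    answer-suc (suc i) a ans = answer-suc i (T x a) (seen x a <∣> ans)

    module _ {s c : ℕ} (s<V : s < Vb) (c<V : c < Vb) (n<V : suc n < Vb) where

      private
        small : ∀ {v} → Good x s c v → Small v
        small g = n<V , subst (_< Vb) (sym (length-work g)) s<V , subst (_< Vb) (sym (length-cat g)) c<V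

      tourP-does : ∀ {pre post b₀ b₁ b τ τ₀} e → let t = N x ^ e in N x ^ e < Vb →
        In x {b} {τ} {s} {c} (start-config s τ₀ , zero) →
        let fr = frame pre post (N x ^ e ∸ 1) 0 b₀ b₁ in
        D (tourP e) (sim fr (start-config s τ₀)) (answer x t (start-config s τ₀ , zero) nothing) (sim fr (start-config s τ₀))
      tourP-does {pre} {post} {b₀} {b₁} {b} {τ} {τ₀} e t<V i₀ =
        fwd ▷ bwd ▷ Does-ret
        where
        t : ℕ
        t = N x ^ e
        a : Config Q × Dart
        a = start-config s τ₀ , zero
        state : ℕ → ℕ → Config Q × Dart → CM nregs
        state a₀ a₁ (v , _) = sim (frame pre post a₀ a₁ b₀ b₁) v
        ctl : Config Q × Dart → Maybe Bool → Ctl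
        ctl (v , d) ans = Config.state v , d , ans
        ans : Maybe Bool
        ans = answer x t a nothing
        fwd-y : ℕ → Ctl
        fwd-y i = ctl (iter (T x) i a) (answer x i a nothing)
        fwd : D (rep aLo aHi e forward (start , zero , nothing)) (state (t ∸ 1) 0 a) (fwd-y t) (state (t ∸ 1) 0 (iter (T x) t a))
        fwd = subst (λ z → D (rep aLo aHi e forward (start , zero , nothing)) (state (t ∸ 1) 0 a) (fwd-y z) (state (t ∸ 1) 0 (iter (T x) z a))) (1+[N^e∸1] x e)
          (rep-does (λ a₀ a₁ i → state a₀ a₁ (iter (T x) i a)) fwd-y (t ∸ 1) (λ i a₁ → isReg aLo (state 0 a₁ (iter (T x) i a))) (λ i a₀ → isReg aHi (state a₀ 0 (iter (T x) i a)))
            (≤-<-trans (m∸n≤m t 1) t<V) (≤-reflexive (1+[N^e∸1] x e)) one)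
          where
          one : ∀ i a₀ a₁ → i ≤ t ∸ 1 → D (forward (fwd-y i)) (state a₀ a₁ (iter (T x) i a)) (fwd-y (suc i)) (state a₀ a₁ (iter (T x) (suc i) a))
          one i a₀ a₁ _ = to (cong (state a₀ a₁) (sym (iter-suc (T x) i a)))
            (exit (cong₂ ctl (sym (iter-suc (T x) i a)) (sym (answer-suc i a nothing)))
              (flipP-does {frame pre post a₀ a₁ b₀ b₁} _ _ (valid g) (small g) ▷ Does-ret))
            where
            g : Good x s c (proj₁ (iter (T x) i a))
            g = proj₁ (iter-in x i a i₀)
        bwd-y : ℕ → Ctl
        bwd-y i = ctl (iter (T⁻¹ x) i (iter (T x) t a)) ans
        -- The states of the way back are those of the way out in reverse order, so they inherit
        -- their invariant.
        back-good : ∀ i → i ≤ t → Good x s c (proj₁ (iter (T⁻¹ x) i (iter (T x) t a)))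
        back-good i i≤t = subst (λ z → Good x s c (proj₁ z)) (sym rewound) (proj₁ (iter-in x (t ∸ i) a i₀))
          where
          rewound : iter (T⁻¹ x) i (iter (T x) t a) ≡ iter (T x) (t ∸ i) a
          rewound = trans (cong (λ z → iter (T⁻¹ x) i (iter (T x) z a)) (sym (m∸n+n≡m i≤t)))
            (trans (cong (iter (T⁻¹ x) i) (iter-+ (T x) (t ∸ i) i a)) (undo x i _ (iter-in x (t ∸ i) a i₀)))
        bwd : D (rep aLo aHi e backward (fwd-y t)) (state (t ∸ 1) 0 (iter (T x) t a)) (ctl a ans) (state (t ∸ 1) 0 a)
        bwd = subst (λ z → D (rep aLo aHi e backward (fwd-y t)) (state (t ∸ 1) 0 (iter (T x) t a)) (ctl z ans) (state (t ∸ 1) 0 z)) (undo x t a i₀)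
          (subst (λ z → D (rep aLo aHi e backward (fwd-y t)) (state (t ∸ 1) 0 (iter (T x) t a)) (bwd-y z) (state (t ∸ 1) 0 (iter (T⁻¹ x) z (iter (T x) t a)))) (1+[N^e∸1] x e)
            (rep-does (λ a₀ a₁ i → state a₀ a₁ (iter (T⁻¹ x) i (iter (T x) t a))) bwd-y (t ∸ 1) (λ i a₁ → isReg aLo (state 0 a₁ (iter (T⁻¹ x) i (iter (T x) t a)))) (λ i a₀ → isReg aHi (state a₀ 0 (iter (T⁻¹ x) i (iter (T x) t a))))
              (≤-<-trans (m∸n≤m t 1) t<V) (≤-reflexive (1+[N^e∸1] x e)) one))
          where
          one : ∀ i a₀ a₁ → i ≤ t ∸ 1 → D (backward (bwd-y i)) (state a₀ a₁ (iter (T⁻¹ x) i (iter (T x) t a))) (bwd-y (suc i))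
            (state a₀ a₁ (iter (T⁻¹ x) (suc i) (iter (T x) t a)))
          one i a₀ a₁ i≤ = to (cong (state a₀ a₁) (sym (iter-suc (T⁻¹ x) i _)))
            (exit (cong (λ z → ctl z ans) (sym (iter-suc (T⁻¹ x) i _)))
              (flipP-does {frame pre post a₀ a₁ b₀ b₁} _ _ (valid g) (small g) ▷ Does-ret))
            where
            g : Good x s c (proj₁ (iter (T⁻¹ x) i (iter (T x) t a)))
            g = back-good i (≤-trans i≤ (m∸n≤m t 1))

      private
        Running : Set
        Running = Config Q × Maybe Bool
        advance : Running → Running
        advance (v , just b)  = v , just b
        advance (v , nothing) = proj₁ (flip x (v , zero)) , reveal x v zero
        stays : ∀ i v b → iter advance i (v , just b) ≡ (v , just b)
        stays zero    v b = refl
        stays (suc i) v b = stays i v b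
        advance-halts : ∀ {b τ v m} i → Halts x b τ v m → m < i → proj₂ (iter advance i (v , nothing)) ≡ just b
        advance-halts {b} {v = v} (suc i) (stops eq _) _ =
          trans (cong (λ α → proj₂ (iter advance i (proj₁ (flipOut x v α) , revealOut x α))) eq) (cong proj₂ (stays i v b))
        advance-halts {v = v} (suc i) (steps eq h) (s≤s m<) =
          trans (cong (λ α → proj₂ (iter advance i (proj₁ (flipOut x v α) , revealOut x α))) eq) (advance-halts i h m<)
        advance-good : ∀ a → Good x s c (proj₁ a) → Good x s c (proj₁ (advance a))
        advance-good (v , just _)  g = g
        advance-good (v , nothing) g = flip-good x v zero g
        iter-good : ∀ i a → Good x s c (proj₁ a) → Good x s c (proj₁ (iter advance i a))
        iter-good zero    a g = g
        iter-good (suc i) a g = iter-good i (advance a) (advance-good a g)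

      directP-does : ∀ {pre post b₀ b₁ b τ τ₀ m} e → N x ^ e < Vb → Good x s c (start-config s τ₀) →
        Halts x b τ (start-config s τ₀) m → m < N x ^ e →
        ∃ λ a → D (directP e) (sim (frame pre post (N x ^ e ∸ 1) 0 b₀ b₁) (start-config s τ₀)) (just b) a
      directP-does {pre} {post} {b₀} {b₁} {b} {τ₀ = τ₀} e t<V g₀ h m<t =
        state (t ∸ 1) 0 (iter advance (suc (t ∸ 1)) a) ,
        rep-does (λ a₀ a₁ i → state a₀ a₁ (iter advance i a)) (λ i → ctl (iter advance i a)) (t ∸ 1)
            (λ i a₁ → isReg aLo (state 0 a₁ (iter advance i a))) (λ i a₀ → isReg aHi (state a₀ 0 (iter advance i a))) (≤-<-trans (m∸n≤m t 1) t<V) (≤-reflexive (1+[N^e∸1] x e)) one ▷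
          exit (advance-halts (suc (t ∸ 1)) h (subst (_ <_) (sym (1+[N^e∸1] x e)) m<t)) (Does-ret)
        where
        t : ℕ
        t = N x ^ e
        a : Running
        a = start-config s τ₀ , nothing
        ctl : Running → Fin Q × Maybe Bool
        ctl (v , r) = Config.state v , r
        state : ℕ → ℕ → Running → CM nregs
        state a₀ a₁ (v , _) = sim (frame pre post a₀ a₁ b₀ b₁) v
        direct-does : ∀ a₀ a₁ y → Good x s c (proj₁ y) → D (direct (ctl y)) (state a₀ a₁ y) (ctl (advance y)) (state a₀ a₁ (advance y))
        direct-does a₀ a₁ (v , just _)  g = Does-ret
        direct-does a₀ a₁ (v , nothing) g = flipP-does {frame pre post a₀ a₁ b₀ b₁} v zero (valid g) (small g) ▷ Does-ret
        one : ∀ i a₀ a₁ → i ≤ t ∸ 1 → D (direct (ctl (iter advance i a))) (state a₀ a₁ (iter advance i a)) (ctl (iter advance (suc i) a))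
          (state a₀ a₁ (iter advance (suc i) a))
        one i a₀ a₁ _ = subst (λ z → D (direct (ctl (iter advance i a))) (state a₀ a₁ (iter advance i a)) (ctl z) (state a₀ a₁ z))
          (sym (iter-suc advance i a)) (direct-does a₀ a₁ (iter advance i a) (iter-good i a g₀))

-- Polynomial time

⌈n/2⌉*2≤ : ∀ y → 2 * ⌈ y /2⌉ ≤ suc y
⌈n/2⌉*2≤ zero          = z≤n
⌈n/2⌉*2≤ (suc zero)    = ≤-refl
⌈n/2⌉*2≤ (suc (suc y)) = ≤-trans (≤-reflexive (*-suc 2 ⌈ y /2⌉)) (s≤s (s≤s (⌈n/2⌉*2≤ y)))

≤⌈n/2⌉*2 : ∀ y → y ≤ 2 * ⌈ y /2⌉
≤⌈n/2⌉*2 zero          = z≤n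
≤⌈n/2⌉*2 (suc zero)    = s≤s z≤n
≤⌈n/2⌉*2 (suc (suc y)) = ≤-trans (s≤s (s≤s (≤⌈n/2⌉*2 y))) (≤-reflexive (sym (*-suc 2 ⌈ y /2⌉)))

2^log-upper : ∀ y → 2 ^ ⌈log₂ suc (suc y) ⌉ ≤ 2 * suc y
2^log-upper y = bound y (<-wellFounded y)
  where
  bound : ∀ y → Acc _<_ y → 2 ^ ⌈log₂ suc (suc y) ⌉ ≤ 2 * suc y
  bound y (acc rs) = subst (λ z → 2 ^ z ≤ 2 * suc y) (sym (log-unfold y)) (half ⌈ y /2⌉ refl)
    where
    half : ∀ h → ⌈ y /2⌉ ≡ h → 2 * 2 ^ ⌈log₂ suc ⌈ y /2⌉ ⌉ ≤ 2 * suc y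
    half zero    eq = subst (λ z → 2 * 2 ^ ⌈log₂ suc z ⌉ ≤ 2 * suc y) (sym eq) (*-monoʳ-≤ 2 {1} (s≤s z≤n))
    half (suc q) eq = subst (λ z → 2 * 2 ^ ⌈log₂ suc z ⌉ ≤ 2 * suc y) (sym eq)
      (*-monoʳ-≤ 2 (≤-trans (bound q (rs (subst (_≤ y) eq (⌈n/2⌉≤n y)))) (subst (λ z → 2 * z ≤ suc y) eq (⌈n/2⌉*2≤ y))))

2^log-lower : ∀ y → suc y ≤ 2 ^ ⌈log₂ suc y ⌉
2^log-lower y = bound y (<-wellFounded y)
  where
  bound : ∀ y → Acc _<_ y → suc y ≤ 2 ^ ⌈log₂ suc y ⌉
  bound zero    _        = ≤-refl
  bound (suc y) (acc rs) = subst (λ z → suc (suc y) ≤ 2 ^ z) (sym (log-unfold y))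
    (≤-trans (≤-trans (s≤s (s≤s (≤⌈n/2⌉*2 y))) (≤-reflexive (sym (*-suc 2 ⌈ y /2⌉))))
             (*-monoʳ-≤ 2 (bound ⌈ y /2⌉ (rs (s≤s (⌈n/2⌉≤n y))))))

n<2^n : ∀ n → n < 2 ^ n
n<2^n zero    = s≤s z≤n
n<2^n (suc n) = ≤-trans (+-mono-≤ (m^n>0 2 n) (n<2^n n)) (≤-reflexive (cong (2 ^ n +_) (sym (+-identityʳ (2 ^ n)))))

module Bounds (x : List Bool) where

  ℓ : ℕ
  ℓ = ⌈log₂ N x ⌉

  private
    n : ℕ
    n = length x
    N≡ : N x ≡ suc (suc n)
    N≡ = +-comm n 2

  1≤ℓ : 1 ≤ ℓ
  1≤ℓ = subst (λ z → 1 ≤ ⌈log₂ z ⌉) (sym N≡) (subst (1 ≤_) (sym (log-unfold n)) (s≤s z≤n))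

  ℓ≤N : ℓ ≤ N x
  ℓ≤N = subst (λ z → ⌈log₂ z ⌉ ≤ z) (sym N≡) (≤-trans (log≤ (suc n)) (n≤1+n (suc n)))

  N≤2^ℓ : N x ≤ 2 ^ ℓ
  N≤2^ℓ = subst (λ z → z ≤ 2 ^ ⌈log₂ z ⌉) (sym N≡) (2^log-lower (suc n))

  2^ℓ≤N² : 2 ^ ℓ ≤ N x ^ 2
  2^ℓ≤N² = ≤-trans (subst (λ z → 2 ^ ⌈log₂ z ⌉ ≤ 2 * z) (sym N≡) (≤-trans (2^log-upper n) (*-monoʳ-≤ 2 (n≤1+n (suc n)))))
    (≤-trans (*-monoˡ-≤ (N x) (2≤N x)) (≤-reflexive (cong (N x *_) (sym (*-identityʳ (N x))))))

  2^≤N^ : ∀ k → 2 ^ k ≤ N x ^ k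
  2^≤N^ k = ^-monoˡ-≤ k (2≤N x)

  kℓ<N^ : ∀ k → k * ℓ < N x ^ suc k
  kℓ<N^ k = <-≤-trans (*-monoˡ-< ℓ ⦃ >-nonZero 1≤ℓ ⦄ (<-≤-trans (n<2^n k) (2^≤N^ k)))
    (≤-trans (*-monoʳ-≤ (N x ^ k) ℓ≤N) (≤-reflexive (*-comm (N x ^ k) (N x))))

  1<N^ : ∀ k → 1 < N x ^ suc k
  1<N^ k = ≤-trans (2≤N x) (≤-trans (≤-reflexive (sym (*-identityʳ (N x)))) (N^-mono x {1} {suc k} (s≤s z≤n)))

  1+n<N^ : ∀ k → suc n < N x ^ suc k
  1+n<N^ k = ≤-trans (≤-reflexive (sym N≡)) (≤-trans (≤-reflexive (sym (*-identityʳ (N x)))) (N^-mono x {1} {suc k} (s≤s z≤n)))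

  N^< : ∀ {a b} → a < b → N x ^ a < N x ^ b
  N^< {a} p = <-≤-trans (<-≤-trans (m<m+n (N x ^ a) (N^-mono x {0} {a} z≤n)) (N^+N^ x {a} {a} {a} ≤-refl ≤-refl)) (N^-mono x p)

  -- the simulated work tape is never empty
  space : ℕ → ℕ
  space k = suc (k * ℓ ∸ 1)

  space<N^ : ∀ k → space k < N x ^ suc k
  space<N^ k with k * ℓ | kℓ<N^ k
  ... | zero  | _ = 1<N^ k
  ... | suc z | p = p

  space≤ : ∀ k → space k ≤ suc (k * ℓ)
  space≤ k = s≤s (m∸n≤m (k * ℓ) 1)

-- A machine with an empty work tape (k = 0) is replaced by one that ignores its only work cell.
ignoreWork : Machine → Machine
ignoreWork M = record { Q = Q ; start = start ; δ = λ q i _ b → mask (δ q i false b) }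
  where
  open Machine M
  mask : Action Q → Action Q
  mask (halt b) = halt b
  mask (go q _ cw mi _ mc) = go q false cw mi S mc

ignoreWork-run : ∀ M x t {st ih wh c ch b τ} → runFor M t x (running (config st ih [] wh c ch)) ≡ halted b τ →
  runFor (ignoreWork M) t x (running (config st ih (false ∷ []) 0 c ch)) ≡ halted b τ
ignoreWork-run M x (suc t) {st} {ih} {wh} {c} {ch} eq with Machine.δ M st (readIn x ih) false (read c ch)
... | halt b = trans (trans (runFor-halted x (ignoreWork M) t b c) (sym (runFor-halted x M t b c))) eq
... | go _ _ _ _ _ _ = ignoreWork-run M x t eq

normalise : ℕ → Machine → Machine
normalise zero    M = ignoreWork M
normalise (suc k) M = M

normalise-run : ∀ k M x t {τ b τ′} → runFor M t x (init M (spaceB k (length x)) τ) ≡ halted b τ′ →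
  runFor (normalise k M) t x (init (normalise k M) (Bounds.space x k) τ) ≡ halted b τ′
normalise-run zero    M x t eq = ignoreWork-run M x t eq
normalise-run (suc k) M x t {τ} {b} {τ′} eq =
  subst (λ s → runFor M t x (init M s τ) ≡ halted b τ′)
    (sym (m+[n∸m]≡n {1} (≤-trans (Bounds.1≤ℓ x) (m≤m+n _ (k * Bounds.ℓ x))))) eq

-- One memory is read in up to three ways in turn: untouched before the tracks are set up, as a
-- counter machine, and, after a failed search, as bare tapes for the polynomial time machine.
data Phase (A B : Set) : Set where
  fresh : Phase A B
  on    : A → Phase A B
  off   : B → Phase A B

module _ (x : List Bool) {A B : Set} (σ₀ : Mem) (R₁ : A → Mem → Set) (R₂ : B → Mem → Set) where

  data RepPhase : Phase A B → Mem → Set where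
    rep₀ : RepPhase fresh σ₀
    rep₁ : ∀ {a σ} → R₁ a σ → RepPhase (on a) σ
    rep₂ : ∀ {b σ} → R₂ b σ → RepPhase (off b) σ

  phase-on : ∀ {E} {P : Prog E} {a e a′} → Does x R₁ P a e a′ → Does x RepPhase P (on a) e (on a′)
  phase-on d .run σ (rep₁ r) = let t , σ′ , t≤ , reach , r′ = run d σ r in t , σ′ , t≤ , reach , rep₁ r′

  phase-off : ∀ {E} {P : Prog E} {a e a′} → Does x R₂ P a e a′ → Does x RepPhase P (off a) e (off a′)
  phase-off d .run σ (rep₂ r) = let t , σ′ , t≤ , reach , r′ = run d σ r in t , σ′ , t≤ , reach , rep₂ r′

  phase-switch : ∀ {E} {P : Prog E} {s e a b} → (∀ σ → R₁ a σ → R₂ b σ) → Does x RepPhase P s e (on a) → Does x RepPhase P s e (off b)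
  phase-switch {P = P} {e = e} {a} {b} f d .run σ r = conv (run d σ r)
    where
    conv : (∃ λ t → ∃ λ σ′ → t ≤ N x ^ expo P × Reach x P (entry P) σ t e σ′ × RepPhase (on a) σ′) →
      ∃ λ t → ∃ λ σ′ → t ≤ N x ^ expo P × Reach x P (entry P) σ t e σ′ × RepPhase (off b) σ′
    conv (t , σ′ , t≤ , reach , rep₁ r) = t , σ′ , t≤ , reach , rep₂ (f σ′ r)

  phase-fresh : ∀ {E} {P : Prog E} {e a} →
    (∃ λ t → ∃ λ σ′ → t ≤ N x ^ expo P × Reach x P (entry P) σ₀ t e σ′ × R₁ a σ′) → Does x RepPhase P fresh e (on a)
  phase-fresh (t , σ′ , t≤ , reach , r) .run .σ₀ rep₀ = t , σ′ , t≤ , reach , rep₁ r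

compile-run : ∀ x P {A : Set} {Rep : A → Mem → Set} {a b a′ w τ T} → Does x Rep P a b a′ → Rep a (mem 0 w 0 τ 0) → expo P ≤ T →
  ∃ λ σ′ → Rep a′ σ′ ×
    runFor (compile P) (N x ^ T) x (running (config (Machine.start (compile P)) 0 w 0 τ 0)) ≡ halted b (Mem.cat σ′)
compile-run x P d r T≥ =
  let t , σ′ , t≤ , reach , r′ = run d _ r in
  σ′ , r′ , runFor-mono x (compile P) (≤-trans t≤ (N^-mono x T≥)) (compile-correct x P reach)

module Initialise (ops : CMOps nregs) where
  open CMOps ops
  open Macros ops

  initP : ℕ → ℕ → Prog ⊤
  initP k e = initN ▸ initW k ▸ initPow k crem ▸ initPow e aLo ▸ initPow e bLo

  module _ (x : List Bool) (V : ℕ) (spec : CMSpec ops x V) (M : Machine) where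
    open CMSpec spec
    open Specs x V spec
    open Tour M using (start-config)
    open Simulation.SimSpecs ops M x V spec using (sim)
    open Bounds x using (ℓ; space)

    initP-does : ∀ k e {τ post} → suc n < V → k * ℓ < V → N x ^ k < V → N x ^ e < V → length τ ≡ N x ^ k →
      D (initP k e) (cm (vreplicate nregs 0) 0 (replicate (space k) false) 0 (τ ++ post) 0) tt
        (sim (frame [] post (N x ^ e ∸ 1) 0 (N x ^ e ∸ 1) 0) (start-config (space k) τ))
    initP-does k e {τ} {post} n<V kℓ<V c<V t<V len =
      initN-does n<V ▷
      initW-does k (<-trans (n<1+n n) n<V) kℓ<V ▷
      initPow-does regs-c k c<V ▷
      initPow-does regs-a e t<V ▷
      to final (initPow-does regs-b e t<V)
      where
      t wr : ℕ
      t  = N x ^ e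
      wr = k * ℓ ∸ 1
      G : (cr a₀ b₀ t₂ n₀ n₁ : ℕ) → CM nregs
      G cr a₀ b₀ t₂ n₀ n₁ = cm (0 ∷ 0 ∷ wr ∷ 0 ∷ cr ∷ 0 ∷ t₂ ∷ n₀ ∷ n₁ ∷ a₀ ∷ 0 ∷ b₀ ∷ 0 ∷ []) 0 (replicate (space k) false) 0 (τ ++ post) 0
      reg-t : ∀ {cr a₀ b₀ n₀ n₁} → IsReg tmp₂ (λ v → G cr a₀ b₀ v n₀ n₁)
      reg-t {cr} {a₀} {b₀} {n₀} {n₁} = isReg tmp₂ (G cr a₀ b₀ 0 n₀ n₁)
      reg-0 : ∀ {cr a₀ b₀ t₂ n₁} → IsReg nLo (λ v → G cr a₀ b₀ t₂ v n₁)
      reg-0 {cr} {a₀} {b₀} {t₂} {n₁} = isReg nLo (G cr a₀ b₀ t₂ 0 n₁)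
      reg-1 : ∀ {cr a₀ b₀ t₂ n₀} → IsReg nHi (λ v → G cr a₀ b₀ t₂ n₀ v)
      reg-1 {cr} {a₀} {b₀} {t₂} {n₀} = isReg nHi (G cr a₀ b₀ t₂ n₀ 0)
      regs-c : PowRegs crem (λ v → G v 0 0)
      regs-c = record
        { reg-r = λ t₂ n₀ n₁ → isReg crem (G 0 0 0 t₂ n₀ n₁)
        ; reg-t = λ _ _ _ → reg-t ; reg-0 = λ _ _ _ → reg-0 ; reg-1 = λ _ _ _ → reg-1 }
      regs-a : PowRegs aLo (λ v → G (N x ^ k ∸ 1) v 0)
      regs-a = record
        { reg-r = λ t₂ n₀ n₁ → isReg aLo (G (N x ^ k ∸ 1) 0 0 t₂ n₀ n₁)
        ; reg-t = λ _ _ _ → reg-t ; reg-0 = λ _ _ _ → reg-0 ; reg-1 = λ _ _ _ → reg-1 }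
      regs-b : PowRegs bLo (λ v → G (N x ^ k ∸ 1) (t ∸ 1) v)
      regs-b = record
        { reg-r = λ t₂ n₀ n₁ → isReg bLo (G (N x ^ k ∸ 1) (t ∸ 1) 0 t₂ n₀ n₁)
        ; reg-t = λ _ _ _ → reg-t ; reg-0 = λ _ _ _ → reg-0 ; reg-1 = λ _ _ _ → reg-1 }
      final : G (N x ^ k ∸ 1) (t ∸ 1) (t ∸ 1) 0 (suc n) 0 ≡ sim (frame [] post (t ∸ 1) 0 (t ∸ 1) 0) (start-config (space k) τ)
      final = cong₂ (λ u v → cm (0 ∷ 0 ∷ u ∷ 0 ∷ v ∷ 0 ∷ 0 ∷ suc n ∷ 0 ∷ t ∸ 1 ∷ 0 ∷ t ∸ 1 ∷ 0 ∷ []) 0 (replicate (space k) false) 0 (τ ++ post) 0)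
        (cong (_∸ 1) (sym (length-replicate (space k)))) (cong (_∸ 1) (sym len))

module ToP (Lg : Language) (k : ℕ) (M : Machine)
  (halts : ∀ x τ → length τ ≡ polyB k (length x) →
    ∃ λ τ′ → runFor M (polyB k (length x)) x (init M (spaceB k (length x)) τ) ≡ halted (Lg x) τ′) where

  private
    eW : ℕ
    eW = suc (suc k)
    M′ : Machine
    M′ = normalise k M
    module I = Impl nregs eW
    ops : CMOps nregs
    ops = I.polyOps

  program : Prog Bool
  program = I.setAll I.polySetup ▸ Initialise.initP ops k k ▸ bind (Simulation.directP ops M′ k) λ r → ret (fromMaybe false r)

  private
    B : ℕ
    B = Tracks.B nregs eW
    K : ℕ
    -- N^eW blocks of B ≤ N^B cells fit on the work tape, and the last summand pays for the running
    -- time.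
    K = (eW + B) + expo program

  inP : InP Lg
  inP = K , compile program , λ x → correct x
    where
    module _ (x : List Bool) where
      open Bounds x
      m : ℕ
      m = N x ^ suc k
      W≤ : suc m ≤ N x ^ eW
      W≤ = N^+N^ x {0} {suc k} {suc k} z≤n ≤-refl
      spec : CMSpec ops x (suc m)
      spec = I.polySpec x m W≤
      c : ℕ
      c = N x ^ k
      0<c : 0 < c
      0<c = N^-mono x {0} {k} z≤n
      c<V : c < suc m
      c<V = <-trans (N^< {k} {suc k} (n<1+n k)) (n<1+n m)
      -- Every initial content leads to the right answer, hence so does the blank one, which needs
      -- no preparation on the tracks.
      τ₀ : List Bool
      τ₀ = replicate c false
      run₀ : ∃ λ τ′ → runFor M (polyB k (length x)) x (init M (spaceB k (length x)) τ₀) ≡ halted (Lg x) τ′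
      run₀ = halts x τ₀ (length-replicate c)
      halts₀ : ∃ λ m → suc m ≤ c × Tour.Halts M′ x (Lg x) (proj₁ run₀) (Tour.start-config M′ (space k) τ₀) m
      halts₀ = Tour.runFor-Halts M′ x c (normalise-run k M x c (proj₂ run₀))
      σ₀ : Mem
      σ₀ = mem 0 (replicate (polyB K (length x)) false) 0 [] 0
      fits : suc m * B ≤ polyB K (length x)
      fits = ≤-trans (*-mono-≤ W≤ (≤-trans (<⇒≤ (n<2^n B)) (2^≤N^ B)))
        (≤-trans (≤-reflexive (sym (^-distribˡ-+-* (N x) eW B))) (N^-mono x (m≤m+n (eW + B) (expo program))))
      direct = Simulation.SimSpecs.directP-does ops M′ x (suc m) spec {space k} {c} (<-trans (space<N^ k) (n<1+n m))
        c<V (<-trans (1+n<N^ k) (n<1+n m)) {[]} {[]} {c ∸ 1} {0} k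
        c<V (Tour.start-good M′ x (s≤s z≤n) 0<c (length-replicate c)) (proj₂ (proj₂ halts₀)) (proj₁ (proj₂ halts₀))
      d : Does x (RepPhase x {B = ⊤} σ₀ (CMSpec.Rep spec) (λ _ _ → ⊤)) program fresh (Lg x) (on (proj₁ direct))
      d = phase-fresh x σ₀ _ _ (I.polySetup-reach x m W≤ (<⇒≤ (<-trans (space<N^ k) (n<1+n m)))
              (<⇒≤ c<V) (Impl.fresh fits)) ▷
          phase-on x σ₀ _ _ (subst (λ z → Does x (CMSpec.Rep spec) (Initialise.initP ops k k)
                  (cm (vreplicate nregs 0) 0 (replicate (space k) false) 0 z 0) tt
                  (Simulation.SimSpecs.sim ops M′ x (suc m) spec (Macros.Specs.frame [] [] (c ∸ 1) 0 (c ∸ 1) 0) (Tour.start-config M′ (space k) τ₀)))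
                (++-identityʳ τ₀)
              (Initialise.initP-does ops x (suc m) spec M′ k k {τ₀} {[]} (<-trans (1+n<N^ k) (n<1+n m)) (<-trans (kℓ<N^ k) (n<1+n m))
                c<V c<V (length-replicate c)) ▷
            proj₂ direct ▷ Does-ret)
      correct : ∃ λ τ′ → runFor (compile program) (polyB K (length x)) x (init (compile program) (polyB K (length x)) []) ≡ halted (Lg x) τ′
      correct = let σ′ , _ , eq = compile-run x program d rep₀ (m≤n+m (expo program) (eW + B)) in Mem.cat σ′ , eq

-- Searching the blocks of the catalytic tape

wiped : ℕ → List Bool → List Bool
wiped zero    l = l
wiped (suc i) l = write (wiped i l) i false

length-wiped : ∀ i l → length (wiped i l) ≡ length l
length-wiped zero    l = refl
length-wiped (suc i) l = trans (length-write (wiped i l) i false) (length-wiped i l)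

read-wiped : ∀ t l → t ≤ length l → ∀ i → i < t → read (wiped t l) i ≡ false
read-wiped (suc t) l t≤ i i<t with t ≟ i
... | yes refl = read-write-same (wiped t l) t false (subst (t <_) (sym (length-wiped t l)) t≤)
... | no ¬p    = trans (read-write-other (wiped t l) t i false ¬p)
                   (read-wiped t l (<⇒≤ t≤) i (≤∧≢⇒< (s≤s⁻¹ i<t) λ q → ¬p (sym q)))

module Search (ops : CMOps nregs) (M : Machine) where
  open CMOps ops
  open Macros ops
  open Simulation ops M

  -- With the simulated head at the start of its window, `crem` holds c - 1 and `cpos` holds 0. The
  -- pair therefore doubles as a loop counter for crossing one block.
  advanceP retreatP : ℕ → Prog ⊤
  advanceP k = rep crem cpos k (λ _ → cR) tt
  retreatP k = rep crem cpos k (λ _ → cL) tt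

  -- The first answer is kept and the search goes on regardless. Every tour restores its block, so
  -- the remaining ones do no harm, and the head ends at the same place in all cases.
  blockP : ℕ → ℕ → Maybe Bool → Prog (Maybe Bool)
  blockP k e ans = bind (tourP e) λ r → advanceP k ▸ ret (ans <∣> r)

  searchP : ℕ → ℕ → Prog (Maybe Bool)
  searchP k e = rep bLo bHi e (blockP k e) nothing

  wipeStep : ⊤ → Prog ⊤
  wipeStep _ = wrC false ▸ cR

  -- Back over all t blocks, then t cells are erased, not t blocks: so many cells are enough for the
  -- work tape of the polynomial time machine. Finally the head returns to cell 0, where that
  -- machine starts.
  wipeP : ℕ → ℕ → Prog ⊤
  wipeP k e = rep bLo bHi e (λ _ → retreatP k) tt ▸ rep aLo aHi e wipeStep tt ▸ rep aLo aHi e (λ _ → cL) tt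

  module Windows (x : List Bool) (V : ℕ) (spec : CMSpec ops x V) (s k : ℕ) where
    open CMSpec spec
    open Specs x V spec
    open SimSpecs x V spec
    open Tour M hiding (V)
    open Counting M x

    c : ℕ
    c = N x ^ k

    w : List Bool
    w = replicate s false

    at : (a₀ a₁ b₀ b₁ cp cr h : ℕ) → List Bool → CM nregs
    at a₀ a₁ b₀ b₁ cp cr h ct =
      cm (0 ∷ 0 ∷ length w ∸ 1 ∷ cp ∷ cr ∷ 0 ∷ 0 ∷ suc n ∷ 0 ∷ a₀ ∷ a₁ ∷ b₀ ∷ b₁ ∷ []) 0 w 0 ct h

    home-at : (a₀ a₁ b₀ b₁ h : ℕ) → List Bool → CM nregs
    home-at a₀ a₁ b₀ b₁ = at a₀ a₁ b₀ b₁ 0 (c ∸ 1)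

    length-block : ∀ {ct : List Bool} h → h + c ≤ length ct → length (take c (drop h ct)) ≡ c
    length-block {ct} h fits = trans (length-take c (drop h ct))
      (m≤n⇒m⊓n≡m (≤-trans (≤-trans (≤-reflexive (sym (m+n∸m≡n h c))) (∸-monoˡ-≤ h fits)) (≤-reflexive (sym (length-drop h ct)))))

    -- One state seen in two ways, as the start configuration on the block at h and as the whole
    -- tape with its head at h. Thus the specification of the tour applies to block after block.
    window-at : ∀ {a₀ a₁ b₀ b₁ ct} h → h + c ≤ length ct →
      sim (frame (take h ct) (drop c (drop h ct)) a₀ a₁ b₀ b₁) (start-config s (take c (drop h ct))) ≡ home-at a₀ a₁ b₀ b₁ h ct
    window-at {a₀} {a₁} {b₀} {b₁} {ct} h fits = trans
      (cong₂ (λ u v → cm (0 ∷ 0 ∷ length w ∸ 1 ∷ 0 ∷ u ∸ 1 ∷ 0 ∷ 0 ∷ suc n ∷ 0 ∷ a₀ ∷ a₁ ∷ b₀ ∷ b₁ ∷ []) 0 w 0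
                          (take h ct ++ take c (drop h ct) ++ drop c (drop h ct)) v) (length-block h fits) len-pre)
      (cong (home-at a₀ a₁ b₀ b₁ h) (trans (cong (take h ct ++_) (take++drop≡id c (drop h ct))) (take++drop≡id h ct)))
      where
      len-pre : length (take h ct) + 0 ≡ h
      len-pre = trans (+-identityʳ _) (trans (length-take h ct) (m≤n⇒m⊓n≡m (≤-trans (m≤m+n h c) fits)))

    module _ (c<V : c < V) {a₀ a₁ b₀ b₁ : ℕ} {ct : List Bool} (h : ℕ) (fits : h + c < length ct) where

      private
        regs-lo : ∀ p cp → IsReg crem (λ cr → at a₀ a₁ b₀ b₁ cp cr p ct)
        regs-lo p cp = isReg crem (at a₀ a₁ b₀ b₁ cp 0 p ct)
        regs-hi : ∀ p cr → IsReg cpos (λ cp → at a₀ a₁ b₀ b₁ cp cr p ct)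
        regs-hi p cr = isReg cpos (at a₀ a₁ b₀ b₁ 0 cr p ct)

      advance-does : D (advanceP k) (home-at a₀ a₁ b₀ b₁ h ct) tt (home-at a₀ a₁ b₀ b₁ (h + c) ct)
      advance-does = subst₂ (λ u v → D (advanceP k) (home-at a₀ a₁ b₀ b₁ u ct) tt (home-at a₀ a₁ b₀ b₁ v ct))
        (+-identityʳ h) (cong (h +_) (1+[N^e∸1] x k))
        (rep-does (λ cr cp i → at a₀ a₁ b₀ b₁ cp cr (h + i) ct) (λ _ → tt) (c ∸ 1) (λ i cp → regs-lo (h + i) cp) (λ i cr → regs-hi (h + i) cr)
          (≤-<-trans (m∸n≤m c 1) c<V) (≤-reflexive (1+[N^e∸1] x k)) one)
        where
        one : ∀ i cr cp → i ≤ c ∸ 1 → D cR (at a₀ a₁ b₀ b₁ cp cr (h + i) ct) tt (at a₀ a₁ b₀ b₁ cp cr (h + suc i) ct)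
        one i cr cp i≤ = to (cong (λ z → at a₀ a₁ b₀ b₁ cp cr z ct) (sym (+-suc h i)))
          (cR-does (≤-<-trans (≤-trans (≤-reflexive (sym (+-suc h i))) (+-monoʳ-≤ h (≤-trans (s≤s i≤) (≤-reflexive (1+[N^e∸1] x k))))) fits))

      retreat-does : D (retreatP k) (home-at a₀ a₁ b₀ b₁ (h + c) ct) tt (home-at a₀ a₁ b₀ b₁ h ct)
      retreat-does = subst (λ v → D (retreatP k) (home-at a₀ a₁ b₀ b₁ (h + c) ct) tt (home-at a₀ a₁ b₀ b₁ v ct))
        (trans (cong (λ z → h + (c ∸ z)) (1+[N^e∸1] x k)) (trans (cong (h +_) (n∸n≡0 c)) (+-identityʳ h)))
        (rep-does (λ cr cp i → at a₀ a₁ b₀ b₁ cp cr (h + (c ∸ i)) ct) (λ _ → tt) (c ∸ 1) (λ i cp → regs-lo (h + (c ∸ i)) cp) (λ i cr → regs-hi (h + (c ∸ i)) cr)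
          (≤-<-trans (m∸n≤m c 1) c<V) (≤-reflexive (1+[N^e∸1] x k)) one)
        where
        one : ∀ i cr cp → i ≤ c ∸ 1 → D cL (at a₀ a₁ b₀ b₁ cp cr (h + (c ∸ i)) ct) tt (at a₀ a₁ b₀ b₁ cp cr (h + (c ∸ suc i)) ct)
        one i cr cp i≤ = subst (λ z → D cL (at a₀ a₁ b₀ b₁ cp cr z ct) tt (at a₀ a₁ b₀ b₁ cp cr (h + (c ∸ suc i)) ct)) (sym down)
          (cL-does (≤-<-trans (≤-trans (≤-reflexive (sym down)) (+-monoʳ-≤ h (m∸n≤m c i))) fits))
          where
          down : h + (c ∸ i) ≡ suc (h + (c ∸ suc i))
          down = trans (cong (h +_) (∸-peel (≤-trans (s≤s i≤) (≤-reflexive (1+[N^e∸1] x k))))) (+-suc h _)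

    module Blocks (e : ℕ) (c<V : c < V) (s<V : s < V) (n<V : suc n < V) (t<V : N x ^ e < V) {ct : List Bool}
             -- The spare block gives the head a cell to stand on when it has passed the last block
             -- searched.
             (fits : N x ^ e * c + c ≤ length ct) where

      private
        t : ℕ
        t = N x ^ e
        0<c : 0 < c
        0<c = N^-mono x {0} {k} z≤n
        fits-i : ∀ {i} → i < t → i * c + c < length ct
        fits-i {i} i<t = ≤-trans (≤-trans (≤-reflexive (cong suc (+-comm (i * c) c))) (≤-trans (m<m+n (suc i * c) 0<c) (+-monoˡ-≤ c (*-monoˡ-≤ c i<t)))) fits
        isLo : ∀ {a₀ a₁ h} b₁ → IsReg bLo (λ b₀ → home-at a₀ a₁ b₀ b₁ h ct)
        isLo {a₀} {a₁} {h} b₁ = isReg bLo (home-at a₀ a₁ 0 b₁ h ct)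
        isHi : ∀ {a₀ a₁ h} b₀ → IsReg bHi (λ b₁ → home-at a₀ a₁ b₀ b₁ h ct)
        isHi {a₀} {a₁} {h} b₀ = isReg bHi (home-at a₀ a₁ b₀ 0 h ct)

      blockAnswer : ℕ → Maybe Bool
      blockAnswer i = tourAnswer s t (take c (drop (i * c) ct))

      found : ℕ → Maybe Bool
      found zero    = nothing
      found (suc i) = found i <∣> blockAnswer i

      search-does : (∀ i → i < t → ∃ λ b → ∃ λ τ → In x {b} {τ} {s} {c} (start-config s (take c (drop (i * c) ct)) , zero)) →
        D (searchP k e) (home-at (t ∸ 1) 0 (t ∸ 1) 0 0 ct) (found t) (home-at (t ∸ 1) 0 (t ∸ 1) 0 (t * c) ct)
      search-does ins = subst (λ z → D (searchP k e) (home-at (t ∸ 1) 0 (t ∸ 1) 0 0 ct) (found z) (home-at (t ∸ 1) 0 (t ∸ 1) 0 (z * c) ct)) (1+[N^e∸1] x e)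
        (rep-does (λ b₀ b₁ i → home-at (t ∸ 1) 0 b₀ b₁ (i * c) ct) found (t ∸ 1) (λ i → isLo) (λ i → isHi)
          (≤-<-trans (m∸n≤m t 1) t<V) (≤-reflexive (1+[N^e∸1] x e)) one)
        where
        one : ∀ i b₀ b₁ → i ≤ t ∸ 1 → D (blockP k e (found i)) (home-at (t ∸ 1) 0 b₀ b₁ (i * c) ct) (found (suc i)) (home-at (t ∸ 1) 0 b₀ b₁ (suc i * c) ct)
        one i b₀ b₁ i≤ = subst (λ z → D (tourP e) z (blockAnswer i) z) (window-at (i * c) (<⇒≤ (fits-i i<t)))
            (tourP-does s<V c<V n<V {take (i * c) ct} {drop c (drop (i * c) ct)} e t<V (proj₂ (proj₂ (ins i i<t)))) ▷
          to (cong (λ z → home-at (t ∸ 1) 0 b₀ b₁ z ct) (+-comm (i * c) c)) (advance-does c<V (i * c) (fits-i i<t)) ▷ Does-ret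
          where
          i<t : i < t
          i<t = ≤-trans (s≤s i≤) (≤-reflexive (1+[N^e∸1] x e))

      wipe-does : D (wipeP k e) (home-at (t ∸ 1) 0 (t ∸ 1) 0 (t * c) ct) tt (home-at (t ∸ 1) 0 (t ∸ 1) 0 0 (wiped t ct))
      wipe-does = back ▷ wipe ▷ return
        where
        back : D (rep bLo bHi e (λ _ → retreatP k) tt) (home-at (t ∸ 1) 0 (t ∸ 1) 0 (t * c) ct) tt (home-at (t ∸ 1) 0 (t ∸ 1) 0 0 ct)
        back = to (cong (λ z → home-at (t ∸ 1) 0 (t ∸ 1) 0 (z * c) ct) (trans (cong (t ∸_) (1+[N^e∸1] x e)) (n∸n≡0 t)))
          (rep-does (λ b₀ b₁ i → home-at (t ∸ 1) 0 b₀ b₁ ((t ∸ i) * c) ct) (λ _ → tt) (t ∸ 1) (λ i → isLo) (λ i → isHi)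
            (≤-<-trans (m∸n≤m t 1) t<V) (≤-reflexive (1+[N^e∸1] x e)) one)
          where
          one : ∀ i b₀ b₁ → i ≤ t ∸ 1 → D (retreatP k) (home-at (t ∸ 1) 0 b₀ b₁ ((t ∸ i) * c) ct) tt (home-at (t ∸ 1) 0 b₀ b₁ ((t ∸ suc i) * c) ct)
          one i b₀ b₁ i≤ = subst (λ z → D (retreatP k) (home-at (t ∸ 1) 0 b₀ b₁ z ct) tt (home-at (t ∸ 1) 0 b₀ b₁ ((t ∸ suc i) * c) ct)) (sym down)
            (retreat-does c<V ((t ∸ suc i) * c) (fits-i (subst (t ∸ suc i <_) (1+[N^e∸1] x e) (s≤s (≤-trans (≤-reflexive (sym (∸-+-assoc t 1 i))) (m∸n≤m (t ∸ 1) i))))))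
            where
            down : (t ∸ i) * c ≡ (t ∸ suc i) * c + c
            down = trans (cong (_* c) (∸-peel (≤-trans (s≤s i≤) (≤-reflexive (1+[N^e∸1] x e))))) (+-comm c _)
        loA : ∀ {ct h} a₁ → IsReg aLo (λ a₀ → home-at a₀ a₁ (t ∸ 1) 0 h ct)
        loA {ct} {h} a₁ = isReg aLo (home-at 0 a₁ (t ∸ 1) 0 h ct)
        hiA : ∀ {ct h} a₀ → IsReg aHi (λ a₁ → home-at a₀ a₁ (t ∸ 1) 0 h ct)
        hiA {ct} {h} a₀ = isReg aHi (home-at a₀ 0 (t ∸ 1) 0 h ct)
        t<len : t < length ct
        t<len = ≤-trans (≤-trans (m<m+n t {c} 0<c) (+-monoˡ-≤ c (≤-trans (≤-reflexive (sym (*-identityʳ t))) (*-monoʳ-≤ t 0<c)))) fits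
        wipe : D (rep aLo aHi e wipeStep tt) (home-at (t ∸ 1) 0 (t ∸ 1) 0 0 ct) tt (home-at (t ∸ 1) 0 (t ∸ 1) 0 t (wiped t ct))
        wipe = subst (λ z → D (rep aLo aHi e wipeStep tt) (home-at (t ∸ 1) 0 (t ∸ 1) 0 0 ct) tt (home-at (t ∸ 1) 0 (t ∸ 1) 0 z (wiped z ct))) (1+[N^e∸1] x e)
          (rep-does (λ a₀ a₁ i → home-at a₀ a₁ (t ∸ 1) 0 i (wiped i ct)) (λ _ → tt) (t ∸ 1) (λ i → loA) (λ i → hiA)
            (≤-<-trans (m∸n≤m t 1) t<V) (≤-reflexive (1+[N^e∸1] x e)) λ i a₀ a₁ i≤ →
              let i<t = ≤-trans (s≤s i≤) (≤-reflexive (1+[N^e∸1] x e)) in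
              wrC-does false (subst (i <_) (sym (length-wiped i ct)) (<-trans i<t t<len)) ▷
                cR-does (subst (suc i <_) (sym (length-wiped (suc i) ct)) (≤-<-trans i<t t<len)))
        return : D (rep aLo aHi e (λ _ → cL) tt) (home-at (t ∸ 1) 0 (t ∸ 1) 0 t (wiped t ct)) tt (home-at (t ∸ 1) 0 (t ∸ 1) 0 0 (wiped t ct))
        return = to (cong (λ z → home-at (t ∸ 1) 0 (t ∸ 1) 0 z (wiped t ct)) (trans (cong (t ∸_) (1+[N^e∸1] x e)) (n∸n≡0 t)))
          (rep-does (λ a₀ a₁ i → home-at a₀ a₁ (t ∸ 1) 0 (t ∸ i) (wiped t ct)) (λ _ → tt) (t ∸ 1) (λ i → loA) (λ i → hiA)
            (≤-<-trans (m∸n≤m t 1) t<V) (≤-reflexive (1+[N^e∸1] x e)) one)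
          where
          one : ∀ i a₀ a₁ → i ≤ t ∸ 1 → D cL (home-at a₀ a₁ (t ∸ 1) 0 (t ∸ i) (wiped t ct)) tt (home-at a₀ a₁ (t ∸ 1) 0 (t ∸ suc i) (wiped t ct))
          one i a₀ a₁ i≤ = subst (λ z → D cL (home-at a₀ a₁ (t ∸ 1) 0 z (wiped t ct)) tt (home-at a₀ a₁ (t ∸ 1) 0 (t ∸ suc i) (wiped t ct))) (sym down)
            (cL-does (≤-<-trans (≤-trans (≤-reflexive (sym down)) (m∸n≤m t i)) (subst (t <_) (sym (length-wiped t ct)) t<len)))
            where
            down : t ∸ i ≡ suc (t ∸ suc i)
            down = ∸-peel (≤-trans (s≤s i≤) (≤-reflexive (1+[N^e∸1] x e)))

      found-nothing : ∀ m → found m ≡ nothing → ∀ i → i < m → blockAnswer i ≡ nothing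
      found-nothing (suc m) eq i i<m with found m in feq
      found-nothing (suc m) eq i i<m | nothing with i ≟ m
      ... | yes refl = eq
      ... | no ¬p    = found-nothing m feq i (≤∧≢⇒< (s≤s⁻¹ i<m) ¬p)

      found-just : ∀ m {b} → found m ≡ just b → ∃ λ i → i < m × blockAnswer i ≡ just b
      found-just (suc m) eq with found m in feq
      ... | nothing = m , ≤-refl , eq
      found-just (suc m) refl | just b with found-just m feq
      ... | i , i<m , ans = i , m≤n⇒m≤1+n i<m , ans

    blocks-bad : ∀ {P : List Bool → Set} (P? : ∀ l → Dec (P l)) m ct → (∀ i → i < m → P (take c (drop (i * c) ct))) →
      Blockwise.AllBlocks P? c m ct
    blocks-bad P? zero    ct f = tt
    blocks-bad {P} P? (suc m) ct f = f 0 (s≤s z≤n) , blocks-bad P? m (drop c ct) λ i i<m →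
      subst (λ z → P (take c z)) (sym (drop-drop c (i * c) ct)) (f (suc i) (s≤s i<m))

-- The polynomial time machine on the erased tape

module DirectRun (M : Machine) where
  open Machine M
  open Tour M using (Halts; stops; steps)

  -- the machine M run with the catalytic tape as its work tape
  runWrites : Bool → Bool → Action Q → Writes
  runWrites a b (halt _)             = writes a b S S S
  runWrites a b (go _ ww _ mi mw _) = writes a ww mi S mw

  runNext : Action Q → Prog (Fin Q ⊎ Bool)
  runNext (halt b)          = ret (inj₂ b)
  runNext (go st _ _ _ _ _) = ret (inj₁ st)

  -- The roles are exchanged: the catalytic symbol `b` is passed to `δ` as the work symbol. The
  -- catalytic tape of a machine for `InP` is empty and always reads `false`.
  runRound : Fin Q → Prog (Fin Q ⊎ Bool)
  runRound q = bind (act λ (i , a , b) → runWrites a b (δ q i b false)) λ (i , a , b) → runNext (δ q i b false)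

  runP : ℕ → Prog Bool
  runP k = loop k runRound start

  module _ (x : List Bool) (len : ℕ) where

    data RunRep : Config Q → Mem → Set where
      runRep : ∀ {q ih l wh ch w p c} → length l ≡ len → len ≤ length c → (∀ i → i < len → read c i ≡ read l i) →
        RunRep (config q ih l wh [] ch) (mem ih w p c wh)

    private
      move-same : ∀ {a b h} m → suc h < a → suc h < b → move a m h ≡ move b m h
      move-same {h = zero}  L _ _ = refl
      move-same {h = suc h} L _ _ = refl
      move-same             S _ _ = refl
      move-same             R p q = trans (move-R p) (sym (move-R q))

      move≤ : ∀ {a} m h → move a m h ≤ suc h
      move≤     L zero    = z≤n
      move≤     L (suc h) = m≤n⇒m≤1+n (n≤1+n h)
      move≤     S h       = n≤1+n h
      move≤ {a} R h with suc h <ᵇ a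
      ... | true  = ≤-refl
      ... | false = n≤1+n h

      same-cells : ∀ c l wh v → length l ≡ len → len ≤ length c → wh < len → (∀ i → i < len → read c i ≡ read l i) →
        ∀ i → i < len → read (write c wh v) i ≡ read (write l wh v) i
      same-cells c l wh v refl len≤ wh< cells i i< with wh ≟ i
      ... | yes refl = trans (read-write-same c wh v (<-≤-trans wh< len≤)) (sym (read-write-same l wh v wh<))
      ... | no ¬p    = trans (read-write-other c wh i v ¬p) (trans (cells i i<) (sym (read-write-other l wh i v ¬p)))

    -- The catalytic tape may be longer than the work tape it stands for, so the two behave
    -- differently at the right end. With head position plus remaining time below `len`, the head
    -- has no time to try a move beyond that end.
    run-rounds : ∀ {b τ q ih l wh ch m} → Halts x b τ (config q ih l wh [] ch) m → wh + m < len →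
      ∃ λ v′ → Rounds x {Rep = RunRep} runRound q (config q ih l wh [] ch) (suc m) b v′
    run-rounds {b} {q = q} {ih} {l} {wh} {ch} (stops eq _) room = config q ih l wh [] ch , last (lift-Is x λ where
      (mem .ih w p c .wh) (runRep len≡ len≤ cells) →
        let δ≡ = trans (cong (λ z → δ q (readIn x ih) z false) (cells wh wh<)) eq in
        mem ih w p c wh ,
        subst (Does x (Is x) (act _) (mem ih w p c wh) (reads x (mem ih w p c wh)))
            (trans (cong (λ α → apply x (runWrites (read w p) (read c wh) α) (mem ih w p c wh)) δ≡) (apply-keep x (mem ih w p c wh))) (Does-act x) ▷
          subst (λ α → Does x (Is x) (runNext α) (mem ih w p c wh) (inj₂ b) (mem ih w p c wh)) (sym δ≡) (Does-ret) ,
        runRep {l = l} len≡ len≤ cells)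
      where
      wh< : wh < len
      wh< = ≤-<-trans (m≤m+n wh 0) room
    run-rounds {b} {q = q} {ih} {l} {wh} {ch} {suc m} (steps {st = st} {ww} {cw} {mi} {mw} {mc} eq h) room =
      proj₁ IH , again (lift-Is x λ where
        (mem .ih w p c .wh) (runRep len≡ len≤ cells) →
          let δ≡ = trans (cong (λ z → δ q (readIn x ih) z false) (cells wh (<-trans (n<1+n wh) swh<))) eq
              σ  = mem ih w p c wh
              σ′ = mem (move (suc (length x)) mi ih) w p (write c wh ww) (move (length l) mw wh) in
          σ′ ,
          subst (Does x (Is x) (act _) σ (reads x σ))
              (trans (cong (λ α → apply x (runWrites (read w p) (read c wh) α) σ) δ≡)
                (cong₂ (λ u v → mem (move (suc (length x)) mi ih) u p (write c wh ww) v) (write-read w p)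
                  (move-same mw (<-≤-trans swh< len≤) (subst (suc wh <_) (sym len≡) swh<)))) (Does-act x) ▷
            subst (λ α → Does x (Is x) (runNext α) σ′ (inj₁ st) σ′) (sym δ≡) (Does-ret) ,
          runRep (trans (length-write l wh ww) len≡) (subst (len ≤_) (sym (length-write c wh ww)) len≤)
            (same-cells c l wh ww len≡ len≤ (<-trans (n<1+n wh) swh<) cells))
        (proj₂ IH)
      where
      swh< : suc wh < len
      swh< = ≤-<-trans (≤-trans (s≤s (m≤m+n wh m)) (≤-reflexive (sym (+-suc wh m)))) room
      IH : ∃ λ v′ → Rounds x {Rep = RunRep} runRound st
        (config st (move (suc (length x)) mi ih) (write l wh ww) (move (length l) mw wh) [] (move 0 mc ch)) (suc m) b v′
      IH = run-rounds h (≤-<-trans (≤-trans (+-monoˡ-≤ m (move≤ mw wh)) (≤-reflexive (sym (+-suc wh m)))) room)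

    runP-does : ∀ {b τ k m} → Halts x b τ (config start 0 (replicate len false) 0 [] 0) m → m < len → suc m ≤ N x ^ k →
      ∃ λ v′ → Does x RunRep (runP k) (config start 0 (replicate len false) 0 [] 0) b v′
    runP-does h m<len m≤ = let v′ , rs = run-rounds h m<len in v′ , Does-loop x rs m≤

-- The converse inclusion

PolyBounded : (List Bool → ℕ) → Set
PolyBounded f = ∃ λ e → ∀ x → f x ≤ N x ^ e

poly-const : ∀ a → PolyBounded (λ _ → a)
poly-const a = a , λ x → ≤-trans (<⇒≤ (n<2^n a)) (Bounds.2^≤N^ x a)

poly-* : ∀ {f g} → PolyBounded f → PolyBounded g → PolyBounded (λ x → f x * g x)
poly-* (a , p) (b , q) = a + b , λ x → ≤-trans (*-mono-≤ (p x) (q x)) (≤-reflexive (sym (^-distribˡ-+-* (N x) a b)))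

poly-suc : ∀ {f} → PolyBounded f → PolyBounded (λ x → suc (f x))
poly-suc (a , p) = suc a , λ x → ≤-trans (s≤s (p x)) (N^+N^ x {0} {a} {a} z≤n ≤-refl)

poly-^ : ∀ {f} → PolyBounded f → ∀ d → PolyBounded (λ x → f x ^ d)
poly-^ p zero    = poly-const 1
poly-^ p (suc d) = poly-* p (poly-^ p d)

poly-N^ : ∀ k → PolyBounded (λ x → N x ^ k)
poly-N^ k = k , λ x → ≤-refl

poly-space : ∀ k → PolyBounded (λ x → Bounds.space x k)
poly-space k = suc k , λ x → <⇒≤ (Bounds.space<N^ x k)

-- Here logarithmic space is used: the factor 2 for the possible extra cell is at most N, and 2^ℓ ≤
-- N^2 gives N^(2k) for the rest.
poly-2^space : ∀ k → PolyBounded (λ x → 2 ^ Bounds.space x k)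
poly-2^space k = 1 + 2 * k , λ x → let open Bounds x in
  ≤-trans (^-monoʳ-≤ 2 (space≤ k))
    (≤-trans (*-mono-≤ (2≤N x) (≤-trans (≤-reflexive (trans (cong (2 ^_) (*-comm k ℓ)) (sym (^-*-assoc 2 ℓ k))))
        (≤-trans (^-monoˡ-≤ k 2^ℓ≤N²) (≤-reflexive (^-*-assoc (N x) 2 k))))) ≤-refl)

-- Only contents with all t blocks bad contribute, each at most the whole tape length. They make up
-- at most a 2^-t part of all contents, which outweighs the tape length up to the constant C.
average-bound : ∀ {P : List Bool → Set} (P? : Decidable P) c t total C (f : List Bool → ℕ) →
  2 * length (filter P? (allBits c)) ≤ 2 ^ c → t * c ≤ total → total ≤ C * 2 ^ t →
  (∀ l → length l ≡ total → f l ≤ total) → (∀ l → length l ≡ total → ¬ Blockwise.AllBlocks P? c t l → f l ≡ 0) →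
  sum (map f (allBits total)) ≤ C * 2 ^ total
average-bound P? c t total C f half fits small bounded vanishes = begin
  sum (map f (allBits total))
    ≤⟨ sum≤filter (allBlocks? t) f total (allBits total) (λ p → bounded _ (∈-allBits⁻ p)) (λ p → vanishes _ (∈-allBits⁻ p)) ⟩
  total * count
    ≤⟨ *-monoˡ-≤ count small ⟩
  C * 2 ^ t * count
    ≡⟨ *-assoc C (2 ^ t) count ⟩
  C * (2 ^ t * count)
    ≤⟨ *-monoʳ-≤ C (subst (λ z → 2 ^ t * length (filter (allBlocks? t) (allBits z)) ≤ 2 ^ z) (m+[n∸m]≡n fits)
         (count-AllBlocks half t (total ∸ t * c))) ⟩
  C * 2 ^ total ∎
  where
  open ≤-Reasoning
  open Blockwise P? c
  count : ℕ
  count = length (filter (allBlocks? t) (allBits total))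

-- From N < 2^N and N K ≤ K^2 + N^2. The factor 2^(K K) becomes the bound on the average distance of
-- the new machine, uniformly in the input.
N^K≤ : ∀ x K e → 2 ≤ e → N x ^ K ≤ 2 ^ (K * K) * 2 ^ (N x ^ e)
N^K≤ x K e 2≤e = begin
  N x ^ K                       ≤⟨ ^-monoˡ-≤ K (<⇒≤ (n<2^n (N x))) ⟩
  (2 ^ N x) ^ K                 ≡⟨ ^-*-assoc 2 (N x) K ⟩
  2 ^ (N x * K)                 ≤⟨ ^-monoʳ-≤ 2 (product≤ (N x) K) ⟩
  2 ^ (K * K + N x * N x)       ≤⟨ ^-monoʳ-≤ 2 (+-monoʳ-≤ (K * K) (≤-trans (≤-reflexive (cong (N x *_) (sym (*-identityʳ (N x))))) (N^-mono x 2≤e))) ⟩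
  2 ^ (K * K + N x ^ e)         ≡⟨ ^-distribˡ-+-* 2 (K * K) (N x ^ e) ⟩
  2 ^ (K * K) * 2 ^ (N x ^ e)   ∎
  where
  open ≤-Reasoning
  product≤ : ∀ a b → a * b ≤ b * b + a * a
  product≤ a b with ≤-total a b
  ... | inj₁ a≤b = ≤-trans (*-monoˡ-≤ b a≤b) (m≤m+n _ _)
  ... | inj₂ b≤a = ≤-trans (*-monoʳ-≤ a b≤a) (m≤n+m _ _)

module FromAvg (Lg : Language) (k C : ℕ) (M : Machine) (T : List Bool → List Bool → ℕ)
  (halts : ∀ x τ → length τ ≡ polyB k (length x) →
    ∃ λ τ′ → runFor M (T x τ) x (init M (spaceB k (length x)) τ) ≡ halted (Lg x) τ′)
  (avg : ∀ x → sum (map (λ τ → hamming τ (finalCat (runFor M (T x τ) x (init M (spaceB k (length x)) τ)))) (allBits (polyB k (length x))))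
    ≤ C * 2 ^ polyB k (length x))
  (kP : ℕ) (MP : Machine)
  (haltsP : ∀ x → ∃ λ τ′ → runFor MP (polyB kP (length x)) x (init MP (polyB kP (length x)) []) ≡ halted (Lg x) τ′) where

  private
    M′ : Machine
    M′ = normalise k M

    F : List Bool → List Bool → List Bool
    F x τ = finalCat (runFor M (T x τ) x (init M (spaceB k (length x)) τ))

    comp : ∀ x τ → length τ ≡ N x ^ k → Tour.Comp M′ x (Lg x) (F x τ) (Tour.start-config M′ (Bounds.space x k) τ)
    comp x τ len with halts x τ len
    ... | τ′ , eq with Tour.runFor-Halts M′ x (T x τ) (normalise-run k M x (T x τ) eq)
    ... | m , _ , h = m , subst (λ z → Tour.Halts M′ x (Lg x) z (Tour.start-config M′ (Bounds.space x k) τ) m) (sym (cong finalCat eq)) h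

    abstract
      congested : PolyBounded (λ x → 4 * suc (Counting.congestion M′ x (Bounds.space x k) (N x ^ k) (4 * C + 3)))
      congested = poly-* (poly-const 4) (poly-suc (poly-* (poly-* (poly-const (Machine.Q M′))
          (poly-* (1 , λ x → ≤-trans (≤-trans (n≤1+n _) (≤-reflexive (+-comm 2 (length x)))) (≤-reflexive (sym (*-identityʳ (N x)))))
            (poly-* (poly-2^space k) (poly-* (poly-space k) (poly-N^ k)))))
        (poly-* (poly-const (suc (Tour.K M′))) (poly-^ (poly-suc (poly-N^ k)) (4 * C + 3)))))

    e : ℕ
    -- One power t = N^e is the length of the tours, the number of blocks and the number of erased
    -- cells. The first summand makes at most half of the block contents bad, `kP` provides the work
    -- tape of `MP`, and 2 gives t ≥ N^2.
    e = proj₁ congested + (kP + 2)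

    eW : ℕ
    eW = suc (suc (k + e))

    module I = Impl nregs eW

    ops : CMOps nregs
    ops = I.logOps

    open Search ops M′

  conclude : Maybe Bool → Prog Bool
  conclude (just b) = ret b
  conclude nothing  = wipeP k e ▸ DirectRun.runP MP kP

  program : Prog Bool
  program = I.setAll I.logSetup ▸ Initialise.initP ops k e ▸ bind (searchP k e) conclude

  private
    B : ℕ
    B = Tracks.B nregs eW

    abstract
      K : ℕ
      -- The summands pay for the work tape, for t + 1 blocks of catalytic tape and for the running
      -- time. All tapes and the clock of a machine share one exponent.
      K = (eW * B + suc (e + k)) + expo program

      eW*B≤K : eW * B ≤ K
      eW*B≤K = ≤-trans (m≤m+n (eW * B) (suc (e + k))) (m≤m+n _ (expo program))

      1+e+k≤K : suc (e + k) ≤ K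
      1+e+k≤K = ≤-trans (m≤n+m (suc (e + k)) (eW * B)) (m≤m+n _ (expo program))

      expo≤K : expo program ≤ K
      expo≤K = m≤n+m (expo program) (eW * B + suc (e + k))

    module _ (x : List Bool) where
      open Bounds x

      c t s m : ℕ
      c = N x ^ k
      t = N x ^ e
      s = space k
      -- So many binary digits give counters up to N^(1 + k + e), above both the block length N^k
      -- and the tour length N^e.
      m = suc (k + e) * ℓ

      W≤ : suc m ≤ N x ^ eW
      W≤ = kℓ<N^ (suc (k + e))

      big : N x ^ suc (k + e) ≤ 2 ^ m
      big = ≤-trans (^-monoˡ-≤ (suc (k + e)) N≤2^ℓ) (≤-reflexive (trans (^-*-assoc 2 ℓ (suc (k + e))) (cong (2 ^_) (*-comm ℓ (suc (k + e))))))

      below : ∀ {a} → a < N x ^ suc k → a < 2 ^ m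
      below p = <-≤-trans p (≤-trans (N^-mono x (s≤s (m≤m+n k e))) big)

      spec : CMSpec ops x (2 ^ m)
      spec = I.logSpec x m W≤

      c<V : c < 2 ^ m
      c<V = below (N^< {k} {suc k} ≤-refl)

      t<V : t < 2 ^ m
      t<V = <-≤-trans (N^< {e} {suc (k + e)} (s≤s (m≤n+m e k))) big

      n<V : suc (length x) < 2 ^ m
      n<V = below (1+n<N^ k)

      0<c : 0 < c
      0<c = N^-mono x {0} {k} z≤n

      open Windows x (2 ^ m) spec s k hiding (c)

      blocks≤ : t * c + c ≤ polyB K (length x)
      blocks≤ = ≤-trans (≤-trans (+-monoˡ-≤ c (≤-reflexive (sym (^-distribˡ-+-* (N x) e k)))) (N^+N^ x {e + k} {k} {e + k} ≤-refl (m≤n+m k e)))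
        (N^-mono x 1+e+k≤K)

      work≤ : suc m * B ≤ spaceB K (length x)
      work≤ = ≤-trans (*-monoˡ-≤ B (+-monoˡ-≤ m 1≤ℓ))
        (≤-trans (≤-reflexive (trans (*-assoc eW ℓ B) (trans (cong (eW *_) (*-comm ℓ B)) (sym (*-assoc eW B ℓ)))))
          (*-monoˡ-≤ ℓ eW*B≤K))

      open Counting M′ x using (Bad; bad?; tourAnswer; bad-half; start-in)

      bad-blocks : 2 * length (filter (bad? s t) (allBits c)) ≤ 2 ^ c
      bad-blocks = bad-half (Lg x) s c (s≤s z≤n) 0<c (F x) (comp x) C t (avg x)
        (≤-trans (proj₂ congested x) (N^-mono x (m≤m+n (proj₁ congested) (kP + 2))))

      module _ (τ : List Bool) (len : length τ ≡ polyB K (length x)) where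

        fits : t * c + c ≤ length τ
        fits = subst (t * c + c ≤_) (sym len) blocks≤

        open Blocks e c<V (below (space<N^ k)) n<V t<V {τ} fits

        block : ℕ → List Bool
        block i = take c (drop (i * c) τ)

        block-in : ∀ i → i < t → Tour.In M′ x {Lg x} {F x (block i)} {s} {c} (Tour.start-config M′ s (block i) , zero)
        block-in i i<t = start-in (Lg x) s c (s≤s z≤n) 0<c (F x) (comp x) (block i)
          (length-block (i * c) (≤-trans (≤-trans (≤-reflexive (+-comm (i * c) c)) (*-monoˡ-≤ c i<t)) (≤-trans (m≤m+n (t * c) c) fits)))

        σ₀ : Mem
        σ₀ = mem 0 (replicate (spaceB K (length x)) false) 0 τ 0

        len-run : ℕ
        len-run = N x ^ kP

        Rep : Phase (CM nregs) (Config (Machine.Q MP)) → Mem → Set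
        Rep = RepPhase x σ₀ (CMSpec.Rep spec) (DirectRun.RunRep MP x len-run)

        home-state : ℕ → List Bool → CM nregs
        home-state = home-at (t ∸ 1) 0 (t ∸ 1) 0

        start-does : Does x Rep (Initialise.initP ops k e) (on (cm (vreplicate nregs 0) 0 (replicate s false) 0 τ 0)) tt (on (home-state 0 τ))
        start-does = phase-on x σ₀ _ _ (subst₂ (λ u v → Does x (CMSpec.Rep spec) (Initialise.initP ops k e)
            (cm (vreplicate nregs 0) 0 (replicate s false) 0 u 0) tt v)
          (take++drop≡id c τ) (window-at 0 (≤-trans (m≤n+m c (t * c)) fits))
          (Initialise.initP-does ops x (2 ^ m) spec M′ k e {take c τ} {drop c τ} n<V (below (kℓ<N^ k)) c<V t<V
            (length-block 0 (≤-trans (m≤n+m c (t * c)) fits))))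

        result : Maybe Bool
        result = found t

        searched : Does x Rep (searchP k e) (on (home-state 0 τ)) result (on (home-state (t * c) τ))
        searched = phase-on x σ₀ _ _ (search-does
          (λ i i<t → Lg x , F x (block i) , block-in i i<t))

        program-does : ∀ {b a} → Does x Rep (conclude result) (on (home-state (t * c) τ)) b a → Does x Rep program fresh b a
        program-does d = phase-fresh x σ₀ _ _ (I.logSetup-reach x m W≤ (≤-trans (space≤ k) (s≤s (*-monoˡ-≤ ℓ (≤-trans (m≤m+n k e) (n≤1+n _))))) (Impl.fresh work≤)) ▷
          start-does ▷ searched ▷ d

        -- If all blocks are bad, nothing is claimed about the final content; `average-bound` then
        -- charges the full tape length.
        Outcome : Set
        Outcome = ∃ λ τ′ → runFor (compile program) (polyB K (length x)) x (init (compile program) (spaceB K (length x)) τ) ≡ halted (Lg x) τ′ ×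
          (Blockwise.AllBlocks (bad? s t) c t τ ⊎ τ′ ≡ τ)

        finished : ∀ {a} {Q : Set} → Does x Rep program fresh (Lg x) a → (∀ σ′ → Rep a σ′ → Q ⊎ Mem.cat σ′ ≡ τ) →
          ∃ λ τ′ → runFor (compile program) (polyB K (length x)) x (init (compile program) (spaceB K (length x)) τ) ≡ halted (Lg x) τ′ × (Q ⊎ τ′ ≡ τ)
        finished d f = let σ′ , r , eq = compile-run x program d rep₀ expo≤K in
          Mem.cat σ′ , eq , f σ′ r

        kept : ∀ h σ′ → Rep (on (home-state h τ)) σ′ → Mem.cat σ′ ≡ τ
        kept h _ (rep₁ (I.logRep (Tracks.Representation.repB _ _ _) _ _ _)) = refl

        outcome : Outcome
        outcome = byResult result refl
          where
          byResult : ∀ r → result ≡ r → Outcome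
          byResult (just b) eq =
            let i , i<t , ans = found-just t eq
                b≡ = Tour.answer-sound M′ x t _ (block-in i i<t) ans in
            finished (program-does (subst₂ (λ r b′ → Does x Rep (conclude r) (on (home-state (t * c) τ)) b′ (on (home-state (t * c) τ)))
              (sym eq) b≡ (Does-ret))) (λ σ′ r → inj₂ (kept (t * c) σ′ r))
          byResult nothing eq =
            let τ′ , ran = haltsP x
                mP , m< , h = Tour.runFor-Halts MP x len-run ran
                v′ , d = DirectRun.runP-does MP x len-run {k = kP} h m< m< in
            finished (program-does (subst (λ r → Does x Rep (conclude r) (on (home-state (t * c) τ)) (Lg x) (off v′)) (sym eq)
              (phase-switch x σ₀ _ _ restart
                  (phase-on x σ₀ _ _ (wipe-does)) ▷
                phase-off x σ₀ _ _ d)))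
              (λ _ _ → inj₁ (blocks-bad (bad? s t) t τ
                (found-nothing t eq)))
            where
            len-run≤t : len-run ≤ t
            len-run≤t = N^-mono x (≤-trans (m≤m+n kP 2) (m≤n+m (kP + 2) (proj₁ congested)))
            t≤ : t ≤ length τ
            t≤ = ≤-trans (≤-trans (≤-reflexive (sym (*-identityʳ t))) (*-monoʳ-≤ t 0<c)) (≤-trans (m≤m+n (t * c) c) fits)
            -- Tracks and counters are simply abandoned. What `MP` needs is that the input and
            -- catalytic heads are at cell 0 and that enough cells of the catalytic tape read
            -- `false`.
            restart : ∀ σ → CMSpec.Rep spec (home-state 0 (wiped t τ)) σ →
              DirectRun.RunRep MP x len-run (config (Machine.start MP) 0 (replicate len-run false) 0 [] 0) σ
            restart _ (I.logRep (Tracks.Representation.repB _ _ _) _ _ _) = DirectRun.runRep (length-replicate len-run)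
              (≤-trans len-run≤t (≤-trans t≤ (≤-reflexive (sym (length-wiped t τ)))))
              (λ i i< → trans (read-wiped t τ t≤ i (<-≤-trans i< len-run≤t)) (sym (read-replicate len-run i)))

      average : sum (map (λ τ → hamming τ (finalCat (runFor (compile program) (polyB K (length x)) x (init (compile program) (spaceB K (length x)) τ))))
                  (allBits (polyB K (length x)))) ≤ 2 ^ (K * K) * 2 ^ polyB K (length x)
      average = average-bound (bad? s t) c t (polyB K (length x)) (2 ^ (K * K)) _ bad-blocks
        (≤-trans (m≤m+n (t * c) c) blocks≤) (N^K≤ x K e (≤-trans (m≤n+m 2 kP) (m≤n+m (kP + 2) (proj₁ congested))))
        (λ τ len → ≤-trans (hamming≤ τ _) (≤-reflexive len))
        (λ τ len ¬bad → vanishes τ ¬bad (outcome τ len))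
        where
        vanishes : ∀ τ → ¬ Blockwise.AllBlocks (bad? s t) c t τ →
          (∃ λ τ′ → runFor (compile program) (polyB K (length x)) x (init (compile program) (spaceB K (length x)) τ) ≡ halted (Lg x) τ′ ×
            (Blockwise.AllBlocks (bad? s t) c t τ ⊎ τ′ ≡ τ)) →
          hamming τ (finalCat (runFor (compile program) (polyB K (length x)) x (init (compile program) (spaceB K (length x)) τ))) ≡ 0
        vanishes τ ¬bad (τ′ , eq , inj₁ bad)  = contradiction bad ¬bad
        vanishes τ ¬bad (τ′ , eq , inj₂ same) = trans (cong (λ z → hamming τ (finalCat z)) eq) (trans (cong (hamming τ) same) (hamming-self τ))

  avgLCLP : AvgLCLP Lg
  avgLCLP = K , 2 ^ (K * K) , compile program ,
    (λ x τ len → let τ′ , eq , _ = outcome x τ len in τ′ , eq) , average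

theorem6p9 : (Lg : Language) →
    (AvgLCLP Lg → AvgLCL Lg × InP Lg) × (AvgLCL Lg × InP Lg → AvgLCLP Lg)
theorem6p9 Lg =
  (λ (k , C , M , halts , avg) →
     (k , C , M , (λ x _ → polyB k (length x)) , halts , avg) , ToP.inP Lg k M halts) ,
  (λ ((k , C , M , T , halts , avg) , (kP , MP , haltsP)) → FromAvg.avgLCLP Lg k C M T halts avg kP MP haltsP)
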